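{- For every $\varepsilon>0$ there is a constant $C_\varepsilon>0$ such that the following holds. Let $p\equiv-1$ mod $12$ be prime, fix a Farey symbol of level $p$, and consider the associated $\frac{p+1}{6}$ matrices $$\begin{pmatrix} a_{i^*+1}b_{i+1}+a_{i^*}b_i & -a_ia_{i^*}-a_{i+1}a_{i^*+1} \\ b_ib_{i^*}+b_{i+1}b_{i^*+1} & -a_{i+1}b_{i^*+1}-a_ib_{i^*} \end{pmatrix},\qquad i<i^*\text{ a pair}.\tag{$\ast$}$$ Let $K$ be a real quadratic field of discriminant $d_K$ and (wide) class number one such that $p$ splits in $K$ with $p\mathcal{O}_K=\mathfrak{p}_1\mathfrak{p}_2$ and $\mathfrak{p}_1$ does not have a generator of positive norm. Let $(u,v)$ be the positive half-integer solution to $u^2-d_Kv^2=1$ with $v$ minimal among all such, and let $a,b,c\in\mathbb{Z}$ satisfy $b^2-4ac=d_K$ and $p\mid a$. If $d_K\geq C_\varepsilon p^{24+\varepsilon}$, then the matrix $\begin{pmatrix} u+bv & 2cv \\ -2av & u-bv \end{pmatrix}\in\Gamma_0(p)$ is not contained in the subgroup of $\Gamma_0(p)$ generated by the matrices $(\ast)$.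
   Context: $\Gamma_0(p)$ denotes the image in $\mathrm{PSL}_2(\mathbb{Z})$ of the matrices with lower left entry divisible by $p$; matrices are considered as elements of $\mathrm{PSL}_2(\mathbb{Z})$. "Half-integer" means an element of $\frac12\mathbb{Z}$ (integers allowed). For $p\equiv-1$ mod $12$ put $n=\frac{p+1}{3}$. A Farey symbol of level $p$ is a sequence of reduced fractions $$\frac01=\frac{a_0}{b_0}<\frac{a_1}{b_1}<\dots<\frac{a_{n-1}}{b_{n-1}}<\frac{a_n}{b_n}=\frac11$$ with $a_{i+1}b_i-a_ib_{i+1}=1$ for all $0\leq i<n$, together with a pairing (fixed-point free involution) $i\leftrightarrow i^*$ of $\{0,\dots,n-1\}$ such that $b_ib_{i^*}+b_{i+1}b_{i^*+1}\equiv0$ mod $p$ for all $i$. Such symbols exist. (It is known that $\Gamma_0(p)$ is then freely generated by $\begin{pmatrix} 1 & 1 \\ 0 & 1 \end{pmatrix}$ together with the $\frac{p+1}{6}$ matrices $(\ast)$.) -}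

module Defs where

open import Algebra.Bundles using (Group)
open import Algebra.Definitions using (Involutive)
open import Data.Fin.Base as Fin using (Fin; inject₁; fromℕ)
open import Data.Integer.Base as ℤ using (ℤ; +_; 0ℤ; 1ℤ)
import Data.Integer.Divisibility as ℤ
import Data.Integer.Properties as ℤ
open import Data.Integer.Tactic.RingSolver using (solve-∀)
open import Data.List.Base using (List; []; _∷_)
open import Data.List.Relation.Unary.All using (All)
open import Data.Nat.Base as ℕ using (ℕ; suc; NonZero)
import Data.Nat.Divisibility as ℕ
open import Data.Product.Base using (∃; ∃₂; _×_; _,_)
open import Data.Rational.Base as ℚ using (ℚ; 0ℚ; 1ℚ; ↥_; ↧_; _/_)
import Data.Rational.Properties as ℚ
open import Data.Sum.Base using (_⊎_)
open import Level using (0ℓ; _⊔_)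
open import Relation.Binary.PropositionalEquality
open import Relation.Nullary using (¬_)
open import Relation.Unary using (Pred; _∈_; _≐_)

-- Two-sided Dedekind cuts.
record ℝ : Set₁ where
  field
    L U : Pred ℚ 0ℓ
    L-inhabited : ∃ λ q → q ∈ L
    U-inhabited : ∃ λ q → q ∈ U
    L-lower : ∀ {q r} → q ℚ.< r → r ∈ L → q ∈ L
    U-upper : ∀ {q r} → q ℚ.< r → q ∈ U → r ∈ U
    L-open : ∀ {q} → q ∈ L → ∃ λ r → q ℚ.< r × r ∈ L
    U-open : ∀ {r} → r ∈ U → ∃ λ q → q ℚ.< r × q ∈ U
    disjoint : ∀ {q} → q ∈ L → ¬ q ∈ U
    located : ∀ {q r} → q ℚ.< r → q ∈ L ⊎ r ∈ U

Positive : ℝ → Set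
Positive x = 0ℚ ∈ ℝ.L x

private
  +-−-cancel : ∀ r q → (r ℚ.+ q) ℚ.- q ≡ r
  +-−-cancel r q = begin
    (r ℚ.+ q) ℚ.- q     ≡⟨ ℚ.+-assoc r q (ℚ.- q) ⟩
    r ℚ.+ (q ℚ.- q)     ≡⟨ cong (r ℚ.+_) (ℚ.+-inverseʳ q) ⟩
    r ℚ.+ 0ℚ            ≡⟨ ℚ.+-identityʳ r ⟩
    r                   ∎
    where open ≡-Reasoning

  −-+-cancel : ∀ r q → (r ℚ.- q) ℚ.+ q ≡ r
  −-+-cancel r q = begin
    (r ℚ.- q) ℚ.+ q         ≡⟨ ℚ.+-assoc r (ℚ.- q) q ⟩
    r ℚ.+ (ℚ.- q ℚ.+ q)     ≡⟨ cong (r ℚ.+_) (ℚ.+-inverseˡ q) ⟩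
    r ℚ.+ 0ℚ                ≡⟨ ℚ.+-identityʳ r ⟩
    r                       ∎
    where open ≡-Reasoning

  −-mono-< : ∀ q {r s} → r ℚ.< s → r ℚ.- q ℚ.< s ℚ.- q
  −-mono-< q = ℚ.+-monoˡ-< (ℚ.- q)

  +-mono-<′ : ∀ q {r s} → r ℚ.- q ℚ.< s → r ℚ.< s ℚ.+ q
  +-mono-<′ q {r} {s} lt =
    subst (ℚ._< s ℚ.+ q) (−-+-cancel r q) (ℚ.+-monoˡ-< q lt)

  +-mono-<″ : ∀ q {r s} → r ℚ.< s ℚ.- q → r ℚ.+ q ℚ.< s
  +-mono-<″ q {r} {s} lt =
    subst (r ℚ.+ q ℚ.<_) (−-+-cancel s q) (ℚ.+-monoˡ-< q lt)

infixr 6 _⊕_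

_⊕_ : ℚ → ℝ → ℝ
q ⊕ x = record
  { L = λ r → r ℚ.- q ∈ L
  ; U = λ r → r ℚ.- q ∈ U
  ; L-inhabited = let (r , r∈L) = L-inhabited in
      r ℚ.+ q , subst L (sym (+-−-cancel r q)) r∈L
  ; U-inhabited = let (r , r∈U) = U-inhabited in
      r ℚ.+ q , subst U (sym (+-−-cancel r q)) r∈U
  ; L-lower = λ lt → L-lower (−-mono-< q lt)
  ; U-upper = λ lt → U-upper (−-mono-< q lt)
  ; L-open = λ s∈L → let (r , lt , r∈L) = L-open s∈L in
      r ℚ.+ q , +-mono-<′ q lt , subst L (sym (+-−-cancel r q)) r∈L
  ; U-open = λ s∈U → let (r , lt , r∈U) = U-open s∈U in
      r ℚ.+ q , +-mono-<″ q lt , subst U (sym (+-−-cancel r q)) r∈U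
  ; disjoint = disjoint
  ; located = λ lt → located (−-mono-< q lt)
  }
  where open ℝ x

infix 4 _≥_·_^_

-- The inequality d ≥ C p^x, for C > 0, x > 0 and p ≥ 1.  Then C p^x is the
-- supremum of the numbers (s/t) p^(m/k) with 0 ≤ s/t < C and 0 ≤ m/k < x, and
-- (s/t) p^(m/k) ≤ d means s^k p^m ≤ (d t)^k.
_≥_·_^_ : ℕ → ℝ → ℕ → ℝ → Set
d ≥ C · p ^ x = ∀ s t m k .{{_ : NonZero t}} .{{_ : NonZero k}} →
  + s / t ∈ ℝ.L C → + m / k ∈ ℝ.L x →
  s ℕ.^ k ℕ.* p ℕ.^ m ℕ.≤ (d ℕ.* t) ℕ.^ k

record SL₂ℤ : Set where
  constructor mat
  field
    m₁₁ m₁₂ m₂₁ m₂₂ : ℤ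
    det≡1 : m₁₁ ℤ.* m₂₂ ℤ.- m₁₂ ℤ.* m₂₁ ≡ 1ℤ

open SL₂ℤ public

infix 4 _≋_ _≈±_
infixl 7 _·ₘ_

-- Equality of entries, ignoring the proof of det≡1.
record _≋_ (M N : SL₂ℤ) : Set where
  constructor entries
  field
    eq₁₁ : m₁₁ M ≡ m₁₁ N
    eq₁₂ : m₁₂ M ≡ m₁₂ N
    eq₂₁ : m₂₁ M ≡ m₂₁ N
    eq₂₂ : m₂₂ M ≡ m₂₂ N

private
  det-· : ∀ a b c d a′ b′ c′ d′ →
    (a ℤ.* a′ ℤ.+ b ℤ.* c′) ℤ.* (c ℤ.* b′ ℤ.+ d ℤ.* d′) ℤ.-
    (a ℤ.* b′ ℤ.+ b ℤ.* d′) ℤ.* (c ℤ.* a′ ℤ.+ d ℤ.* c′) ≡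
    (a ℤ.* d ℤ.- b ℤ.* c) ℤ.* (a′ ℤ.* d′ ℤ.- b′ ℤ.* c′)
  det-· = solve-∀

  det-⁻¹ : ∀ a b c d → d ℤ.* a ℤ.- (ℤ.- b) ℤ.* (ℤ.- c) ≡ a ℤ.* d ℤ.- b ℤ.* c
  det-⁻¹ = solve-∀

  det-neg : ∀ a b c d →
    (ℤ.- a) ℤ.* (ℤ.- d) ℤ.- (ℤ.- b) ℤ.* (ℤ.- c) ≡ a ℤ.* d ℤ.- b ℤ.* c
  det-neg = solve-∀

_·ₘ_ : SL₂ℤ → SL₂ℤ → SL₂ℤ
mat a b c d δ ·ₘ mat a′ b′ c′ d′ δ′ = mat
  (a ℤ.* a′ ℤ.+ b ℤ.* c′) (a ℤ.* b′ ℤ.+ b ℤ.* d′)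
  (c ℤ.* a′ ℤ.+ d ℤ.* c′) (c ℤ.* b′ ℤ.+ d ℤ.* d′)
  (trans (det-· a b c d a′ b′ c′ d′) (cong₂ ℤ._*_ δ δ′))

1ₘ : SL₂ℤ
1ₘ = mat 1ℤ 0ℤ 0ℤ 1ℤ refl

_⁻¹ₘ : SL₂ℤ → SL₂ℤ
mat a b c d δ ⁻¹ₘ = mat d (ℤ.- b) (ℤ.- c) a (trans (det-⁻¹ a b c d) δ)

-ₘ_ : SL₂ℤ → SL₂ℤ
-ₘ mat a b c d δ =
  mat (ℤ.- a) (ℤ.- b) (ℤ.- c) (ℤ.- d) (trans (det-neg a b c d) δ)

data _≈±_ (M N : SL₂ℤ) : Set where
  plus : M ≋ N → M ≈± N
  minus : M ≋ (-ₘ N) → M ≈± N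

private
  ≋-refl : ∀ {M} → M ≋ M
  ≋-refl = entries refl refl refl refl

  ≋-sym : ∀ {M N} → M ≋ N → N ≋ M
  ≋-sym (entries p q r s) = entries (sym p) (sym q) (sym r) (sym s)

  ≋-trans : ∀ {M N P} → M ≋ N → N ≋ P → M ≋ P
  ≋-trans (entries p q r s) (entries p′ q′ r′ s′) =
    entries (trans p p′) (trans q q′) (trans r r′) (trans s s′)

  neg-cong : ∀ {M N} → M ≋ N → (-ₘ M) ≋ (-ₘ N)
  neg-cong (entries p q r s) =
    entries (cong ℤ.-_ p) (cong ℤ.-_ q) (cong ℤ.-_ r) (cong ℤ.-_ s)

  neg-neg : ∀ M → (-ₘ (-ₘ M)) ≋ M
  neg-neg (mat a b c d _) =
    entries (ℤ.neg-involutive a) (ℤ.neg-involutive b)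
            (ℤ.neg-involutive c) (ℤ.neg-involutive d)

  ≈-sym : ∀ {M N} → M ≈± N → N ≈± M
  ≈-sym (plus e) = plus (≋-sym e)
  ≈-sym {M} {N} (minus e) =
    minus (≋-sym (≋-trans (neg-cong e) (neg-neg N)))

  ≈-trans : ∀ {M N P} → M ≈± N → N ≈± P → M ≈± P
  ≈-trans (plus e) (plus f) = plus (≋-trans e f)
  ≈-trans (plus e) (minus f) = minus (≋-trans e f)
  ≈-trans (minus e) (plus f) = minus (≋-trans e (neg-cong f))
  ≈-trans {P = P} (minus e) (minus f) =
    plus (≋-trans e (≋-trans (neg-cong f) (neg-neg P)))

  ·-cong : ∀ {M N P Q} → M ≋ N → P ≋ Q → (M ·ₘ P) ≋ (N ·ₘ Q)
  ·-cong (entries refl refl refl refl) (entries refl refl refl refl) =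
    entries refl refl refl refl

  neg-·ˡ : ∀ M N → ((-ₘ M) ·ₘ N) ≋ (-ₘ (M ·ₘ N))
  neg-·ˡ (mat a b c d _) (mat a′ b′ c′ d′ _) =
    entries (e a b a′ c′) (e a b b′ d′) (e c d a′ c′) (e c d b′ d′)
    where
    e : ∀ x y z w →
      (ℤ.- x) ℤ.* z ℤ.+ (ℤ.- y) ℤ.* w ≡ ℤ.- (x ℤ.* z ℤ.+ y ℤ.* w)
    e = solve-∀

  neg-·ʳ : ∀ M N → (M ·ₘ (-ₘ N)) ≋ (-ₘ (M ·ₘ N))
  neg-·ʳ (mat a b c d _) (mat a′ b′ c′ d′ _) =
    entries (e a b a′ c′) (e a b b′ d′) (e c d a′ c′) (e c d b′ d′)
    where
    e : ∀ x y z w →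
      x ℤ.* (ℤ.- z) ℤ.+ y ℤ.* (ℤ.- w) ≡ ℤ.- (x ℤ.* z ℤ.+ y ℤ.* w)
    e = solve-∀

  ≈-·-cong : ∀ {M N P Q} → M ≈± N → P ≈± Q → (M ·ₘ P) ≈± (N ·ₘ Q)
  ≈-·-cong (plus e) (plus f) = plus (·-cong e f)
  ≈-·-cong {N = N} {Q = Q} (plus e) (minus f) =
    minus (≋-trans (·-cong e f) (neg-·ʳ N Q))
  ≈-·-cong {N = N} {Q = Q} (minus e) (plus f) =
    minus (≋-trans (·-cong e f) (neg-·ˡ N Q))
  ≈-·-cong {N = N} {Q = Q} (minus e) (minus f) =
    plus (≋-trans (·-cong e f) (≋-trans (neg-·ˡ N (-ₘ Q))
      (≋-trans (neg-cong (neg-·ʳ N Q)) (neg-neg (N ·ₘ Q)))))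

  ≈-⁻¹-cong : ∀ {M N} → M ≈± N → (M ⁻¹ₘ) ≈± (N ⁻¹ₘ)
  ≈-⁻¹-cong (plus (entries p q r s)) =
    plus (entries s (cong ℤ.-_ q) (cong ℤ.-_ r) p)
  ≈-⁻¹-cong (minus (entries p q r s)) =
    minus (entries s (cong ℤ.-_ q) (cong ℤ.-_ r) p)

  ·-assoc : ∀ M N P → ((M ·ₘ N) ·ₘ P) ≋ (M ·ₘ (N ·ₘ P))
  ·-assoc (mat a b c d _) (mat a′ b′ c′ d′ _) (mat a″ b″ c″ d″ _) =
    entries (e a b a′ b′ c′ d′ a″ c″) (e a b a′ b′ c′ d′ b″ d″)
            (e c d a′ b′ c′ d′ a″ c″) (e c d a′ b′ c′ d′ b″ d″)
    where
    e : ∀ x y a b c d z w →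
      (x ℤ.* a ℤ.+ y ℤ.* c) ℤ.* z ℤ.+ (x ℤ.* b ℤ.+ y ℤ.* d) ℤ.* w ≡
      x ℤ.* (a ℤ.* z ℤ.+ b ℤ.* w) ℤ.+ y ℤ.* (c ℤ.* z ℤ.+ d ℤ.* w)
    e = solve-∀

  ·-identityˡ : ∀ M → (1ₘ ·ₘ M) ≋ M
  ·-identityˡ (mat a b c d _) = entries (e a c) (e b d) (e′ a c) (e′ b d)
    where
    e : ∀ x y → 1ℤ ℤ.* x ℤ.+ 0ℤ ℤ.* y ≡ x
    e = solve-∀
    e′ : ∀ x y → 0ℤ ℤ.* x ℤ.+ 1ℤ ℤ.* y ≡ y
    e′ = solve-∀

  ·-identityʳ : ∀ M → (M ·ₘ 1ₘ) ≋ M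
  ·-identityʳ (mat a b c d _) = entries (e a b) (e′ a b) (e c d) (e′ c d)
    where
    e : ∀ x y → x ℤ.* 1ℤ ℤ.+ y ℤ.* 0ℤ ≡ x
    e = solve-∀
    e′ : ∀ x y → x ℤ.* 0ℤ ℤ.+ y ℤ.* 1ℤ ≡ y
    e′ = solve-∀

  ·-inverseˡ : ∀ M → ((M ⁻¹ₘ) ·ₘ M) ≋ 1ₘ
  ·-inverseˡ (mat a b c d δ) =
    entries (trans (e₁ a b c d) δ) (e₂ b d) (e₃ a c) (trans (e₄ a b c d) δ)
    where
    e₁ : ∀ a b c d → d ℤ.* a ℤ.+ (ℤ.- b) ℤ.* c ≡ a ℤ.* d ℤ.- b ℤ.* c
    e₁ = solve-∀
    e₂ : ∀ b d → d ℤ.* b ℤ.+ (ℤ.- b) ℤ.* d ≡ 0ℤ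
    e₂ = solve-∀
    e₃ : ∀ a c → (ℤ.- c) ℤ.* a ℤ.+ a ℤ.* c ≡ 0ℤ
    e₃ = solve-∀
    e₄ : ∀ a b c d → (ℤ.- c) ℤ.* b ℤ.+ a ℤ.* d ≡ a ℤ.* d ℤ.- b ℤ.* c
    e₄ = solve-∀

  ·-inverseʳ : ∀ M → (M ·ₘ (M ⁻¹ₘ)) ≋ 1ₘ
  ·-inverseʳ (mat a b c d δ) =
    entries (trans (e₁ a b c d) δ) (e₂ a b) (e₃ c d) (trans (e₄ a b c d) δ)
    where
    e₁ : ∀ a b c d → a ℤ.* d ℤ.+ b ℤ.* (ℤ.- c) ≡ a ℤ.* d ℤ.- b ℤ.* c
    e₁ = solve-∀
    e₂ : ∀ a b → a ℤ.* (ℤ.- b) ℤ.+ b ℤ.* a ≡ 0ℤ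
    e₂ = solve-∀
    e₃ : ∀ c d → c ℤ.* d ℤ.+ d ℤ.* (ℤ.- c) ≡ 0ℤ
    e₃ = solve-∀
    e₄ : ∀ a b c d → c ℤ.* (ℤ.- b) ℤ.+ d ℤ.* a ≡ a ℤ.* d ℤ.- b ℤ.* c
    e₄ = solve-∀

PSL₂ℤ : Group 0ℓ 0ℓ
PSL₂ℤ = record
  { Carrier = SL₂ℤ
  ; _≈_ = _≈±_
  ; _∙_ = _·ₘ_
  ; ε = 1ₘ
  ; _⁻¹ = _⁻¹ₘ
  ; isGroup = record
    { isMonoid = record
      { isSemigroup = record
        { isMagma = record
          { isEquivalence = record
            { refl = plus ≋-refl ; sym = ≈-sym ; trans = ≈-trans }
          ; ∙-cong = ≈-·-cong
          }
        ; assoc = λ M N P → plus (·-assoc M N P)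
        }
      ; identity = (λ M → plus (·-identityˡ M)) , (λ M → plus (·-identityʳ M))
      }
    ; inverse = (λ M → plus (·-inverseˡ M)) , (λ M → plus (·-inverseʳ M))
    ; ⁻¹-cong = ≈-⁻¹-cong
    }
  }

Γ₀ : ℕ → Pred SL₂ℤ 0ℓ
Γ₀ p M = + p ℤ.∣ m₂₁ M

module _ {c ℓ} (G : Group c ℓ) where
  open Group G

  data Generated {s} (S : Pred Carrier s) : Pred Carrier (c ⊔ ℓ ⊔ s) where
    gen : ∀ {x} → x ∈ S → x ∈ Generated S
    gen-ε : ε ∈ Generated S
    gen-∙ : ∀ {x y} → x ∈ Generated S → y ∈ Generated S →
            x ∙ y ∈ Generated S
    gen-⁻¹ : ∀ {x} → x ∈ Generated S → x ⁻¹ ∈ Generated S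
    gen-≈ : ∀ {x y} → x ≈ y → x ∈ Generated S → y ∈ Generated S

-- A reduced fraction with positive denominator is exactly an element of ℚ.
record FareySymbol (p : ℕ) : Set where
  n : ℕ
  n = (p ℕ.+ 1) ℕ./ 3

  field
    fraction : Fin (suc n) → ℚ

  a : Fin (suc n) → ℤ
  a i = ↥ fraction i

  b : Fin (suc n) → ℤ
  b i = ↧ fraction i

  -- The indices i and i + 1 in {0,…,n}, for 0 ≤ i < n.
  lo : Fin n → Fin (suc n)
  lo i = inject₁ i

  hi : Fin n → Fin (suc n)
  hi i = Fin.suc i

  field
    first : fraction Fin.zero ≡ 0ℚ
    last : fraction (fromℕ n) ≡ 1ℚ
    increasing : ∀ i → fraction (lo i) ℚ.< fraction (hi i)
    unimodular : ∀ i → a (hi i) ℤ.* b (lo i) ℤ.- a (lo i) ℤ.* b (hi i) ≡ 1ℤ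
    _* : Fin n → Fin n
    *-involutive : Involutive _≡_ _*
    *-fixedPointFree : ∀ i → i * ≢ i
    congruence : ∀ i →
      + p ℤ.∣ b (lo i) ℤ.* b (lo (i *)) ℤ.+ b (hi i) ℤ.* b (hi (i *))

  private
    det-identity : ∀ a b a′ b′ c d c′ d′ →
      (c′ ℤ.* b′ ℤ.+ c ℤ.* b) ℤ.* (ℤ.- (a′ ℤ.* d′) ℤ.- a ℤ.* d) ℤ.-
      (ℤ.- (a ℤ.* c) ℤ.- a′ ℤ.* c′) ℤ.* (b ℤ.* d ℤ.+ b′ ℤ.* d′) ≡
      (a′ ℤ.* b ℤ.- a ℤ.* b′) ℤ.* (c′ ℤ.* d ℤ.- c ℤ.* d′)
    det-identity = solve-∀

  pairingMatrix : Fin n → SL₂ℤ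
  pairingMatrix i = mat
    (a (hi (i *)) ℤ.* b (hi i) ℤ.+ a (lo (i *)) ℤ.* b (lo i))
    (ℤ.- (a (lo i) ℤ.* a (lo (i *))) ℤ.- a (hi i) ℤ.* a (hi (i *)))
    (b (lo i) ℤ.* b (lo (i *)) ℤ.+ b (hi i) ℤ.* b (hi (i *)))
    (ℤ.- (a (hi i) ℤ.* b (hi (i *))) ℤ.- a (lo i) ℤ.* b (lo (i *)))
    (trans
      (det-identity (a (lo i)) (b (lo i)) (a (hi i)) (b (hi i))
        (a (lo (i *))) (b (lo (i *))) (a (hi (i *))) (b (hi (i *))))
      (cong₂ ℤ._*_ (unimodular i) (unimodular (i *))))

  pairingMatrix∈Γ₀ : ∀ i → pairingMatrix i ∈ Γ₀ p
  pairingMatrix∈Γ₀ = congruence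

  pairingMatrices : Pred SL₂ℤ 0ℓ
  pairingMatrices M = ∃ λ i → i Fin.< i * × M ≡ pairingMatrix i

ι : ℤ → ℚ
ι m = m / 1

-- The field ℚ(√D).  Every real quadratic field is of this form for a unique D.
record RealQuadraticField : Set where
  field
    D : ℕ
    1<D : 1 ℕ.< D
    squarefree : ∀ k → k ℕ.* k ℕ.∣ D → k ≡ 1

module _ (K : RealQuadraticField) where
  open RealQuadraticField K

  -- x ∔ y √D stands for x + y√D.
  record Element : Set where
    constructor _∔_√D
    field
      re im : ℚ

  open Element

  private
    D′ : ℚ
    D′ = ι (+ D)

  embed : ℚ → Element
  embed x = x ∔ 0ℚ √D

  infixl 6 _+ᴷ_
  infixl 7 _*ᴷ_

  _+ᴷ_ _*ᴷ_ : Element → Element → Element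
  α +ᴷ β = (re α ℚ.+ re β) ∔ (im α ℚ.+ im β) √D
  α *ᴷ β = (re α ℚ.* re β ℚ.+ D′ ℚ.* (im α ℚ.* im β))
           ∔ (re α ℚ.* im β ℚ.+ im α ℚ.* re β) √D

  0ᴷ 1ᴷ : Element
  0ᴷ = embed 0ℚ
  1ᴷ = embed 1ℚ

  trace norm : Element → ℚ
  trace α = re α ℚ.+ re α
  norm α = re α ℚ.* re α ℚ.- D′ ℚ.* (im α ℚ.* im α)

  -- evalMonic (c₀ ∷ … ∷ cₖ₋₁ ∷ []) α = c₀ + c₁ α + … + cₖ₋₁ αᵏ⁻¹ + αᵏ
  evalMonic : List ℤ → Element → Element
  evalMonic [] α = 1ᴷ
  evalMonic (c ∷ cs) α = embed (ι c) +ᴷ α *ᴷ evalMonic cs α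

  𝓞 : Pred Element 0ℓ
  𝓞 α = ∃ λ cs → evalMonic cs α ≡ 0ᴷ

  IsIntegralBasis : Element → Element → Set
  IsIntegralBasis ω₁ ω₂ =
    ω₁ ∈ 𝓞 × ω₂ ∈ 𝓞 ×
    (∀ α → α ∈ 𝓞 → ∃₂ λ m n → α ≡ embed (ι m) *ᴷ ω₁ +ᴷ embed (ι n) *ᴷ ω₂) ×
    (∀ m n → embed (ι m) *ᴷ ω₁ +ᴷ embed (ι n) *ᴷ ω₂ ≡ 0ᴷ → m ≡ 0ℤ × n ≡ 0ℤ)

  -- The discriminant det (Tr (ωᵢ ωⱼ)) of a real quadratic field is positive, hence
  -- a natural number.
  IsDiscriminant : ℕ → Set
  IsDiscriminant d = ∃₂ λ ω₁ ω₂ → IsIntegralBasis ω₁ ω₂ ×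
    ι (+ d) ≡ trace (ω₁ *ᴷ ω₁) ℚ.* trace (ω₂ *ᴷ ω₂) ℚ.-
              trace (ω₁ *ᴷ ω₂) ℚ.* trace (ω₂ *ᴷ ω₁)

  data Span : List Element → Pred Element 0ℓ where
    [] : Span [] 0ᴷ
    _∷_ : ∀ {ρ γ γs α} → ρ ∈ 𝓞 → α ∈ Span γs → (ρ *ᴷ γ +ᴷ α) ∈ Span (γ ∷ γs)

  -- Finite generation is classically automatic.  It is part of the definition
  -- because for arbitrary predicates closed under the operations, principality
  -- of all ideals would already imply excluded middle.
  record Ideal : Set₁ where
    field
      carrier : Pred Element 0ℓ
      integral : ∀ {α} → α ∈ carrier → α ∈ 𝓞
      0∈ : 0ᴷ ∈ carrier
      +-closed : ∀ {α β} → α ∈ carrier → β ∈ carrier → α +ᴷ β ∈ carrier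
      *-closed : ∀ {ρ α} → ρ ∈ 𝓞 → α ∈ carrier → ρ *ᴷ α ∈ carrier
      generators : List Element
      generators⊆ : All (_∈ carrier) generators
      spanned : ∀ {α} → α ∈ carrier → α ∈ Span generators

  open Ideal

  Nonzero : Ideal → Set
  Nonzero I = ∃ λ α → α ∈ carrier I × α ≢ 0ᴷ

  infixr 7 _⟪*⟫_ _⟪·⟫_

  _⟪*⟫_ : Element → Pred Element 0ℓ → Pred Element 0ℓ
  (α ⟪*⟫ S) β = ∃ λ σ → σ ∈ S × β ≡ α *ᴷ σ

  data _⟪·⟫_ (I J : Ideal) : Pred Element 0ℓ where
    zero : (I ⟪·⟫ J) 0ᴷ
    add : ∀ {α β γ} → α ∈ carrier I → β ∈ carrier J →
          (I ⟪·⟫ J) γ → (I ⟪·⟫ J) (α *ᴷ β +ᴷ γ)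

  -- Equality of classes in the wide ideal class group.
  SameClass : Ideal → Ideal → Set
  SameClass I J = ∃₂ λ α β → (α ∈ 𝓞 × α ≢ 0ᴷ) × (β ∈ 𝓞 × β ≢ 0ᴷ) ×
    (α ⟪*⟫ carrier I) ≐ (β ⟪*⟫ carrier J)

  ClassNumberOne : Set₁
  ClassNumberOne = ∀ I J → Nonzero I → Nonzero J → SameClass I J

  IsPrimeIdeal : Ideal → Set
  IsPrimeIdeal 𝔭 = ¬ 1ᴷ ∈ carrier 𝔭 ×
    (∀ α β → α ∈ 𝓞 → β ∈ 𝓞 → α *ᴷ β ∈ carrier 𝔭 →
     α ∈ carrier 𝔭 ⊎ β ∈ carrier 𝔭)

  SplitsAs : ℕ → Ideal → Ideal → Set
  SplitsAs p 𝔭₁ 𝔭₂ = IsPrimeIdeal 𝔭₁ × IsPrimeIdeal 𝔭₂ ×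
    ¬ carrier 𝔭₁ ≐ carrier 𝔭₂ ×
    (embed (ι (+ p)) ⟪*⟫ 𝓞) ≐ (𝔭₁ ⟪·⟫ 𝔭₂)

  HasGeneratorOfPositiveNorm : Ideal → Set
  HasGeneratorOfPositiveNorm I = ∃ λ γ →
    γ ∈ 𝓞 × carrier I ≐ (γ ⟪*⟫ 𝓞) × 0ℚ ℚ.< norm γ

HalfInteger : Pred ℚ 0ℓ
HalfInteger x = ∃ λ m → x ≡ m / 2

record PellSolution (d : ℕ) (u v : ℚ) : Set where
  field
    u-half : HalfInteger u
    v-half : HalfInteger v
    0<u : 0ℚ ℚ.< u
    0<v : 0ℚ ℚ.< v
    equation : u ℚ.* u ℚ.- ι (+ d) ℚ.* (v ℚ.* v) ≡ 1ℚ

MinimalPellSolution : ℕ → ℚ → ℚ → Set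
MinimalPellSolution d u v = PellSolution d u v ×
  (∀ u′ v′ → PellSolution d u′ v′ → v ℚ.≤ v′)

record HasEntries (M : SL₂ℤ) (w x y z : ℚ) : Set where
  field
    eq₁₁ : ι (m₁₁ M) ≡ w
    eq₁₂ : ι (m₁₂ M) ≡ x
    eq₂₁ : ι (m₂₁ M) ≡ y
    eq₂₂ : ι (m₂₂ M) ≡ z

{-# OPTIONS --safe #-}

-- The polygon P with vertices ∞, a₀/b₀, …, aₙ/bₙ is a fundamental domain of Γ₀(p): its sides
-- are glued by the pairing matrices and by the translation between its two vertical sides.
-- The group H generated by the pairing matrices alone plays ping-pong on the intervals
-- [aᵢ/bᵢ, aᵢ₊₁/bᵢ₊₁], and so maps the complement J of (0, 1) into [0, 1].  Conversely H moves
-- every cusp x/z with p ∣ z into J: the only obstruction would be a vertex aᵢ/bᵢ with p ∣ bᵢ, and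
-- there is none, because the p + 1 angles of the n triangles of P are all used up by ∞ and by the
-- vertices equivalent to 0.
--
-- Suppose M ∈ H and F is its fixed point form.  After conjugation in H, M maps J into [0, 1] and
-- the cusp x/z lies in J.  Then both fixed points lie in [0, 1], and (tr M)² − 4 ≤ 4 F(x, z)².
-- For the matrix M of the theorem, (tr M)² − 4 = 4 d v², and F is −2v times the form (a, b, c).
-- As (a/p, b, pc) has discriminant d, class number one implies that it represents ±1, say at
-- (x, y), so that F(x, py) = ± 2 v p, and we get d ≤ 4p².

module Submission where

open import Data.Integer.Base as ℤ using (ℤ; +_)
open import Data.Integer.Divisibility as ℤD using ()
open import Data.Nat.Base as ℕ using (ℕ)
open import Data.Nat.Divisibility as ℕD using ()
open import Data.Nat.Primality using (Prime)
open import Data.Product.Base using (∃; _×_)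
open import Data.Rational.Base as ℚ using (ℚ)
open import Relation.Binary.PropositionalEquality using (_≡_)
open import Relation.Nullary using (¬_)
open import Relation.Unary using (_∈_)
open import Defs

open import Algebra.Bundles using (Group)
open import Algebra.Definitions using (Involutive)
import Algebra.Properties.Group as GroupProperties
open import Data.Fin.Base as Fin using (Fin; toℕ; fromℕ; fromℕ<)
open import Data.Fin.Permutation using (permutation)
import Data.Fin.Properties as Fin
open import Data.Integer.Base using (-[1+_]; 0ℤ; 1ℤ; ∣_∣; +≤+; +<+; -≤+; -<+; _+_; _*_; _-_; -_; _≤_; _<_)
open import Data.Integer.Divisibility.Signed as ∣ using (divides) renaming (_∣_ to _∣ˢ_; _∣?_ to _∣ˢ?_)
import Data.Integer.Properties as ℤ
open import Data.Integer.Tactic.RingSolver using (solve-∀)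
open import Data.List.Base using (List; []; _∷_; _++_)
import Data.List.Relation.Unary.All as All
open import Data.List.Relation.Unary.Linked as Linked using (Linked; []; [-]; _∷_)
open import Data.Maybe.Base using (Maybe; just; nothing)
open import Data.Nat.Base using (zero; suc; z≤n; s≤s)
open import Data.Nat.Coprimality using (Coprime; coprime-Bézout; coprime-divisor; recompute)
import Data.Nat.Divisibility as ℕ
import Data.Nat.DivMod as ℕ
import Data.Nat.GCD as GCD
import Data.Nat.Induction as ℕ
open import Data.Nat.Primality using (euclidsLemma; prime[2]; prime⇒irreducible; prime⇒nonTrivial; prime⇒nonZero)
import Data.Nat.Properties as ℕ
open import Data.Product.Base using (∃₂; _,_; proj₁; proj₂)
open import Data.Rational.Base using (0ℚ; 1ℚ; ½; mkℚ; toℚᵘ; ↥_; ↧_)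
import Data.Rational.Properties as ℚ
open import Data.Rational.Unnormalised.Base as ℚᵘ using (mkℚᵘ; *≡*)
import Data.Rational.Unnormalised.Properties as ℚᵘ
open import Data.Sum.Base as Sum using (_⊎_; inj₁; inj₂)
open import Induction.WellFounded using (Acc; acc)
open import Level using (0ℓ)
open import Relation.Binary.Definitions using (Tri; tri<; tri≈; tri>)
open import Relation.Binary.PropositionalEquality using (_≢_; refl; sym; trans; cong; cong₂; subst; subst₂; module ≡-Reasoning)
open import Relation.Nullary using (contradiction; Dec; yes; no)
open import Relation.Unary using (Pred)
import Tactic.RingSolver as RingSolver
open import Tactic.RingSolver.Core.AlmostCommutativeRing using (AlmostCommutativeRing; fromCommutativeRing)
open import Algebra.Properties.CommutativeMonoid.Sum ℤ.+-0-commutativeMonoid using (sum; sum-permute; ∑-distrib-+)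

-- Signs of integers

-- The proof plays two estimates of one form against each other. Two roots in [0, 1] have distance
-- √(tr² - 4)/|C| at most 1, where C is the leading coefficient, and at cusps outside [0, 1] the
-- form is at least |C| in absolute value. Class number one, however, provides a cusp at which the
-- form is small compared with the trace.
--
-- The obstacle is that this cusp must be moved out of (0, 1) by `H` alone. The descent can stall
-- only at a vertex of the polygon, which is neither strictly beyond a side nor outside.
-- Geometrically, the index p + 1 of Γ₀(p) and the cusp widths 1 and p exclude a finite vertex
-- equivalent to ∞. Here this is done by arithmetic: modulo p, the number of triangles at a vertex
-- is a difference of two ratios of consecutive denominators, and these ratios cancel around the
-- polygon. Vertices with p ∣ bᵢ have no ratio and drop out of the sum; the total of their angles is
-- then divisible by p, yet smaller than p.

0≤+ : ∀ {x y} → 0ℤ ≤ x → 0ℤ ≤ y → 0ℤ ≤ x + y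
0≤+ = ℤ.+-mono-≤

0≤* : ∀ {x y} → 0ℤ ≤ x → 0ℤ ≤ y → 0ℤ ≤ x * y
0≤* {+ m} {+ n} _ _ = subst (0ℤ ≤_) (ℤ.pos-* m n) (+≤+ z≤n)

0<* : ∀ {x y} → 0ℤ < x → 0ℤ < y → 0ℤ < x * y
0<* {+ suc m} {+ suc n} _ _ = +<+ (s≤s z≤n)
0<* {+ 0} (+<+ ())
0<* {+ suc m} {+ 0} _ (+<+ ())

0<*⁻¹ : ∀ {x y} → 0ℤ < x * y → 0ℤ < y → 0ℤ < x
0<*⁻¹ {+ 0} {y} (+<+ ())
0<*⁻¹ {+ suc m} _ _ = +<+ (s≤s z≤n)
0<*⁻¹ { -[1+ m ]} {+ suc n} () _
0<*⁻¹ { -[1+ m ]} {+ 0} _ (+<+ ())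

0≤neg : ∀ {x} → x ≤ 0ℤ → 0ℤ ≤ - x
0≤neg = ℤ.neg-mono-≤

neg≤0 : ∀ {x} → 0ℤ ≤ x → - x ≤ 0ℤ
neg≤0 = ℤ.neg-mono-≤

≤-split : ∀ x y → x * y ≤ 0ℤ → (0ℤ ≤ x × y ≤ 0ℤ) ⊎ (x ≤ 0ℤ × 0ℤ ≤ y)
≤-split (+ x) (-[1+ y ]) _ = inj₁ (+≤+ z≤n , -≤+)
≤-split (-[1+ x ]) (+ y) _ = inj₂ (-≤+ , +≤+ z≤n)
≤-split (+ 0) (+ y) _ = inj₂ (+≤+ z≤n , +≤+ z≤n)
≤-split (+ suc x) (+ 0) _ = inj₁ (+≤+ z≤n , +≤+ z≤n)
≤-split (+ suc x) (+ suc y) (+≤+ ())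
≤-split (-[1+ x ]) (-[1+ y ]) (+≤+ ())

<-split : ∀ x y → x * y < 0ℤ → (0ℤ < x × y < 0ℤ) ⊎ (x < 0ℤ × 0ℤ < y)
<-split (+ suc x) (-[1+ y ]) _ = inj₁ (+<+ (s≤s z≤n) , -<+)
<-split (-[1+ x ]) (+ suc y) _ = inj₂ (-<+ , +<+ (s≤s z≤n))
<-split (+ 0) y (+<+ ())
<-split (+ suc x) (+ 0) p = contradiction (subst (_< 0ℤ) (ℤ.*-zeroʳ (+ suc x)) p) λ { (+<+ ()) }
<-split (+ suc x) (+ suc y) (+<+ ())
<-split (-[1+ x ]) (-[1+ y ]) (+<+ ())
<-split (-[1+ x ]) (+ 0) p = contradiction (subst (_< 0ℤ) (ℤ.*-zeroʳ -[1+ x ]) p) λ { (+<+ ()) }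

0<square : ∀ {x} → x ≢ 0ℤ → 0ℤ < x * x
0<square {+ 0} x≢0 = contradiction refl x≢0
0<square {+ suc _} _ = +<+ (s≤s z≤n)
0<square { -[1+ _ ]} _ = +<+ (s≤s z≤n)

0<*-trans : ∀ x y z → 0ℤ < x * y → 0ℤ < y * z → 0ℤ < x * z
0<*-trans (+ suc x) (+ suc y) (+ suc z) _ _ = +<+ (s≤s z≤n)
0<*-trans (-[1+ x ]) (-[1+ y ]) (-[1+ z ]) _ _ = +<+ (s≤s z≤n)
0<*-trans (+ 0) y z (+<+ ())
0<*-trans x (+ 0) z _ (+<+ ())
0<*-trans (+ suc x) (+ suc y) (+ 0) _ q = contradiction (subst (0ℤ <_) (ℤ.*-zeroʳ (+ suc y)) q) λ { (+<+ ()) }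
0<*-trans (+ suc x) (-[1+ y ]) z ()
0<*-trans (-[1+ x ]) (+ suc y) z ()
0<*-trans (-[1+ x ]) (-[1+ y ]) (+ 0) _ q = contradiction (subst (0ℤ <_) (ℤ.*-zeroʳ -[1+ y ]) q) λ { (+<+ ()) }

≤-by : ∀ {x y} t → 0ℤ ≤ t → x + t ≡ y → x ≤ y
≤-by {x} t 0≤t e = subst₂ _≤_ (ℤ.+-identityʳ x) e (ℤ.+-monoʳ-≤ x 0≤t)

<-by : ∀ {x y} t → 0ℤ < t → x + t ≡ y → x < y
<-by {x} t 0<t e = subst₂ _<_ (ℤ.+-identityʳ x) e (ℤ.+-monoʳ-< x 0<t)

0≤⇒1≤ : ∀ {x} → 0ℤ < x → 0ℤ ≤ x - 1ℤ
0≤⇒1≤ {+ suc m} _ = +≤+ z≤n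
0≤⇒1≤ {+ 0} (+<+ ())

abs-< : ∀ {x y} → 0ℤ ≤ x → x < y → ∣ x ∣ ℕ.< ∣ y ∣
abs-< {+ _} {+ _} _ (+<+ p) = p

-- Farey sequences

module Fan (n : ℕ) (a b : ℕ → ℤ)
  (b-pos : ∀ k → k ℕ.≤ n → 0ℤ ℤ.< b k)
  (unimodular : ∀ k → k ℕ.< n →
    a (suc k) ℤ.* b k ℤ.- a k ℤ.* b (suc k) ≡ 1ℤ) where

  -- The determinants of pairs of vertices are the entries of a Conway-Coxeter frieze; the value 1
  -- marks Farey neighbours.
  c : ℕ → ℕ → ℤ
  c i j = a j * b i - a i * b j

  c-refl : ∀ i → c i i ≡ 0ℤ
  c-refl i = e (a i) (b i)
    where
    e : ∀ x y → x * y - x * y ≡ 0ℤ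
    e = solve-∀

  -- Induction on `j` by the Plücker relation of e_i, e_j, e_{j+1}: after multiplication by the
  -- positive b_j, the new determinant is a sum of positive terms.
  c-pos : ∀ {i j} → i ℕ.< j → j ℕ.≤ n → 0ℤ < c i j
  c-pos {i} {suc j} (s≤s i≤j) j<n with ℕ.m≤n⇒m<n∨m≡n i≤j
  ... | inj₂ refl = subst (0ℤ <_) (sym (unimodular i j<n)) (+<+ (s≤s z≤n))
  ... | inj₁ i<j = 0<*⁻¹ (subst (0ℤ <_) (sym eq) (ℤ.+-mono-<
      (0<* (c-pos i<j j≤n) (b-pos (suc j) j<n)) (b-pos i (ℕ.≤-trans (ℕ.<⇒≤ i<j) j≤n)))) (b-pos j j≤n)
    where
    j≤n = ℕ.<⇒≤ j<n
    e : ∀ ai bi aj bj ak bk → (ak * bi - ai * bk) * bj ≡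
      (aj * bi - ai * bj) * bk + (ak * bj - aj * bk) * bi
    e = solve-∀
    eq : c i (suc j) * b j ≡ c i j * b (suc j) + b i
    eq = trans (e (a i) (b i) (a j) (b j) (a (suc j)) (b (suc j)))
      (cong (_+_ (c i j * b (suc j))) (trans (cong (_* b i) (unimodular j j<n)) (ℤ.*-identityˡ (b i))))

  c-nonNeg : ∀ {i j} → i ℕ.≤ j → j ℕ.≤ n → 0ℤ ≤ c i j
  c-nonNeg {i} {j} i≤j j≤n with ℕ.m≤n⇒m<n∨m≡n i≤j
  ... | inj₁ i<j = ℤ.<⇒≤ (c-pos i<j j≤n)
  ... | inj₂ refl = ℤ.≤-reflexive (sym (c-refl i))

  -- The determinant of v = (x, z) with e_k. The product of two consecutive values is negative
  -- exactly when x/z lies strictly between the two vertices, and it does not change under v ↦ -v.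
  f : ℕ → ℤ → ℤ → ℤ
  f k x z = x * b k - z * a k

  f-neg : ∀ k x z → f k (- x) (- z) ≡ - f k x z
  f-neg k x z = e x z (a k) (b k)
    where
    e : ∀ x z a b → (- x) * b - (- z) * a ≡ - (x * b - z * a)
    e = solve-∀

  -- v = −f_{j+1}(v) e_j + f_j(v) e_{j+1} for e_k = (a_k, b_k), and f_k(e_j) = c k j.
  f-expand : ∀ {j} → j ℕ.< n → ∀ k x z →
    f k x z ≡ (- f (suc j) x z) * c k j + f j x z * c k (suc j)
  f-expand {j} j<n k x z = trans (sym (ℤ.*-identityʳ (f k x z)))
    (trans (cong (f k x z *_) (sym (unimodular j j<n)))
      (e x z (a j) (b j) (a (suc j)) (b (suc j)) (a k) (b k)))
    where
    e : ∀ x z a b a′ b′ aₖ bₖ →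
      (x * bₖ - z * aₖ) * (a′ * b - a * b′) ≡
      (- (x * b′ - z * a′)) * (a * bₖ - aₖ * b) + (x * b - z * a) * (a′ * bₖ - aₖ * b′)
    e = solve-∀

  -f-expand : ∀ {j} → j ℕ.< n → ∀ k x z →
    - f k x z ≡ (- f (suc j) x z) * c j k + f j x z * c (suc j) k
  -f-expand {j} j<n k x z = trans (cong -_ (f-expand j<n k x z))
    (e (f (suc j) x z) (f j x z) (a j) (b j) (a (suc j)) (b (suc j)) (a k) (b k))
    where
    e : ∀ g h a b a′ b′ aₖ bₖ →
      - ((- g) * (a * bₖ - aₖ * b) + h * (a′ * bₖ - aₖ * b′)) ≡
      (- g) * (aₖ * b - a * bₖ) + h * (aₖ * b′ - a′ * bₖ)
    e = solve-∀

  module _ {j : ℕ} (j<n : j ℕ.< n) {x z : ℤ} where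

    -- The hypotheses say that v is a nonnegative combination of e_j and e_{j+1}, so its sign
    -- against e_k is that of `c k j` and `c k (suc j)`.
    module Weak (f≥0 : 0ℤ ≤ f j x z) (f≤0 : f (suc j) x z ≤ 0ℤ) where

      before : ∀ {k} → k ℕ.≤ j → 0ℤ ≤ f k x z
      before {k} k≤j = subst (0ℤ ≤_) (sym (f-expand j<n k x z))
        (0≤+ (0≤* (0≤neg f≤0) (c-nonNeg k≤j (ℕ.<⇒≤ j<n)))
             (0≤* f≥0 (c-nonNeg (ℕ.m≤n⇒m≤1+n k≤j) j<n)))

      after : ∀ {k} → j ℕ.< k → k ℕ.≤ n → 0ℤ ≤ - f k x z
      after {k} j<k k≤n = subst (0ℤ ≤_) (sym (-f-expand j<n k x z))
        (0≤+ (0≤* (0≤neg f≤0) (c-nonNeg (ℕ.<⇒≤ j<k) k≤n))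
             (0≤* f≥0 (c-nonNeg j<k k≤n)))

      same-sign : ∀ {i} → i ℕ.< n → i ≢ j → 0ℤ ≤ f i x z * f (suc i) x z
      same-sign {i} i<n i≢j with ℕ.<-cmp i j
      ... | tri< i<j _ _ = 0≤* (before (ℕ.<⇒≤ i<j)) (before i<j)
      ... | tri≈ _ i≡j _ = contradiction i≡j i≢j
      ... | tri> _ _ j<i = subst (0ℤ ≤_) (e (f i x z) (f (suc i) x z))
          (0≤* (after j<i (ℕ.<⇒≤ i<n)) (after (ℕ.m<n⇒m<1+n j<i) i<n))
        where
        e : ∀ x y → (- x) * (- y) ≡ x * y
        e = solve-∀

      ends : f 0 x z * f n x z ≤ 0ℤ
      ends = subst (_≤ 0ℤ) (e (f 0 x z) (f n x z))
        (neg≤0 (0≤* (before z≤n) (after j<n ℕ.≤-refl)))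
        where
        e : ∀ x y → - (x * (- y)) ≡ x * y
        e = solve-∀

    module Strict (f>0 : 0ℤ < f j x z) (f<0 : f (suc j) x z < 0ℤ) where

      private
        g = f j x z
        h = - f (suc j) x z
        0<h : 0ℤ < h
        0<h = ℤ.neg-mono-< f<0

      ends-< : f 0 x z * f n x z < 0ℤ
      ends-< = subst (_< 0ℤ) (e (f 0 x z) (f n x z)) (ℤ.neg-mono-< (0<* 0<f₀ 0<-fₙ))
        where
        e : ∀ x y → - (x * (- y)) ≡ x * y
        e = solve-∀
        0<f₀ = subst (0ℤ <_) (sym (f-expand j<n 0 x z))
          (ℤ.+-mono-≤-< (0≤* (ℤ.<⇒≤ 0<h) (c-nonNeg z≤n (ℕ.<⇒≤ j<n))) (0<* f>0 (c-pos (s≤s z≤n) j<n)))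
        0<-fₙ = subst (0ℤ <_) (sym (-f-expand j<n n x z))
          (ℤ.+-mono-<-≤ (0<* 0<h (c-pos j<n ℕ.≤-refl)) (0≤* (ℤ.<⇒≤ f>0) (c-nonNeg j<n ℕ.≤-refl)))

      private
        combine : ∀ {s t p q p′ q′} → 0ℤ < s → 0ℤ < t → 0ℤ ≤ p → 0ℤ < q → 0ℤ < p′ → 0ℤ < q′ →
          t + s < (s * p + t * p′) + (s * q + t * q′)
        combine {s} {t} {p} {q} {p′} {q′} 0<s 0<t 0≤p 0<q 0<p′ 0<q′ =
          <-by (s * p + s * (q - 1ℤ) + t * (p′ - 1ℤ) + t * (q′ - 1ℤ) + t)
            (ℤ.+-mono-≤-< (0≤+ (0≤+ (0≤+ (0≤* (ℤ.<⇒≤ 0<s) 0≤p) (0≤* (ℤ.<⇒≤ 0<s) (0≤⇒1≤ 0<q)))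
              (0≤* (ℤ.<⇒≤ 0<t) (0≤⇒1≤ 0<p′))) (0≤* (ℤ.<⇒≤ 0<t) (0≤⇒1≤ 0<q′))) 0<t)
            (e s t p q p′ q′)
          where
          e : ∀ s t p q p′ q′ →
            t + s + (s * p + s * (q - 1ℤ) + t * (p′ - 1ℤ) + t * (q′ - 1ℤ) + t) ≡
            (s * p + t * p′) + (s * q + t * q′)
          e = solve-∀

        width>0 : 0ℤ ≤ g - f (suc j) x z
        width>0 = 0≤+ (ℤ.<⇒≤ f>0) (ℤ.<⇒≤ 0<h)

      -- In the basis e_j, e_{j+1} the vector v has positive coordinates `h` and `g`, whose sum is
      -- the left side. In the expansion of f_k + f_{k+1} the four coefficients have one common sign
      -- and at most one of them vanishes, so each coordinate counts at least once and one of them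
      -- twice.
      shrinks : ∀ {k} → k ℕ.< n → k ≢ j →
        ∣ f j x z - f (suc j) x z ∣ ℕ.< ∣ f k x z + f (suc k) x z ∣
      shrinks {k} k<n k≢j with ℕ.<-cmp k j
      ... | tri≈ _ k≡j _ = contradiction k≡j k≢j
      ... | tri< k<j _ _ = abs-< width>0 (subst (g + h <_)
          (sym (trans (cong₂ _+_ (f-expand j<n k x z) (f-expand j<n (suc k) x z))
            (e h g (c k j) (c k (suc j)) (c (suc k) j) (c (suc k) (suc j)))))
          (combine 0<h f>0 (c-nonNeg k<j j≤n) (c-pos k<j j≤n)
            (c-pos (ℕ.m<n⇒m<1+n k<j) j<n) (c-pos (s≤s k<j) j<n)))
        where
        j≤n = ℕ.<⇒≤ j<n
        e : ∀ h g p p′ q q′ → (h * p + g * p′) + (h * q + g * q′) ≡ (h * q + g * p′) + (h * p + g * q′)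
        e = solve-∀
      ... | tri> _ _ j<k = subst (∣ g - f (suc j) x z ∣ ℕ.<_) abs-eq (abs-< width>0 (subst (g + h <_)
          (sym (trans (cong₂ _+_ (-f-expand j<n k x z) (-f-expand j<n (suc k) x z))
            (e h g (c j k) (c (suc j) k) (c j (suc k)) (c (suc j) (suc k)))))
          (subst (_< (g * c (suc j) k + h * c j k) + (g * c (suc j) (suc k) + h * c j (suc k)))
            (ℤ.+-comm h g) (combine f>0 0<h (c-nonNeg j<k k≤n) (c-pos (s≤s j<k) k<n)
            (c-pos j<k k≤n) (c-pos (ℕ.m<n⇒m<1+n j<k) k<n)))))
        where
        k≤n = ℕ.<⇒≤ k<n
        e : ∀ h g p p′ q q′ → (h * p + g * p′) + (h * q + g * q′) ≡ (g * p′ + h * p) + (g * q′ + h * q)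
        e = solve-∀
        abs-eq : ∣ - f k x z + - f (suc k) x z ∣ ≡ ∣ f k x z + f (suc k) x z ∣
        abs-eq = trans (cong ∣_∣ (sym (ℤ.neg-distrib-+ (f k x z) (f (suc k) x z)))) (ℤ.∣-i∣≡∣i∣ (f k x z + f (suc k) x z))

  private
    neg-neg* : ∀ x y → (- x) * (- y) ≡ x * y
    neg-neg* = solve-∀

    f-neg* : ∀ i k x z → f i (- x) (- z) * f k (- x) (- z) ≡ f i x z * f k x z
    f-neg* i k x z = trans (cong₂ _*_ (f-neg i x z) (f-neg k x z)) (neg-neg* (f i x z) (f k x z))

    flip-≥ : ∀ k x z → f k x z ≤ 0ℤ → 0ℤ ≤ f k (- x) (- z)
    flip-≥ k x z p = subst (0ℤ ≤_) (sym (f-neg k x z)) (0≤neg p)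

    flip-≤ : ∀ k x z → 0ℤ ≤ f k x z → f k (- x) (- z) ≤ 0ℤ
    flip-≤ k x z p = subst (_≤ 0ℤ) (sym (f-neg k x z)) (neg≤0 p)

    flip-> : ∀ k x z → f k x z < 0ℤ → 0ℤ < f k (- x) (- z)
    flip-> k x z p = subst (0ℤ <_) (sym (f-neg k x z)) (ℤ.neg-mono-< p)

    flip-< : ∀ k x z → 0ℤ < f k x z → f k (- x) (- z) < 0ℤ
    flip-< k x z p = subst (_< 0ℤ) (sym (f-neg k x z)) (ℤ.neg-mono-< p)

  module _ {j : ℕ} (j<n : j ℕ.< n) (x z : ℤ) where

    inside⇒outside : f j x z * f (suc j) x z ≤ 0ℤ →
      ∀ {i} → i ℕ.< n → i ≢ j → 0ℤ ≤ f i x z * f (suc i) x z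
    inside⇒outside p {i} i<n i≢j with ≤-split (f j x z) (f (suc j) x z) p
    ... | inj₁ (q , r) = Weak.same-sign j<n {x} {z} q r i<n i≢j
    -- The product only sees the cusp, so v is replaced by -v to reach the sign pattern of `Weak`.
    ... | inj₂ (q , r) = subst (0ℤ ≤_) (f-neg* i (suc i) x z)
        (Weak.same-sign j<n { - x} { - z} (flip-≥ j x z q) (flip-≤ (suc j) x z r) i<n i≢j)

    inside⇒ends : f j x z * f (suc j) x z ≤ 0ℤ → f 0 x z * f n x z ≤ 0ℤ
    inside⇒ends p with ≤-split (f j x z) (f (suc j) x z) p
    ... | inj₁ (q , r) = Weak.ends j<n {x} {z} q r
    ... | inj₂ (q , r) = subst (_≤ 0ℤ) (f-neg* 0 n x z)
        (Weak.ends j<n { - x} { - z} (flip-≥ j x z q) (flip-≤ (suc j) x z r))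

    inside⇒ends-< : f j x z * f (suc j) x z < 0ℤ → f 0 x z * f n x z < 0ℤ
    inside⇒ends-< p with <-split (f j x z) (f (suc j) x z) p
    ... | inj₁ (q , r) = Strict.ends-< j<n {x} {z} q r
    ... | inj₂ (q , r) = subst (_< 0ℤ) (f-neg* 0 n x z)
        (Strict.ends-< j<n { - x} { - z} (flip-> j x z q) (flip-< (suc j) x z r))

    inside-shrinks : f j x z * f (suc j) x z < 0ℤ → ∀ {k} → k ℕ.< n → k ≢ j →
      ∣ f j x z - f (suc j) x z ∣ ℕ.< ∣ f k x z + f (suc k) x z ∣
    inside-shrinks p {k} k<n k≢j with <-split (f j x z) (f (suc j) x z) p
    ... | inj₁ (q , r) = Strict.shrinks j<n {x} {z} q r k<n k≢j
    ... | inj₂ (q , r) = subst₂ ℕ._<_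
        (abs-neg _-_ e₁ j) (abs-neg _+_ e₂ k)
        (Strict.shrinks j<n { - x} { - z} (flip-> j x z q) (flip-< (suc j) x z r) k<n k≢j)
      where
      e₁ : ∀ x y → (- x) - (- y) ≡ - (x - y)
      e₁ = solve-∀
      e₂ : ∀ x y → (- x) + (- y) ≡ - (x + y)
      e₂ = solve-∀
      abs-neg : ∀ (_∙_ : ℤ → ℤ → ℤ) → (∀ x y → (- x) ∙ (- y) ≡ - (x ∙ y)) → ∀ k →
        ∣ f k (- x) (- z) ∙ f (suc k) (- x) (- z) ∣ ≡ ∣ f k x z ∙ f (suc k) x z ∣
      abs-neg _∙_ neg-∙ k = trans
        (cong ∣_∣ (trans (cong₂ _∙_ (f-neg k x z) (f-neg (suc k) x z)) (neg-∙ (f k x z) (f (suc k) x z))))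
        (ℤ.∣-i∣≡∣i∣ (f k x z ∙ f (suc k) x z))

  ends⇒outside : ∀ x z → 0ℤ ≤ f 0 x z * f n x z →
    ∀ {i} → i ℕ.< n → 0ℤ ≤ f i x z * f (suc i) x z
  ends⇒outside x z p i<n = ℤ.≮⇒≥ λ q → ℤ.<⇒≱ (inside⇒ends-< i<n x z q) p

  -- A discrete intermediate value argument: `search` keeps f₀ f_m positive until a sign change
  -- occurs. Nonvanishing at the vertices keeps the scan from ending on one of them.
  locate : ∀ x z → (∀ k → k ℕ.≤ n → f k x z ≢ 0ℤ) → f 0 x z * f n x z < 0ℤ →
    ∃ λ j → j ℕ.< n × f j x z * f (suc j) x z < 0ℤ
  locate x z f≢0 ends<0 with search n ℕ.≤-refl
    where
    search : ∀ m → m ℕ.≤ n →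
      (∃ λ j → j ℕ.< n × f j x z * f (suc j) x z < 0ℤ) ⊎ 0ℤ < f 0 x z * f m x z
    search zero _ = inj₂ (0<square (f≢0 0 z≤n))
    search (suc m) m<n with search m (ℕ.<⇒≤ m<n)
    ... | inj₁ found = inj₁ found
    ... | inj₂ 0<f₀fₘ with ℤ.<-cmp (f m x z * f (suc m) x z) 0ℤ
    ...   | tri< lt _ _ = inj₁ (m , m<n , lt)
    ...   | tri≈ _ eq _ with ℤ.i*j≡0⇒i≡0∨j≡0 (f m x z) eq
    ...     | inj₁ z₁ = contradiction z₁ (f≢0 m (ℕ.<⇒≤ m<n))
    ...     | inj₂ z₂ = contradiction z₂ (f≢0 (suc m) m<n)
    search (suc m) m<n | inj₂ 0<f₀fₘ | tri> _ _ gt =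
      inj₂ (0<*-trans (f 0 x z) (f m x z) (f (suc m) x z) 0<f₀fₘ gt)
  ... | inj₁ found = found
  ... | inj₂ gt = contradiction gt (ℤ.<-asym ends<0)

-- Mediants and the angle count of a triangulated polygon

last-true : ∀ {P : ℕ → Set} → (∀ k → Dec (P k)) → ∀ {i j} → i ℕ.≤ j → P i → ¬ P j →
  ∃ λ k → i ℕ.≤ k × k ℕ.< j × P k × ¬ P (suc k)
last-true P? {i} {zero} z≤n Pi ¬Pj = contradiction Pi ¬Pj
last-true P? {i} {suc j} i≤j Pi ¬Pj with P? j | ℕ.m≤n⇒m<n∨m≡n i≤j
... | _ | inj₂ refl = contradiction Pi ¬Pj
... | yes Pj | inj₁ (s≤s i≤j′) = j , i≤j′ , ℕ.≤-refl , Pj , ¬Pj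
... | no ¬Pj′ | inj₁ (s≤s i≤j′) =
  let (k , i≤k , k<j , Pk , ¬Psk) = last-true P? i≤j′ Pi ¬Pj′
  in k , i≤k , ℕ.m<n⇒m<1+n k<j , Pk , ¬Psk

-- With x = s − t and y = t′ − s′ the hypothesis reads t y + x s′ + x y = 1.
mediant-step : ∀ {s t s′ t′} → s * t′ - s′ * t ≡ 1ℤ → 0ℤ < t → t ≤ s → s′ < t′ → 0ℤ ≤ s′ →
  s ≡ 1ℤ × t ≡ 1ℤ
mediant-step {s} {t} {s′} {t′} eq 0<t t≤s s′<t′ 0≤s′ = trans s≡t t≡1 , t≡1
  where
  x y : ℤ
  x = s - t
  y = t′ - s′
  0≤x : 0ℤ ≤ x
  0≤x = ℤ.i≤j⇒0≤j-i t≤s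
  0≤y-1 : 0ℤ ≤ y - 1ℤ
  0≤y-1 = 0≤⇒1≤ (subst (_< y) (ℤ.+-inverseʳ s′) (ℤ.+-monoˡ-< (- s′) s′<t′))
  0≤t-1 : 0ℤ ≤ t - 1ℤ
  0≤t-1 = 0≤⇒1≤ 0<t
  t≤1 : t ≤ 1ℤ
  t≤1 = ≤-by (t * (y - 1ℤ) + x * s′ + (x * (y - 1ℤ) + x))
    (0≤+ (0≤+ (0≤* (ℤ.<⇒≤ 0<t) 0≤y-1) (0≤* 0≤x 0≤s′)) (0≤+ (0≤* 0≤x 0≤y-1) 0≤x))
    (trans (e s t s′ t′) eq)
    where
    e : ∀ s t s′ t′ → t + (t * (t′ - s′ - 1ℤ) + (s - t) * s′ + ((s - t) * (t′ - s′ - 1ℤ) + (s - t))) ≡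
      s * t′ - s′ * t
    e = solve-∀
  t≡1 : t ≡ 1ℤ
  t≡1 = ℤ.≤-antisym t≤1 (ℤ.0≤i-j⇒j≤i 0≤t-1)
  s≤t : s ≤ t
  s≤t = ≤-by (x * s′ + x * (y - 1ℤ) + t * (y - 1ℤ))
    (0≤+ (0≤+ (0≤* 0≤x 0≤s′) (0≤* 0≤x 0≤y-1)) (0≤* (ℤ.<⇒≤ 0<t) 0≤y-1))
    (trans (e s t s′ t′) (trans eq (sym t≡1)))
    where
    e : ∀ s t s′ t′ → s + ((s - t) * s′ + (s - t) * (t′ - s′ - 1ℤ) + t * (t′ - s′ - 1ℤ)) ≡
      s * t′ - s′ * t
    e = solve-∀
  s≡t : s ≡ t
  s≡t = ℤ.≤-antisym s≤t t≤s

module Triangulation (n : ℕ) (a b : ℕ → ℤ)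
  (b-pos : ∀ k → k ℕ.≤ n → 0ℤ ℤ.< b k)
  (unimodular : ∀ k → k ℕ.< n →
    a (suc k) ℤ.* b k ℤ.- a k ℤ.* b (suc k) ≡ 1ℤ) where
  open Fan n a b b-pos unimodular

  private
    ptolemy : ∀ i j k l → c i k * c j l ≡ c i j * c k l + c i l * c j k
    ptolemy i j k l = e (a i) (b i) (a j) (b j) (a k) (b k) (a l) (b l)
      where
      e : ∀ a b a′ b′ a″ b″ a‴ b‴ →
        (a″ * b - a * b″) * (a‴ * b′ - a′ * b‴) ≡
        (a′ * b - a * b′) * (a‴ * b″ - a″ * b‴) + (a‴ * b - a * b‴) * (a″ * b′ - a′ * b″)
      e = solve-∀

  -- In the basis e_i, e_{j+1} the vertex e_k has coordinates `c k (suc j)` and `c i k`, and the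
  -- mediant is (1, 1). The last vertex not past the direction (1, 1) is unimodular with its
  -- successor, which forces it to be (1, 1) itself. The search starts at i + 1, where the second
  -- coordinate is already positive.
  mediant : ∀ {i j} → i ℕ.< j → suc j ℕ.≤ n → c i (suc j) ≡ 1ℤ →
    ∃ λ k → i ℕ.≤ k × k ℕ.< j × c i (suc k) ≡ 1ℤ × c (suc k) (suc j) ≡ 1ℤ
  mediant {i} {j} i<j j<n cij≡1 with last-true (λ k → c i k ℤ.≤? c k (suc j)) (ℕ.m≤n⇒m≤1+n i<j)
      (subst (_≤ c (suc i) (suc j)) (sym (unimodular i (ℕ.<-trans i<j j<n)))
        (ℤ.i<j⇒suc[i]≤j (c-pos (s≤s i<j) j<n)))
      (subst₂ (λ x y → ¬ x ≤ y) (sym cij≡1) (sym (c-refl (suc j))) λ { (+≤+ ()) })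
  ... | suc k , s≤s i≤k , s≤s k<j , t≤s , t≰s =
    let (s≡1 , t≡1) = mediant-step {s = c (suc k) (suc j)} {c i (suc k)} {c (suc (suc k)) (suc j)} {c i (suc (suc k))}
          det (c-pos (s≤s i≤k) (ℕ.≤-trans (ℕ.m≤n⇒m≤1+n k<j) j<n)) t≤s (ℤ.≰⇒> t≰s)
          (c-nonNeg (s≤s k<j) j<n)
    in k , i≤k , k<j , t≡1 , s≡1
    where
    e : ∀ a b a′ b′ a″ b″ a‴ b‴ →
      (a‴ * b′ - a′ * b‴) * (a″ * b - a * b″) - (a‴ * b″ - a″ * b‴) * (a′ * b - a * b′) ≡
      (a‴ * b - a * b‴) * (a″ * b′ - a′ * b″)
    e = solve-∀
    det : c (suc k) (suc j) * c i (suc (suc k)) - c (suc (suc k)) (suc j) * c i (suc k) ≡ 1ℤ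
    det = trans (e (a i) (b i) (a (suc k)) (b (suc k)) (a (suc (suc k))) (b (suc (suc k))) (a (suc j)) (b (suc j)))
      (cong₂ _*_ cij≡1 (unimodular (suc k) (ℕ.≤-trans (s≤s k<j) j<n)))

  -- `c k (suc (suc k))` is the number of triangles at vertex k + 1, so this counts the angles at
  -- the vertices 1, ..., k.
  Σwidth : ℕ → ℤ
  Σwidth zero = 0ℤ
  Σwidth (suc k) = Σwidth k + c k (suc (suc k))

  private
    width-sum′ : ∀ {i j} → Acc ℕ._<_ (j ℕ.∸ i) → i ℕ.≤ j → suc j ℕ.≤ n → c i (suc j) ≡ 1ℤ →
      c i j + c (suc i) (suc j) + (Σwidth j - Σwidth i) ≡ + 3 * (+ j - + i)
    width-sum′ {i} {j} (acc rec) i≤j j<n cij≡1 with ℕ.m≤n⇒m<n∨m≡n i≤j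
    ... | inj₂ refl = trans (cong₂ (λ x y → x + y + (Σwidth i - Σwidth i)) (c-refl i) (c-refl (suc i)))
        (e (Σwidth i) (+ i))
      where
      e : ∀ x y → 0ℤ + 0ℤ + (x - x) ≡ + 3 * (y - y)
      e = solve-∀
    ... | inj₁ i<j with mediant i<j j<n cij≡1
    -- The triangle on e_i, e_{k+1}, e_{j+1} separates two smaller polygons and adds one angle at
    -- each of its corners: `cij`, `csij` and `width` record this, and the summand 3 is their total.
    ...   | k , i≤k , k<j , cik≡1 , ckj≡1 = begin
      c i j + c (suc i) (suc j) + (Σwidth j - Σwidth i)
        ≡⟨ cong₂ (λ x y → x + y + (Σwidth j - Σwidth i)) cij csij ⟩
      1ℤ + c (suc k) j + (1ℤ + c (suc i) (suc k)) + (Σwidth j - Σwidth i)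
        ≡⟨ e₁ (c (suc k) j) (c (suc i) (suc k)) (Σwidth j) (Σwidth i) (Σwidth k) (c i k) (c (suc (suc k)) (suc j)) ⟩
      (c i k + c (suc i) (suc k) + (Σwidth k - Σwidth i)) +
        (c (suc k) j + c (suc (suc k)) (suc j) +
          (Σwidth j - (Σwidth k + (1ℤ + c i k + c (suc (suc k)) (suc j))))) + + 3
        ≡⟨ cong (λ w → (c i k + c (suc i) (suc k) + (Σwidth k - Σwidth i)) +
            (c (suc k) j + c (suc (suc k)) (suc j) + (Σwidth j - (Σwidth k + w))) + + 3) (sym width) ⟩
      (c i k + c (suc i) (suc k) + (Σwidth k - Σwidth i)) +
        (c (suc k) j + c (suc (suc k)) (suc j) + (Σwidth j - Σwidth (suc k))) + + 3
        ≡⟨ cong₂ (λ x y → x + y + + 3)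
            (width-sum′ (rec (ℕ.∸-monoˡ-< k<j i≤k)) i≤k k<n cik≡1)
            (width-sum′ (rec (ℕ.∸-monoʳ-< (s≤s i≤k) k<j)) k<j j<n ckj≡1) ⟩
      + 3 * (+ k - + i) + + 3 * (+ j - + suc k) + + 3
        ≡⟨ e₂ (+ i) (+ j) (+ k) ⟩
      + 3 * (+ j - + i) ∎
      where
      open ≡-Reasoning
      k<n : suc k ℕ.≤ n
      k<n = ℕ.≤-trans k<j (ℕ.<⇒≤ j<n)

      vertex : ∀ (h : ℕ → ℤ) →
        (∀ i j k → h k * c i j ≡ c k j * h i + c i k * h j) → h (suc k) ≡ h i + h (suc j)
      vertex h plücker = trans (sym (ℤ.*-identityʳ (h (suc k))))
        (trans (cong (h (suc k) *_) (sym cij≡1)) (trans (plücker i (suc j) (suc k))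
          (cong₂ _+_ (trans (cong (_* h i) ckj≡1) (ℤ.*-identityˡ (h i)))
                     (trans (cong (_* h (suc j)) cik≡1) (ℤ.*-identityˡ (h (suc j)))))))

      a-eq : a (suc k) ≡ a i + a (suc j)
      a-eq = vertex a λ i j k → e (a i) (b i) (a j) (b j) (a k) (b k)
        where
        e : ∀ a b a′ b′ a″ b″ → a″ * (a′ * b - a * b′) ≡
          (a′ * b″ - a″ * b′) * a + (a″ * b - a * b″) * a′
        e = solve-∀
      b-eq : b (suc k) ≡ b i + b (suc j)
      b-eq = vertex b λ i j k → e (a i) (b i) (a j) (b j) (a k) (b k)
        where
        e : ∀ a b a′ b′ a″ b″ → b″ * (a′ * b - a * b′) ≡
          (a′ * b″ - a″ * b′) * b + (a″ * b - a * b″) * b′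
        e = solve-∀

      into : ∀ l → c l (suc j) ≡ c l (suc k) + c i l
      into l = sym (trans (cong₂ (λ x y → x * b l - a l * y + c i l) a-eq b-eq)
          (e (a i) (b i) (a (suc j)) (b (suc j)) (a l) (b l)))
        where
        e : ∀ a b a′ b′ a″ b″ →
          (a + a′) * b″ - a″ * (b + b′) + (a″ * b - a * b″) ≡ a′ * b″ - a″ * b′
        e = solve-∀

      from : ∀ l → c i l ≡ c l (suc j) + c (suc k) l
      from l = sym (trans (cong₂ (λ x y → c l (suc j) + (a l * y - x * b l)) a-eq b-eq)
          (e (a i) (b i) (a (suc j)) (b (suc j)) (a l) (b l)))
        where
        e : ∀ a b a′ b′ a″ b″ →
          a′ * b″ - a″ * b′ + (a″ * (b + b′) - (a + a′) * b″) ≡ a″ * b - a * b″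
        e = solve-∀

      cij : c i j ≡ 1ℤ + c (suc k) j
      cij = trans (from j) (cong (_+ c (suc k) j) (unimodular j j<n))

      csij : c (suc i) (suc j) ≡ 1ℤ + c (suc i) (suc k)
      csij = trans (into (suc i)) (trans (cong (_+_ (c (suc i) (suc k))) (unimodular i (ℕ.≤-trans (s≤s i≤j) j<n)))
        (ℤ.+-comm (c (suc i) (suc k)) 1ℤ))

      ckj : c k (suc j) ≡ 1ℤ + c i k
      ckj = trans (into k) (cong (_+ c i k) (unimodular k k<n))

      width : c k (suc (suc k)) ≡ 1ℤ + c i k + c (suc (suc k)) (suc j)
      width = begin
        c k (suc (suc k))
          ≡⟨ ℤ.*-identityʳ (c k (suc (suc k))) ⟨
        c k (suc (suc k)) * 1ℤ
          ≡⟨ cong (c k (suc (suc k)) *_) ckj≡1 ⟨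
        c k (suc (suc k)) * c (suc k) (suc j)
          ≡⟨ ptolemy k (suc k) (suc (suc k)) (suc j) ⟩
        c k (suc k) * c (suc (suc k)) (suc j) + c k (suc j) * c (suc k) (suc (suc k))
          ≡⟨ cong₂ _+_ (cong (_* c (suc (suc k)) (suc j)) (unimodular k k<n))
               (cong₂ _*_ ckj (unimodular (suc k) (ℕ.≤-trans (s≤s k<j) j<n))) ⟩
        1ℤ * c (suc (suc k)) (suc j) + (1ℤ + c i k) * 1ℤ
          ≡⟨ e (c (suc (suc k)) (suc j)) (c i k) ⟩
        1ℤ + c i k + c (suc (suc k)) (suc j) ∎
        where
        e : ∀ x y → 1ℤ * x + (1ℤ + y) * 1ℤ ≡ 1ℤ + y + x
        e = solve-∀

      e₁ : ∀ p q zj zi zk r s → 1ℤ + p + (1ℤ + q) + (zj - zi) ≡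
        (r + q + (zk - zi)) + (p + s + (zj - (zk + (1ℤ + r + s)))) + + 3
      e₁ = solve-∀
      e₂ : ∀ i j k → + 3 * (k - i) + + 3 * (j - (1ℤ + k)) + + 3 ≡ + 3 * (j - i)
      e₂ = solve-∀

  -- A triangulation of the polygon between e_i and e_{j+1} has j − i triangles, and the
  -- number of its triangles at each vertex is a determinant of neighbours.
  width-sum : ∀ {i j} → i ℕ.≤ j → suc j ℕ.≤ n → c i (suc j) ≡ 1ℤ →
    c i j + c (suc i) (suc j) + (Σwidth j - Σwidth i) ≡ + 3 * (+ j - + i)
  width-sum = width-sum′ (ℕ.<-wellFounded _)

-- Denominators modulo p

∣-resp : ∀ {k x y} → x ≡ y → k ∣ˢ x → k ∣ˢ y
∣-resp = subst (_ ∣ˢ_)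

module _ {p : ℕ} (pp : Prime p) where

  euclid : ∀ {x y} → + p ∣ˢ x * y → + p ∣ˢ x ⊎ + p ∣ˢ y
  euclid {x} {y} p∣xy = Sum.map ∣.∣ᵤ⇒∣ ∣.∣ᵤ⇒∣
    (euclidsLemma ∣ x ∣ ∣ y ∣ pp (subst (p ℕ.∣_) (ℤ.abs-* x y) (∣.∣⇒∣ᵤ p∣xy)))

  ∤-cancelˡ : ∀ {x y} → ¬ + p ∣ˢ x → + p ∣ˢ x * y → + p ∣ˢ y
  ∤-cancelˡ p∤x p∣xy with euclid p∣xy
  ... | inj₁ p∣x = contradiction p∣x p∤x
  ... | inj₂ p∣y = p∣y

  p∤1 : ¬ + p ∣ˢ 1ℤ
  p∤1 p∣1 = ℕ.nonTrivial⇒≢1 {{prime⇒nonTrivial pp}} (ℕ.∣1⇒≡1 (∣.∣⇒∣ᵤ p∣1))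

  inverse : ∀ {x} → ¬ + p ∣ˢ x → ∃ λ t → + p ∣ˢ t * x - 1ℤ
  inverse {x} p∤x = signed (nat (coprime-Bézout coprime))
    where
    m = ∣ x ∣
    coprime : Coprime p m
    coprime (d∣p , d∣m) with prime⇒irreducible pp d∣p
    ... | inj₁ d≡1 = d≡1
    ... | inj₂ refl = contradiction (∣.∣ᵤ⇒∣ d∣m) p∤x
    cast : ∀ {u v y z} → 1 ℕ.+ u ℕ.* v ≡ y ℕ.* z → 1ℤ + + u * + v ≡ + y * + z
    cast {u} {v} {y} {z} eq = trans (cong (_+_ 1ℤ) (sym (ℤ.pos-* u v))) (trans (cong +_ eq) (ℤ.pos-* y z))
    nat : GCD.Bézout.Identity 1 p m → ∃ λ t → + p ∣ˢ t * + m - 1ℤ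
    nat (GCD.Bézout.+- u v eq) = - + v , divides (- + u)
      (trans (e (+ v) (+ m)) (trans (cong -_ (cast {v} {m} {u} {p} eq)) (ℤ.neg-distribˡ-* (+ u) (+ p))))
      where
      e : ∀ x y → (- x) * y - 1ℤ ≡ - (1ℤ + x * y)
      e = solve-∀
    nat (GCD.Bézout.-+ u v eq) = + v , divides (+ u)
      (trans (cong (_- 1ℤ) (sym (cast {u} {p} {v} {m} eq))) (e (+ u * + p)))
      where
      e : ∀ r → 1ℤ + r - 1ℤ ≡ r
      e = solve-∀
    signed : ∀ {x} → (∃ λ t → + p ∣ˢ t * + ∣ x ∣ - 1ℤ) → ∃ λ t → + p ∣ˢ t * x - 1ℤ
    signed {+ m} td = td
    signed { -[1+ m ]} (t , d) = - t , ∣-resp (e t (+ suc m)) d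
      where
      e : ∀ t x → t * x - 1ℤ ≡ (- t) * (- x) - 1ℤ
      e = solve-∀

sum-∣ : ∀ {k n} (g : Fin n → ℤ) → (∀ i → k ∣ˢ g i) → k ∣ˢ sum g
sum-∣ {k} {zero} g d = divides 0ℤ refl
sum-∣ {k} {suc n} g d = ∣.∣m∣n⇒∣m+n (d Fin.zero) (sum-∣ (λ i → g (Fin.suc i)) λ i → d (Fin.suc i))

sum-≤ : ∀ {n} (g h : Fin n → ℤ) → (∀ i → g i ≤ h i) → sum g ≤ sum h
sum-≤ {zero} g h le = ℤ.≤-refl
sum-≤ {suc n} g h le = ℤ.+-mono-≤ (le Fin.zero) (sum-≤ (λ i → g (Fin.suc i)) (λ i → h (Fin.suc i)) λ i → le (Fin.suc i))

sum-nonNeg : ∀ {n} (g : Fin n → ℤ) → (∀ i → 0ℤ ≤ g i) → 0ℤ ≤ sum g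
sum-nonNeg {zero} g 0≤g = ℤ.≤-refl
sum-nonNeg {suc n} g 0≤g = 0≤+ (0≤g Fin.zero) (sum-nonNeg (λ i → g (Fin.suc i)) λ i → 0≤g (Fin.suc i))

term≤sum : ∀ {n} (g : Fin n → ℤ) → (∀ i → 0ℤ ≤ g i) → ∀ i → g i ≤ sum g
term≤sum {suc n} g 0≤g Fin.zero = ≤-by (sum λ i → g (Fin.suc i)) (sum-nonNeg (λ i → g (Fin.suc i)) λ i → 0≤g (Fin.suc i)) refl
term≤sum {suc n} g 0≤g (Fin.suc i) = ℤ.≤-trans (term≤sum (λ i → g (Fin.suc i)) (λ i → 0≤g (Fin.suc i)) i)
  (≤-by (g Fin.zero) (0≤g Fin.zero) (ℤ.+-comm _ (g Fin.zero)))

sum-neg : ∀ {n} (g : Fin n → ℤ) → sum (λ i → - g i) ≡ - sum g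
sum-neg {zero} g = refl
sum-neg {suc n} g = trans (cong (_+_ (- g Fin.zero)) (sum-neg λ i → g (Fin.suc i)))
  (sym (ℤ.neg-distrib-+ (g Fin.zero) _))

telescope : ∀ n (h : ℕ → ℤ) → sum {n} (λ i → h (suc (toℕ i)) - h (toℕ i)) ≡ h n - h 0
telescope zero h = sym (ℤ.+-inverseʳ (h 0))
telescope (suc n) h = trans (cong (_+_ (h 1 - h 0)) (telescope n λ k → h (suc k))) (e (h 0) (h 1) (h (suc n)))
  where
  e : ∀ x y z → y - x + (z - y) ≡ z - x
  e = solve-∀

-- (a_k, b_k) is continued beyond e_n = (1, 1) by e_{n+1} = (1, 0), the vertex at infinity.
module Vertices {p : ℕ} (pp : Prime p) (n : ℕ) (3n≡p+1 : 3 ℕ.* n ≡ p ℕ.+ 1)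
  (a b : ℕ → ℤ)
  (a₀ : a 0 ≡ 0ℤ) (b₀ : b 0 ≡ 1ℤ) (aₙ : a n ≡ 1ℤ) (bₙ : b n ≡ 1ℤ)
  (aₙ₊₁ : a (suc n) ≡ 1ℤ) (bₙ₊₁ : b (suc n) ≡ 0ℤ)
  (b-pos : ∀ k → k ℕ.≤ n → 0ℤ ℤ.< b k)
  (unimodular : ∀ k → k ℕ.≤ n →
    a (suc k) ℤ.* b k ℤ.- a k ℤ.* b (suc k) ≡ 1ℤ)
  (_⋆ : Fin n → Fin n) (⋆-involutive : Involutive _≡_ _⋆)
  (congruence : ∀ i → + p ∣ˢ b (toℕ i) ℤ.* b (toℕ (i ⋆)) ℤ.+ b (suc (toℕ i)) ℤ.* b (suc (toℕ (i ⋆))))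
  where

  open Fan n a b b-pos (λ k k<n → unimodular k (ℕ.<⇒≤ k<n))
  open Triangulation n a b b-pos (λ k k<n → unimodular k (ℕ.<⇒≤ k<n))

  consecutive : ∀ {k} → k ℕ.≤ n → + p ∣ˢ b k → ¬ + p ∣ˢ b (suc k)
  consecutive {k} k≤n d d′ = p∤1 pp (∣-resp (unimodular k k≤n)
    (∣.∣m∣n⇒∣m-n (∣.∣n⇒∣m*n (a (suc k)) d) (∣.∣n⇒∣m*n (a k) d′)))

  -- The number `t` represents b_{k+1}/b_k modulo p, which makes sense unless p divides b_k.
  data Slope (k : ℕ) : Set where
    cusp : + p ∣ˢ b k → Slope k
    slope : ∀ t → ¬ + p ∣ˢ b k → + p ∣ˢ t * b k - b (suc k) → Slope k

  slope? : ∀ k → Slope k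
  slope? k with + p ∣ˢ? b k
  ... | yes d = cusp d
  ... | no ¬d = let (t , d) = inverse pp ¬d in
    slope (b (suc k) * t) ¬d (∣-resp (e (b k) (b (suc k)) t) (∣.∣n⇒∣m*n (b (suc k)) d))
    where
    e : ∀ x y t → y * (t * x - 1ℤ) ≡ y * t * x - y
    e = solve-∀

  -- The default 0 at a cusp is harmless because the pairing matches cusps with cusps.
  φ : ∀ {k} → Slope k → ℤ
  φ (cusp _) = 0ℤ
  φ (slope t _ _) = t

  -- The angle at vertex k + 1 that no ratio modulo p accounts for.
  lost : ∀ {k} → Slope (suc k) → ℤ
  lost {k} (cusp _) = c k (suc (suc k))
  lost (slope _ _ _) = 0ℤ

  -- From b_k + b_{k+2} = w b_{k+1} the angle w is b_k/b_{k+1} plus the ratio at k + 1, and the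
  -- congruence turns b_k/b_{k+1} into minus the ratio at the start of side j⋆. A cusp at the end of
  -- side j forces one at the start of side j⋆ and conversely, hence the two absurd cases.
  transport : ∀ j (s : Slope (suc (toℕ j))) (s′ : Slope (toℕ (j ⋆))) →
    + p ∣ˢ c (toℕ j) (suc (suc (toℕ j))) - lost s - φ s + φ s′
  transport j (cusp _) (cusp _) = divides 0ℤ (e (c (toℕ j) (suc (suc (toℕ j)))))
    where
    e : ∀ x → x - x - 0ℤ + 0ℤ ≡ 0ℤ
    e = solve-∀
  transport j (cusp d) (slope _ ¬d′ _) = contradiction d (consecutive (ℕ.<⇒≤ (Fin.toℕ<n j))
    (∤-cancelˡ pp ¬d′ (∣-resp (ℤ.*-comm (b (toℕ j)) (b (toℕ (j ⋆))))
      (∣.∣m+n∣n⇒∣m (congruence j) (∣.∣m⇒∣m*n (b (suc (toℕ (j ⋆)))) d)))))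
  transport j (slope _ ¬d _) (cusp d′) = contradiction
    (∤-cancelˡ pp ¬d (∣.∣m+n∣m⇒∣n (congruence j) (∣.∣n⇒∣m*n (b (toℕ j)) d′)))
    (consecutive (ℕ.<⇒≤ (Fin.toℕ<n (j ⋆))) d′)
  transport j (slope t ¬d d) (slope t′ ¬d′ d′) = ∤-cancelˡ pp ¬d (∤-cancelˡ pp ¬d′
    (∣-resp (trans (e x₀ x₁ x₂ y₀ y₁ t t′) (trans
        (cong (λ x → y₀ * (x - x₁ * t + x₁ * t′)) (sym width)) (e′ x₁ y₀ w t t′)))
      (∣.∣m∣n⇒∣m+n (∣.∣m∣n⇒∣m-n (∣.∣n⇒∣m*n x₁ d′) (∣.∣n⇒∣m*n y₀ d)) (congruence j))))
    where
    k = toℕ j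
    x₀ = b k
    x₁ = b (suc k)
    x₂ = b (suc (suc k))
    y₀ = b (toℕ (j ⋆))
    y₁ = b (suc (toℕ (j ⋆)))
    w = c k (suc (suc k))
    e : ∀ x₀ x₁ x₂ y₀ y₁ t t′ →
      x₁ * (t′ * y₀ - y₁) - y₀ * (t * x₁ - x₂) + (x₀ * y₀ + x₁ * y₁) ≡
      y₀ * (x₀ + x₂ - x₁ * t + x₁ * t′)
    e = solve-∀
    e′ : ∀ x₁ y₀ w t t′ → y₀ * (w * x₁ - x₁ * t + x₁ * t′) ≡ y₀ * (x₁ * (w - 0ℤ - t + t′))
    e′ = solve-∀
    e″ : ∀ a b a′ b′ a″ b″ → (a″ * b - a * b″) * b′ ≡ (a″ * b′ - a′ * b″) * b + (a′ * b - a * b′) * b″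
    e″ = solve-∀
    width : w * x₁ ≡ x₀ + x₂
    width = trans (e″ (a k) x₀ (a (suc k)) x₁ (a (suc (suc k))) x₂) (cong₂ _+_
      (trans (cong (_* x₀) (unimodular (suc k) (Fin.toℕ<n j))) (ℤ.*-identityˡ x₀))
      (trans (cong (_* x₂) (unimodular k (ℕ.<⇒≤ (Fin.toℕ<n j)))) (ℤ.*-identityˡ x₂)))

  0<width : ∀ {k} → k ℕ.< n → 0ℤ < c k (suc (suc k))
  0<width {k} k<n with ℕ.m≤n⇒m<n∨m≡n k<n
  ... | inj₁ k+1<n = c-pos (ℕ.m<n⇒m<1+n (ℕ.n<1+n k)) k+1<n
  ... | inj₂ refl = subst (0ℤ <_)
    (sym (trans (cong₂ (λ x y → x * b k - a k * y) aₙ₊₁ bₙ₊₁) (e (b k) (a k)))) (b-pos k (ℕ.<⇒≤ k<n))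
    where
    e : ∀ x y → 1ℤ * x - y * 0ℤ ≡ x
    e = solve-∀

  lost-bounds : ∀ {k} → k ℕ.< n → (s : Slope (suc k)) → 0ℤ ≤ lost s × lost s ≤ c k (suc (suc k))
  lost-bounds k<n (cusp _) = ℤ.<⇒≤ (0<width k<n) , ℤ.≤-refl
  lost-bounds k<n (slope _ _ _) = ℤ.≤-refl , ℤ.<⇒≤ (0<width k<n)

  -- The polygon on e_0, ..., e_n has n - 1 triangles, and the triangle ∞, 0, 1 makes n. Of their 3n
  -- = p + 1 angles one is at ∞, b_1 are at 0, and the others form `Σwidth n`.
  Σwidth-total : b 1 + Σwidth n ≡ + p
  Σwidth-total = begin
    b 1 + Σwidth n
      ≡⟨ cong (λ k → b 1 + Σwidth k) n≡ ⟨
    b 1 + (Σwidth m + c m (suc (suc m)))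
      ≡⟨ cong₂ (λ x y → b 1 + (Σwidth m + (x * b m - a m * y))) (trans (cong (λ k → a (suc k)) n≡) aₙ₊₁) (trans (cong (λ k → b (suc k)) n≡) bₙ₊₁) ⟩
    b 1 + (Σwidth m + (1ℤ * b m - a m * 0ℤ))
      ≡⟨ e₁ (a 1) (b 1) (a m) (b m) (Σwidth m) ⟩
    (a m * 1ℤ - 0ℤ * b m) + (1ℤ * b 1 - a 1 * 1ℤ) + (Σwidth m - 0ℤ) + (1ℤ * b m - a m * 1ℤ) + (a 1 * 1ℤ - 0ℤ * b 1)
      ≡⟨ cong₂ _+_ (cong₂ _+_ wide det-m) det-0 ⟩
    + 3 * (+ m - 0ℤ) + 1ℤ + 1ℤ
      ≡⟨ e₂ (+ m) ⟩
    + 3 * (1ℤ + + m) - 1ℤ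
      ≡⟨ cong (λ k → + 3 * + k - 1ℤ) n≡ ⟩
    + 3 * + n - 1ℤ
      ≡⟨ cong (_- 1ℤ) (trans (sym (ℤ.pos-* 3 n)) (cong +_ 3n≡p+1)) ⟩
    + p + 1ℤ - 1ℤ
      ≡⟨ e₃ (+ p) ⟩
    + p ∎
    where
    open ≡-Reasoning
    predecessor : ∀ n → 3 ℕ.* n ≡ p ℕ.+ 1 → ∃ λ m → suc m ≡ n
    predecessor zero eq = contradiction (trans eq (ℕ.+-comm p 1)) λ ()
    predecessor (suc m) _ = m , refl
    m = proj₁ (predecessor n 3n≡p+1)
    n≡ : suc m ≡ n
    n≡ = proj₂ (predecessor n 3n≡p+1)
    m≤n : ∀ {m} → suc m ≡ n → m ℕ.≤ n
    m≤n refl = ℕ.n≤1+n _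
    e₁ : ∀ a₁ b₁ a b s → b₁ + (s + (1ℤ * b - a * 0ℤ)) ≡
      (a * 1ℤ - 0ℤ * b) + (1ℤ * b₁ - a₁ * 1ℤ) + (s - 0ℤ) + (1ℤ * b - a * 1ℤ) + (a₁ * 1ℤ - 0ℤ * b₁)
    e₁ = solve-∀
    e₂ : ∀ m → + 3 * (m - 0ℤ) + 1ℤ + 1ℤ ≡ + 3 * (1ℤ + m) - 1ℤ
    e₂ = solve-∀
    e₃ : ∀ p → p + 1ℤ - 1ℤ ≡ p
    e₃ = solve-∀
    aₘ₊₁ : a (suc m) ≡ 1ℤ
    aₘ₊₁ = trans (cong a n≡) aₙ
    bₘ₊₁ : b (suc m) ≡ 1ℤ
    bₘ₊₁ = trans (cong b n≡) bₙ
    det-m : 1ℤ * b m - a m * 1ℤ ≡ 1ℤ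
    det-m = trans (cong₂ (λ x y → x * b m - a m * y) (sym aₘ₊₁) (sym bₘ₊₁)) (unimodular m (m≤n n≡))
    det-0 : a 1 * 1ℤ - 0ℤ * b 1 ≡ 1ℤ
    det-0 = trans (cong₂ (λ x y → a 1 * y - x * b 1) (sym a₀) (sym b₀)) (unimodular 0 z≤n)
    wide : (a m * 1ℤ - 0ℤ * b m) + (1ℤ * b 1 - a 1 * 1ℤ) + (Σwidth m - 0ℤ) ≡ + 3 * (+ m - 0ℤ)
    wide = trans (cong₂ (λ x y → x + y + (Σwidth m - 0ℤ))
        (cong₂ (λ x y → a m * y - x * b m) (sym a₀) (sym b₀))
        (cong₂ (λ x y → x * b 1 - a 1 * y) (sym aₘ₊₁) (sym bₘ₊₁)))
      (width-sum z≤n (ℕ.≤-reflexive n≡) (trans (cong₂ (λ x y → x * b 0 - a 0 * y) aₘ₊₁ bₘ₊₁)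
        (trans (cong₂ (λ x y → 1ℤ * y - x * 1ℤ) a₀ b₀) refl)))

  Φ : ℕ → ℤ
  Φ k = φ (slope? k)

  Lost : Fin n → ℤ
  Lost i = lost (slope? (suc (toℕ i)))

  private
    Φ-slope : ∀ k → ¬ + p ∣ˢ b k → + p ∣ˢ Φ k * b k - b (suc k)
    Φ-slope k ¬d with slope? k
    ... | cusp d = contradiction d ¬d
    ... | slope _ _ d = d

    unit∤ : ∀ {k} → b k ≡ 1ℤ → ¬ + p ∣ˢ b k
    unit∤ eq d = p∤1 pp (∣-resp eq d)

    potential : ℕ → ℤ
    potential k = Σwidth k - Φ k

    permuted : sum (λ i → Φ (toℕ (i ⋆))) ≡ sum {n} (λ i → Φ (toℕ i))
    permuted = sym (sum-permute (λ i → Φ (toℕ i)) (permutation _⋆ _⋆ ⋆-involutive ⋆-involutive))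

    sum-sub : ∀ {n} (g h : Fin n → ℤ) → sum (λ i → g i - h i) ≡ sum g - sum h
    sum-sub g h = trans (∑-distrib-+ g (λ i → - h i)) (cong (_+_ (sum g)) (sum-neg h))

  -- Summed over all sides, the ratios in `transport` telescope once `j ⋆` is permuted back to `j`.
  -- What remains is Φ_n - Φ_0, congruent to -b_1, and b_1 completes the angles to p.
  p∣ΣLost : + p ∣ˢ sum Lost
  p∣ΣLost = ∣-resp (e₂ (b 1) (Σwidth n) (Φ n) (Φ 0) (+ p) (sum Lost) Σwidth-total)
    (∣.∣m∣n⇒∣m-n (∣.∣m∣n⇒∣m-n (∣.∣m∣n⇒∣m+n ∣.∣-refl
      (∣-resp (cong₂ (λ x y → Φ 0 * x - y) b₀ refl) (Φ-slope 0 (unit∤ b₀))))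
      (∣-resp (cong₂ (λ x y → Φ n * x - y) bₙ bₙ₊₁) (Φ-slope n (unit∤ bₙ)))) total)
    where
    term : Fin n → ℤ
    term i = (potential (suc (toℕ i)) - potential (toℕ i) - Lost i) + (Φ (toℕ (i ⋆)) - Φ (toℕ i))

    total : + p ∣ˢ potential n - potential 0 - sum Lost + 0ℤ
    total = ∣-resp
      (trans (∑-distrib-+ {n} _ _) (cong₂ _+_
        (trans (sum-sub {n} _ Lost) (cong (_- sum Lost) (telescope n potential)))
        (trans (sum-sub {n} _ _) (trans (cong (_- sum {n} (λ i → Φ (toℕ i))) permuted) (ℤ.+-inverseʳ (sum {n} λ i → Φ (toℕ i)))))))
      (sum-∣ term λ i → ∣-resp
        (e₁ (Σwidth (toℕ i)) (c (toℕ i) (suc (suc (toℕ i)))) (Lost i) (Φ (suc (toℕ i))) (Φ (toℕ i)) (Φ (toℕ (i ⋆))))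
        (transport i (slope? (suc (toℕ i))) (slope? (toℕ (i ⋆)))))
      where
      e₁ : ∀ s w l x y z → w - l - x + z ≡ ((s + w - x) - (s - y) - l) + (z - y)
      e₁ = solve-∀

    e₂ : ∀ b₁ s x y p l → b₁ + s ≡ p →
      p + (y * 1ℤ - b₁) - (x * 1ℤ - 0ℤ) - ((s - x) - (0ℤ - y) - l + 0ℤ) ≡ l
    e₂ b₁ s x y p l refl = e b₁ s x y l
      where
      e : ∀ b₁ s x y l → b₁ + s + (y * 1ℤ - b₁) - (x * 1ℤ - 0ℤ) - ((s - x) - (0ℤ - y) - l + 0ℤ) ≡ l
      e = solve-∀

  -- The lost angles amount to at most p - b_1, so a total divisible by p must vanish; but a cusp
  -- would contribute a positive angle.
  no-cusp : ∀ i → ¬ + p ∣ˢ b (suc (toℕ i))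
  no-cusp i d with slope? (suc (toℕ i)) in eq
  ... | slope _ ¬d _ = ¬d d
  ... | cusp _ = ℤ.<-irrefl (sym ΣLost≡0) (ℤ.<-≤-trans
      (subst (0ℤ <_) (sym (cong lost eq)) (0<width (Fin.toℕ<n i)))
      (term≤sum Lost (λ i → proj₁ (bounds i)) i))
    where
    bounds : ∀ i → 0ℤ ≤ Lost i × Lost i ≤ Σwidth (suc (toℕ i)) - Σwidth (toℕ i)
    bounds i = let (l , u) = lost-bounds (Fin.toℕ<n i) (slope? (suc (toℕ i))) in
      l , subst (Lost i ≤_) (e (Σwidth (toℕ i)) _) u
      where
      e : ∀ s w → w ≡ s + w - s
      e = solve-∀
    ΣLost≤ : sum Lost ≤ Σwidth n
    ΣLost≤ = subst (sum Lost ≤_) (trans (telescope n Σwidth) (ℤ.+-identityʳ (Σwidth n)))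
      (sum-≤ {n} Lost _ (λ i → proj₂ (bounds i)))
    ΣLost<p : sum Lost < + p
    ΣLost<p = ℤ.≤-<-trans ΣLost≤ (<-by (b 1) (b-pos 1 1≤n) (trans (ℤ.+-comm (Σwidth n) (b 1)) Σwidth-total))
      where
      1≤n : 1 ℕ.≤ n
      1≤n = ℕ.≤-trans (s≤s z≤n) (Fin.toℕ<n i)
    small : ∀ {x} → 0ℤ ≤ x → x < + p → + p ∣ˢ x → x ≡ 0ℤ
    small {+ zero} _ _ _ = refl
    small {+ suc m} _ (+<+ lt) d = contradiction (∣.∣⇒∣ᵤ d) (ℕ.>⇒∤ lt)
    ΣLost≡0 : sum Lost ≡ 0ℤ
    ΣLost≡0 = small (sum-nonNeg Lost λ i → proj₁ (bounds i)) ΣLost<p p∣ΣLost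

-- Words and ping-pong

module Words {c ℓ s} (G : Group c ℓ)
  {n} (g : Fin n → Group.Carrier G) (_⋆ : Fin n → Fin n) (⋆-involutive : Involutive _≡_ _⋆)
  (g-⁻¹ : ∀ i → Group._≈_ G (Group._⁻¹ G (g i)) (g (i ⋆)))
  (S : Pred (Group.Carrier G) s) (S⊆g : ∀ {x} → x ∈ S → ∃ λ i → Group._≈_ G x (g i)) where
  private
    module G = Group G
  open Group G using (Carrier; _≈_; _∙_; ε; _⁻¹)
  open GroupProperties G using (⁻¹-anti-homo-∙; ε⁻¹≈ε)
  open import Relation.Binary.Reasoning.Setoid G.setoid

  eval : List (Fin n) → Carrier
  eval [] = ε
  eval (i ∷ is) = g i ∙ eval is

  eval-++ : ∀ is js → eval (is ++ js) ≈ eval is ∙ eval js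
  eval-++ [] js = G.sym (G.identityˡ (eval js))
  eval-++ (i ∷ is) js = G.trans (G.∙-congˡ (eval-++ is js)) (G.sym (G.assoc (g i) (eval is) (eval js)))

  eval-⁻¹ : ∀ is → ∃ λ js → eval is ⁻¹ ≈ eval js
  eval-⁻¹ [] = [] , ε⁻¹≈ε
  eval-⁻¹ (i ∷ is) = let (js , eq) = eval-⁻¹ is in js ++ i ⋆ ∷ [] , (begin
    (g i ∙ eval is) ⁻¹           ≈⟨ ⁻¹-anti-homo-∙ (g i) (eval is) ⟩
    eval is ⁻¹ ∙ g i ⁻¹          ≈⟨ G.∙-cong eq (G.trans (g-⁻¹ i) (G.sym (G.identityʳ _))) ⟩
    eval js ∙ eval (i ⋆ ∷ [])    ≈⟨ eval-++ js (i ⋆ ∷ []) ⟨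
    eval (js ++ i ⋆ ∷ [])        ∎)

  word : ∀ {x} → x ∈ Generated G S → ∃ λ is → x ≈ eval is
  word (gen x∈S) = let (i , eq) = S⊆g x∈S in i ∷ [] , G.trans eq (G.sym (G.identityʳ (g i)))
  word gen-ε = [] , G.refl
  word (gen-∙ x∈ y∈) =
    let (is , eq) = word x∈ ; (js , eq′) = word y∈ in
    is ++ js , G.trans (G.∙-cong eq eq′) (G.sym (eval-++ is js))
  word (gen-⁻¹ x∈) =
    let (is , eq) = word x∈ ; (js , eq′) = eval-⁻¹ is in
    js , G.trans (G.⁻¹-cong eq) eq′
  word (gen-≈ x≈y x∈) = let (is , eq) = word x∈ in is , G.trans (G.sym x≈y) eq

  Reduced : List (Fin n) → Set
  Reduced = Linked λ i j → j ≢ i ⋆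

  -- A letter put before a reduced word can only cancel the first letter, and the tail is still
  -- reduced.
  reduce : ∀ is → ∃ λ js → Reduced js × eval is ≈ eval js
  reduce [] = [] , [] , G.refl
  reduce (i ∷ is) with reduce is
  ... | [] , _ , eq = i ∷ [] , [-] , G.∙-congˡ eq
  ... | j ∷ js , red , eq with j Fin.≟ i ⋆
  ...   | no j≢i⋆ = i ∷ j ∷ js , j≢i⋆ ∷ red , G.∙-congˡ eq
  ...   | yes refl = js , Linked.tail red , (begin
    g i ∙ eval is                   ≈⟨ G.∙-congˡ eq ⟩
    g i ∙ (g (i ⋆) ∙ eval js)       ≈⟨ G.assoc (g i) (g (i ⋆)) (eval js) ⟨
    (g i ∙ g (i ⋆)) ∙ eval js       ≈⟨ G.∙-congʳ (G.∙-congˡ (g-⁻¹ i)) ⟨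
    (g i ∙ g i ⁻¹) ∙ eval js        ≈⟨ G.∙-congʳ (G.inverseʳ (g i)) ⟩
    ε ∙ eval js                     ≈⟨ G.identityˡ (eval js) ⟩
    eval js                         ∎)

  reduced-word : ∀ {x} → x ∈ Generated G S → ∃ λ is → Reduced is × x ≈ eval is
  reduced-word x∈ =
    let (is , eq) = word x∈ ; (js , red , eq′) = reduce is in js , red , G.trans eq eq′

act₁ act₂ : SL₂ℤ → ℤ → ℤ → ℤ
act₁ M x z = m₁₁ M * x + m₁₂ M * z
act₂ M x z = m₂₁ M * x + m₂₂ M * z

act₁-· : ∀ M N x z → act₁ (M ·ₘ N) x z ≡ act₁ M (act₁ N x z) (act₂ N x z)
act₁-· (mat a b _ _ _) (mat a′ b′ c′ d′ _) x z = e a b a′ b′ c′ d′ x z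
  where
  e : ∀ a b a′ b′ c′ d′ x z → (a * a′ + b * c′) * x + (a * b′ + b * d′) * z ≡
    a * (a′ * x + b′ * z) + b * (c′ * x + d′ * z)
  e = solve-∀

act₂-· : ∀ M N x z → act₂ (M ·ₘ N) x z ≡ act₂ M (act₁ N x z) (act₂ N x z)
act₂-· (mat _ _ a b _) (mat a′ b′ c′ d′ _) x z = e a b a′ b′ c′ d′ x z
  where
  e : ∀ a b a′ b′ c′ d′ x z → (a * a′ + b * c′) * x + (a * b′ + b * d′) * z ≡
    a * (a′ * x + b′ * z) + b * (c′ * x + d′ * z)
  e = solve-∀

-- Nonpositive exactly when the cusp x/z lies in [0, 1].
side : ℤ → ℤ → ℤ
side x z = x * (x - z)

side-≈± : ∀ {M N} → M ≈± N → ∀ x z →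
  side (act₁ M x z) (act₂ M x z) ≡ side (act₁ N x z) (act₂ N x z)
side-≈± (plus (entries refl refl refl refl)) x z = refl
side-≈± {N = N} (minus (entries refl refl refl refl)) x z = e (m₁₁ N) (m₁₂ N) (m₂₁ N) (m₂₂ N) x z
  where
  e : ∀ a b c d x z → ((- a) * x + (- b) * z) * ((- a) * x + (- b) * z - ((- c) * x + (- d) * z)) ≡
    (a * x + b * z) * (a * x + b * z - (c * x + d * z))
  e = solve-∀

-- The pairing matrices acting on the polygon

module Pairing {p : ℕ} (pp : Prime p) (12∣p+1 : 12 ℕ.∣ p ℕ.+ 1) (F : FareySymbol p) where
  open FareySymbol F using (n; fraction; lo; hi; unimodular; *-involutive; congruence; pairingMatrix; pairingMatrices; first; last; *-fixedPointFree)
  open FareySymbol F using () renaming (_* to _⋆)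
  private
    module F = FareySymbol F

  extend : (Fin (suc n) → ℤ) → ℤ → ℕ → ℤ
  extend g y k with k ℕ.<? suc n
  ... | yes k<n = g (fromℕ< k<n)
  ... | no _ = y

  extend-toℕ : ∀ g y i → extend g y (toℕ i) ≡ g i
  extend-toℕ g y i with toℕ i ℕ.<? suc n
  ... | yes lt = cong g (Fin.fromℕ<-toℕ i lt)
  ... | no nlt = contradiction (Fin.toℕ<n i) nlt

  extend-beyond : ∀ g y → extend g y (suc n) ≡ y
  extend-beyond g y with suc n ℕ.<? suc n
  ... | yes lt = contradiction lt (ℕ.<-irrefl refl)
  ... | no _ = refl

  extend-lo : ∀ g y i → extend g y (toℕ i) ≡ g (lo i)
  extend-lo g y i = trans (cong (extend g y) (sym (Fin.toℕ-inject₁ i))) (extend-toℕ g y (lo i))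

  -- The default values 1 and 0 beyond n make e_{n+1} the vertex at infinity.
  a b : ℕ → ℤ
  a = extend F.a 1ℤ
  b = extend F.b 0ℤ

  aₙ : a n ≡ 1ℤ
  aₙ = trans (cong a (sym (Fin.toℕ-fromℕ n))) (trans (extend-toℕ F.a 1ℤ (fromℕ n)) (cong ↥_ last))

  bₙ : b n ≡ 1ℤ
  bₙ = trans (cong b (sym (Fin.toℕ-fromℕ n))) (trans (extend-toℕ F.b 0ℤ (fromℕ n)) (cong ↧_ last))

  a₀ : a 0 ≡ 0ℤ
  a₀ = trans (extend-toℕ F.a 1ℤ Fin.zero) (cong ↥_ first)

  b₀ : b 0 ≡ 1ℤ
  b₀ = trans (extend-toℕ F.b 0ℤ Fin.zero) (cong ↧_ first)

  b-pos : ∀ k → k ℕ.≤ n → 0ℤ < b k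
  b-pos k k≤n with k ℕ.<? suc n
  ... | yes _ = +<+ (s≤s z≤n)
  ... | no nlt = contradiction (s≤s k≤n) nlt

  unimodular′ : ∀ k → k ℕ.≤ n → a (suc k) * b k - a k * b (suc k) ≡ 1ℤ
  unimodular′ k k≤n with ℕ.m≤n⇒m<n∨m≡n k≤n
  ... | inj₂ refl = cong₂ _-_ (cong₂ _*_ (extend-beyond F.a 1ℤ) bₙ) (cong₂ _*_ aₙ (extend-beyond F.b 0ℤ))
  ... | inj₁ k<n = subst (λ k → a (suc k) * b k - a k * b (suc k) ≡ 1ℤ) (Fin.toℕ-fromℕ< k<n)
    (trans (cong₂ _-_ (cong₂ _*_ (extend-toℕ F.a 1ℤ (hi i)) (extend-lo F.b 0ℤ i))
                      (cong₂ _*_ (extend-lo F.a 1ℤ i) (extend-toℕ F.b 0ℤ (hi i))))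
      (unimodular i))
    where
    i = fromℕ< k<n

  congr : ∀ i → + p ∣ˢ b (toℕ i) * b (toℕ (i ⋆)) + b (suc (toℕ i)) * b (suc (toℕ (i ⋆)))
  congr i = ∣-resp (sym (cong₂ _+_ (cong₂ _*_ (extend-lo F.b 0ℤ i) (extend-lo F.b 0ℤ (i ⋆)))
      (cong₂ _*_ (extend-toℕ F.b 0ℤ (hi i)) (extend-toℕ F.b 0ℤ (hi (i ⋆))))))
    (∣.∣ᵤ⇒∣ (congruence i))

  3n≡p+1 : 3 ℕ.* n ≡ p ℕ.+ 1
  3n≡p+1 = ℕ.m*[n/m]≡n (ℕ.∣-trans (ℕ.divides 4 refl) 12∣p+1)

  open Fan n a b b-pos (λ k k<n → unimodular′ k (ℕ.<⇒≤ k<n))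
  open Vertices pp n 3n≡p+1 a b a₀ b₀ aₙ bₙ (extend-beyond F.a 1ℤ) (extend-beyond F.b 0ℤ) b-pos unimodular′ _⋆ *-involutive congr
    using (no-cusp)

  f₀ : ∀ x z → f 0 x z ≡ x
  f₀ x z = trans (cong₂ (λ u v → x * v - z * u) a₀ b₀) (e x z)
    where
    e : ∀ x z → x * 1ℤ - z * 0ℤ ≡ x
    e = solve-∀

  fₙ : ∀ x z → f n x z ≡ x - z
  fₙ x z = trans (cong₂ (λ u v → x * v - z * u) aₙ bₙ) (e x z)
    where
    e : ∀ x z → x * 1ℤ - z * 1ℤ ≡ x - z
    e = solve-∀

  f₀fₙ : ∀ x z → f 0 x z * f n x z ≡ side x z
  f₀fₙ x z = cong₂ _*_ (f₀ x z) (fₙ x z)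

  -- The product of the two coordinates of v at the i-th side: negative if v lies strictly
  -- beyond that side, positive if it lies strictly on the other side.
  beyond : Fin n → ℤ → ℤ → ℤ
  beyond i x z = f (toℕ i) x z * f (suc (toℕ i)) x z

  module _ (i : Fin n) (x z : ℤ) where
    private
      x′ = act₁ (pairingMatrix i) x z
      z′ = act₂ (pairingMatrix i) x z
      sub : ∀ (h : ℤ → ℤ → ℤ → ℤ → ℤ → ℤ → ℤ → ℤ → ℤ) →
        h (a (toℕ i)) (b (toℕ i)) (a (suc (toℕ i))) (b (suc (toℕ i)))
          (a (toℕ (i ⋆))) (b (toℕ (i ⋆))) (a (suc (toℕ (i ⋆)))) (b (suc (toℕ (i ⋆)))) ≡
        h (F.a (lo i)) (F.b (lo i)) (F.a (hi i)) (F.b (hi i))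
          (F.a (lo (i ⋆))) (F.b (lo (i ⋆))) (F.a (hi (i ⋆))) (F.b (hi (i ⋆)))
      sub h rewrite extend-lo F.a 1ℤ i | extend-lo F.b 0ℤ i | extend-toℕ F.a 1ℤ (hi i) | extend-toℕ F.b 0ℤ (hi i)
        | extend-lo F.a 1ℤ (i ⋆) | extend-lo F.b 0ℤ (i ⋆) | extend-toℕ F.a 1ℤ (hi (i ⋆)) | extend-toℕ F.b 0ℤ (hi (i ⋆)) = refl

      x′-eq : x′ ≡ (a (suc (toℕ (i ⋆))) * b (suc (toℕ i)) + a (toℕ (i ⋆)) * b (toℕ i)) * x +
        (- (a (toℕ i) * a (toℕ (i ⋆))) - a (suc (toℕ i)) * a (suc (toℕ (i ⋆)))) * z
      x′-eq = sym (sub λ a b a⁺ b⁺ A B A⁺ B⁺ → (A⁺ * b⁺ + A * b) * x + (- (a * A) - a⁺ * A⁺) * z)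

      z′-eq : z′ ≡ (b (toℕ i) * b (toℕ (i ⋆)) + b (suc (toℕ i)) * b (suc (toℕ (i ⋆)))) * x +
        (- (a (suc (toℕ i)) * b (suc (toℕ (i ⋆)))) - a (toℕ i) * b (toℕ (i ⋆))) * z
      z′-eq = sym (sub λ a b a⁺ b⁺ A B A⁺ B⁺ → (b * B + b⁺ * B⁺) * x + (- (a⁺ * B⁺) - a * B) * z)

      det⋆ : a (suc (toℕ (i ⋆))) * b (toℕ (i ⋆)) - a (toℕ (i ⋆)) * b (suc (toℕ (i ⋆))) ≡ 1ℤ
      det⋆ = unimodular′ (toℕ (i ⋆)) (ℕ.<⇒≤ (Fin.toℕ<n (i ⋆)))

    -- The matrix sends e_i to -e_{i⋆+1} and e_{i+1} to e_{i⋆}. As it preserves determinants, this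
    -- gives both `f-lo` and `f-hi`.
    f-lo : f (toℕ (i ⋆)) x′ z′ ≡ f (suc (toℕ i)) x z
    f-lo = trans (cong₂ (λ u v → u * b (toℕ (i ⋆)) - v * a (toℕ (i ⋆))) x′-eq z′-eq)
      (trans (e (a (toℕ i)) (b (toℕ i)) (a (suc (toℕ i))) (b (suc (toℕ i)))
          (a (toℕ (i ⋆))) (b (toℕ (i ⋆))) (a (suc (toℕ (i ⋆)))) (b (suc (toℕ (i ⋆)))) x z)
        (trans (cong (_* f (suc (toℕ i)) x z) det⋆) (ℤ.*-identityˡ _)))
      where
      e : ∀ a b a⁺ b⁺ A B A⁺ B⁺ x z →
        ((A⁺ * b⁺ + A * b) * x + (- (a * A) - a⁺ * A⁺) * z) * B -
        ((b * B + b⁺ * B⁺) * x + (- (a⁺ * B⁺) - a * B) * z) * A ≡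
        (A⁺ * B - A * B⁺) * (x * b⁺ - z * a⁺)
      e = solve-∀

    f-hi : f (suc (toℕ (i ⋆))) x′ z′ ≡ - f (toℕ i) x z
    f-hi = trans (cong₂ (λ u v → u * b (suc (toℕ (i ⋆))) - v * a (suc (toℕ (i ⋆)))) x′-eq z′-eq)
      (trans (e (a (toℕ i)) (b (toℕ i)) (a (suc (toℕ i))) (b (suc (toℕ i)))
          (a (toℕ (i ⋆))) (b (toℕ (i ⋆))) (a (suc (toℕ (i ⋆)))) (b (suc (toℕ (i ⋆)))) x z)
        (trans (cong (λ r → - (r * f (toℕ i) x z)) det⋆) (cong -_ (ℤ.*-identityˡ _))))
      where
      e : ∀ a b a⁺ b⁺ A B A⁺ B⁺ x z →
        ((A⁺ * b⁺ + A * b) * x + (- (a * A) - a⁺ * A⁺) * z) * B⁺ -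
        ((b * B + b⁺ * B⁺) * x + (- (a⁺ * B⁺) - a * B) * z) * A⁺ ≡
        - ((A⁺ * B - A * B⁺) * (x * b - z * a))
      e = solve-∀

  H = Generated PSL₂ℤ pairingMatrices

  -- Gluing side i and then side i⋆ sends e_i to -e_i, so the two matrices are inverse only up to
  -- sign.
  pairingMatrix-⁻¹ : ∀ i → pairingMatrix i ⁻¹ₘ ≈± pairingMatrix (i ⋆)
  pairingMatrix-⁻¹ i = minus (entries
      (trans (e₁ (F.a (hi i)) (F.b (hi (i ⋆))) (F.a (lo i)) (F.b (lo (i ⋆))))
        (cong (λ k → - (F.a (hi k) * F.b (hi (i ⋆)) + F.a (lo k) * F.b (lo (i ⋆)))) i≡i⋆⋆))
      (trans (e₂ (F.a (lo i)) (F.a (lo (i ⋆))) (F.a (hi i)) (F.a (hi (i ⋆))))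
        (cong (λ k → - (- (F.a (lo (i ⋆)) * F.a (lo k)) - F.a (hi (i ⋆)) * F.a (hi k))) i≡i⋆⋆))
      (trans (e₃ (F.b (lo i)) (F.b (lo (i ⋆))) (F.b (hi i)) (F.b (hi (i ⋆))))
        (cong (λ k → - (F.b (lo (i ⋆)) * F.b (lo k) + F.b (hi (i ⋆)) * F.b (hi k))) i≡i⋆⋆))
      (trans (e₄ (F.a (hi (i ⋆))) (F.b (hi i)) (F.a (lo (i ⋆))) (F.b (lo i)))
        (cong (λ k → - (- (F.a (hi (i ⋆)) * F.b (hi k)) - F.a (lo (i ⋆)) * F.b (lo k))) i≡i⋆⋆)))
    where
    i≡i⋆⋆ = sym (*-involutive i)
    e₁ : ∀ x y z w → - (x * y) - z * w ≡ - (x * y + z * w)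
    e₁ = solve-∀
    e₂ : ∀ x y z w → - (- (x * y) - z * w) ≡ - (- (y * x) - w * z)
    e₂ = solve-∀
    e₃ : ∀ x y z w → - (x * y + z * w) ≡ - (y * x + w * z)
    e₃ = solve-∀
    e₄ : ∀ x y z w → x * y + z * w ≡ - (- (x * y) - z * w)
    e₄ = solve-∀

  generated-⁻¹ : ∀ {M N} → M ∈ H → M ⁻¹ₘ ≈± N → N ∈ H
  generated-⁻¹ {M} {N} M∈H eq = gen-≈ {x = M ⁻¹ₘ} {N} eq (gen-⁻¹ {x = M} M∈H)

  -- Opaque because the type checker would otherwise unfold the proofs of det≡1.
  opaque
    g : Fin n → SL₂ℤ
    g = pairingMatrix

    g-lo : ∀ i x z → f (toℕ (i ⋆)) (act₁ (g i) x z) (act₂ (g i) x z) ≡ f (suc (toℕ i)) x z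
    g-lo = f-lo

    g-hi : ∀ i x z → f (suc (toℕ (i ⋆))) (act₁ (g i) x z) (act₂ (g i) x z) ≡ - f (toℕ i) x z
    g-hi = f-hi

    g-⁻¹ : ∀ i → g i ⁻¹ₘ ≈± g (i ⋆)
    g-⁻¹ = pairingMatrix-⁻¹

    g∈Γ₀ : ∀ i → g i ∈ Γ₀ p
    g∈Γ₀ = congruence

    g∈pairingMatrices : ∀ {i} → i Fin.< i ⋆ → g i ∈ pairingMatrices
    g∈pairingMatrices {i} i<i⋆ = i , i<i⋆ , refl

    pairingMatrices⊆g : ∀ {M} → M ∈ pairingMatrices → ∃ λ i → M ≈± g i
    pairingMatrices⊆g (i , _ , refl) = i , plus (entries refl refl refl refl)

  g∈H : ∀ i → g i ∈ H
  g∈H i = by-order (Fin.<-cmp i (i ⋆))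
    where
    by-order : Tri (i Fin.< i ⋆) (i ≡ i ⋆) (i ⋆ Fin.< i) → g i ∈ H
    by-order (tri< i<i⋆ _ _) = gen (g∈pairingMatrices i<i⋆)
    by-order (tri≈ _ i≡i⋆ _) = contradiction (sym i≡i⋆) (*-fixedPointFree i)
    by-order (tri> _ _ i⋆<i) = subst (λ k → g k ∈ H) (*-involutive i)
      (generated-⁻¹ (gen (g∈pairingMatrices (subst (i ⋆ Fin.<_) (sym (*-involutive i)) i⋆<i))) (g-⁻¹ (i ⋆)))

  -- The change of sign is the gluing itself: what lies beyond side i goes to the near side of side
  -- i⋆, and vice versa.
  beyond-⋆ : ∀ i x z → beyond (i ⋆) (act₁ (g i) x z) (act₂ (g i) x z) ≡ - beyond i x z
  beyond-⋆ i x z = trans (cong₂ _*_ (g-lo i x z) (g-hi i x z)) (e (f (toℕ i) x z) (f (suc (toℕ i)) x z))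
    where
    e : ∀ u v → v * (- u) ≡ - (u * v)
    e = solve-∀

  -- Links consecutive steps of the descent: the measure at side i before the move is the upper
  -- bound that `inside-shrinks` uses at side i⋆ after it.
  width-⋆ : ∀ i x z → ∣ f (toℕ (i ⋆)) (act₁ (g i) x z) (act₂ (g i) x z) +
      f (suc (toℕ (i ⋆))) (act₁ (g i) x z) (act₂ (g i) x z) ∣ ≡ ∣ f (toℕ i) x z - f (suc (toℕ i)) x z ∣
  width-⋆ i x z = trans (cong₂ (λ u v → ∣ u + v ∣) (g-lo i x z) (g-hi i x z))
    (ℤ.∣i-j∣≡∣j-i∣ (f (suc (toℕ i)) x z) (f (toℕ i) x z))

  open Words PSL₂ℤ g _⋆ *-involutive g-⁻¹ pairingMatrices pairingMatrices⊆g using (eval; Reduced; reduced-word)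

  -- Ping-pong: the first letter i of a reduced word sends everything on the near side of the
  -- i-th side beyond the i⋆-th side, which is on the near side of all other sides.
  reduced-beyond : ∀ i is → Reduced (i ∷ is) → ∀ x z → 0ℤ ≤ side x z →
    beyond (i ⋆) (act₁ (eval (i ∷ is)) x z) (act₂ (eval (i ∷ is)) x z) ≤ 0ℤ
  reduced-beyond i is red x z 0≤s = subst₂ (λ u v → beyond (i ⋆) u v ≤ 0ℤ)
      (sym (act₁-· (g i) (eval is) x z)) (sym (act₂-· (g i) (eval is) x z))
      (subst (_≤ 0ℤ) (sym (beyond-⋆ i (act₁ (eval is) x z) (act₂ (eval is) x z))) (neg≤0 (near is red)))
    where
    near : ∀ is → Reduced (i ∷ is) → 0ℤ ≤ beyond i (act₁ (eval is) x z) (act₂ (eval is) x z)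
    near [] _ = ends⇒outside (1ℤ * x + 0ℤ * z) (0ℤ * x + 1ℤ * z)
        (subst (0ℤ ≤_) (sym (trans (f₀fₙ (1ℤ * x + 0ℤ * z) (0ℤ * x + 1ℤ * z)) (cong₂ side (e₁ x z) (e₂ x z)))) 0≤s) (Fin.toℕ<n i)
      where
      e₁ : ∀ x z → 1ℤ * x + 0ℤ * z ≡ x
      e₁ = solve-∀
      e₂ : ∀ x z → 0ℤ * x + 1ℤ * z ≡ z
      e₂ = solve-∀
    near (j ∷ js) (j≢i⋆ ∷ red) = inside⇒outside (Fin.toℕ<n (j ⋆))
      (act₁ (eval (j ∷ js)) x z) (act₂ (eval (j ∷ js)) x z) (reduced-beyond j js red x z 0≤s) (Fin.toℕ<n i)
      λ i≡j⋆ → j≢i⋆ (trans (sym (*-involutive j)) (cong _⋆ (sym (Fin.toℕ-injective i≡j⋆))))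

  ping-pong : ∀ {M} → M ∈ H → M ≈± 1ₘ ⊎ (∀ x z → 0ℤ ≤ side x z → side (act₁ M x z) (act₂ M x z) ≤ 0ℤ)
  ping-pong {M} M∈H = let (is , red , eq) = reduced-word M∈H in by-word is red eq
    where
    by-word : ∀ is → Reduced is → M ≈± eval is → _
    by-word [] _ eq = inj₁ eq
    by-word (j ∷ js) red eq = inj₂ λ x z 0≤s → subst (_≤ 0ℤ)
      (trans (f₀fₙ (act₁ N x z) (act₂ N x z)) (sym (side-≈± eq x z)))
      (inside⇒ends (Fin.toℕ<n (j ⋆)) (act₁ N x z) (act₂ N x z) (reduced-beyond j js red x z 0≤s))
      where
      N = eval (j ∷ js)

  private
    p∤b : ∀ k → k ℕ.≤ n → ¬ + p ∣ˢ b k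
    p∤b zero _ d = p∤1 pp (∣-resp b₀ d)
    p∤b (suc k) k<n d = no-cusp (fromℕ< k<n) (∣-resp (cong (λ k → b (suc k)) (sym (Fin.toℕ-fromℕ< k<n))) d)

    -- A zero would make p divide x b_k, although it divides neither factor.
    f≢0 : ∀ {x z} → + p ∣ˢ z → ¬ + p ∣ˢ x → ∀ k → k ℕ.≤ n → f k x z ≢ 0ℤ
    f≢0 {x} {z} p∣z p∤x k k≤n f≡0 = p∤b k k≤n (∤-cancelˡ pp p∤x (∣-resp (sym (ℤ.i-j≡0⇒i≡j (x * b k) (z * a k) f≡0)) (∣.∣m⇒∣m*n (a k) p∣z)))

    Γ₀-preserves : ∀ {M} → M ∈ Γ₀ p → ∀ {x z} → + p ∣ˢ z → ¬ + p ∣ˢ x →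
      + p ∣ˢ act₂ M x z × ¬ + p ∣ˢ act₁ M x z
    Γ₀-preserves {M@(mat α β γ δ det)} M∈Γ₀ {x} {z} p∣z p∤x = p∣z′ ,
      λ p∣x′ → p∤x (∣-resp (trans (e α β γ δ x z) (trans (cong (_* x) det) (ℤ.*-identityˡ x)))
        (∣.∣m∣n⇒∣m-n (∣.∣n⇒∣m*n δ p∣x′) (∣.∣n⇒∣m*n β p∣z′)))
      where
      p∣z′ = ∣.∣m∣n⇒∣m+n (∣.∣m⇒∣m*n {m = γ} x (∣.∣ᵤ⇒∣ {+ p} {γ} M∈Γ₀)) (∣.∣n⇒∣m*n δ {z} p∣z)
      e : ∀ α β γ δ x z → δ * (α * x + β * z) - β * (γ * x + δ * z) ≡ (α * δ - β * γ) * x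
      e = solve-∀

    Outside : ℤ → ℤ → Set
    Outside x z = ∃ λ h → h ∈ H × 0ℤ < side (act₁ h x z) (act₂ h x z)

    outside? : ∀ {x z} → + p ∣ˢ z → ¬ + p ∣ˢ x → 0ℤ < side x z ⊎ ∃ λ i → beyond i x z < 0ℤ
    outside? {x} {z} p∣z p∤x with ℤ.<-cmp (side x z) 0ℤ
    ... | tri> _ _ gt = inj₁ gt
    ... | tri≈ _ eq _ with ℤ.i*j≡0⇒i≡0∨j≡0 (f 0 x z) (trans (f₀fₙ x z) eq)
    ...   | inj₁ f≡0 = contradiction f≡0 (f≢0 p∣z p∤x 0 z≤n)
    ...   | inj₂ f≡0 = contradiction f≡0 (f≢0 p∣z p∤x n ℕ.≤-refl)
    outside? {x} {z} p∣z p∤x | tri< lt _ _ =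
      let (j , j<n , bey) = locate x z (f≢0 p∣z p∤x) (subst (_< 0ℤ) (sym (f₀fₙ x z)) lt) in
      inj₂ (fromℕ< j<n , subst (λ k → f k x z * f (suc k) x z < 0ℤ) (sym (Fin.toℕ-fromℕ< j<n)) bey)

    -- The measure is the sum of the absolute coordinates of v in the basis of the side it lies
    -- beyond. After the move v is on the near side of side i⋆, so any side that it is now beyond
    -- differs from i⋆, as the strict decrease requires.
    descend : ∀ {x z} i → Acc ℕ._<_ ∣ f (toℕ i) x z - f (suc (toℕ i)) x z ∣ →
      + p ∣ˢ z → ¬ + p ∣ˢ x → beyond i x z < 0ℤ → Outside x z
    descend {x} {z} i (acc rec) p∣z p∤x bey = step (outside? p∣z′ p∤x′)
      where
      x′ z′ : ℤ
      x′ = act₁ (g i) x z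
      z′ = act₂ (g i) x z
      p∣z′ : + p ∣ˢ z′
      p∣z′ = proj₁ (Γ₀-preserves {g i} (g∈Γ₀ i) p∣z p∤x)
      p∤x′ : ¬ + p ∣ˢ x′
      p∤x′ = proj₂ (Γ₀-preserves {g i} (g∈Γ₀ i) p∣z p∤x)
      i⋆≢ : ∀ j → beyond j x′ z′ < 0ℤ → toℕ (i ⋆) ≢ toℕ j
      i⋆≢ j bey′ eq = ℤ.<-asym bey′ (subst (λ k → 0ℤ < beyond k x′ z′) (Fin.toℕ-injective eq)
        (subst (0ℤ <_) (sym (beyond-⋆ i x z)) (ℤ.neg-mono-< bey)))
      step : 0ℤ < side x′ z′ ⊎ (∃ λ j → beyond j x′ z′ < 0ℤ) → Outside x z
      step (inj₁ gt) = g i , g∈H i , gt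
      step (inj₂ (j , bey′)) =
        let (h , h∈H , gt) = descend j (rec (subst (∣ f (toℕ j) x′ z′ - f (suc (toℕ j)) x′ z′ ∣ ℕ.<_) (width-⋆ i x z)
                (inside-shrinks (Fin.toℕ<n j) x′ z′ bey′ (Fin.toℕ<n (i ⋆)) (i⋆≢ j bey′)))) p∣z′ p∤x′ bey′
        in h ·ₘ g i , gen-∙ h∈H (g∈H i) ,
           subst (0ℤ <_) (sym (cong₂ side (act₁-· h (g i) x z) (act₂-· h (g i) x z))) gt

  move-outside : ∀ {x z} → + p ∣ˢ z → ¬ + p ∣ˢ x →
    ∃ λ h → h ∈ H × 0ℤ < side (act₁ h x z) (act₂ h x z)
  move-outside {x} {z} p∣z p∤x = start (outside? p∣z p∤x)
    where
    e₁ : ∀ x z → 1ℤ * x + 0ℤ * z ≡ x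
    e₁ = solve-∀
    e₂ : ∀ x z → 0ℤ * x + 1ℤ * z ≡ z
    e₂ = solve-∀
    start : 0ℤ < side x z ⊎ (∃ λ i → beyond i x z < 0ℤ) → Outside x z
    start (inj₁ gt) = 1ₘ , gen-ε , subst (0ℤ <_) (sym (cong₂ side (e₁ x z) (e₂ x z))) gt
    start (inj₂ (i , bey)) = descend i (ℕ.<-wellFounded _) p∣z p∤x bey

-- Fixed point forms

between : ∀ {x c} → 0ℤ < c → x * (x - c) ≤ 0ℤ → 0ℤ ≤ x × x ≤ c
between {x} {c} 0<c p with ≤-split x (x - c) p
... | inj₁ (0≤x , x-c≤0) = 0≤x , ℤ.i-j≤0⇒i≤j x-c≤0
... | inj₂ (x≤0 , 0≤x-c) = contradiction (ℤ.<-≤-trans 0<c (ℤ.≤-trans (ℤ.0≤i-j⇒j≤i 0≤x-c) x≤0)) (ℤ.<-irrefl refl)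

1≤square : ∀ {x} → 0ℤ < x → 0ℤ ≤ x * x - 1ℤ
1≤square 0<x = 0≤⇒1≤ (0<* 0<x 0<x)

-- The quadratic form of (A B; C D), whose roots are the fixed points.
form : (A B C D x z : ℤ) → ℤ
form A B C D x z = x * (C * x + D * z) - z * (A * x + B * z)

-- When ∞, 0, 1 are mapped into [0, 1], and ∞ also by the inverse, both fixed points lie in
-- [0, 1], so that at x/z outside [0, 1] the form is at least its leading coefficient.
module _ {A B C D : ℤ} (∞↦ : A * (A - C) ≤ 0ℤ) (∞↤ : D * (D + C) ≤ 0ℤ) (0↦ : B * (B - D) ≤ 0ℤ)
  (1↦ : (A + B) * (A + B - (C + D)) ≤ 0ℤ) where

  module _ (0<C : 0ℤ < C) where
    private
      0≤A : 0ℤ ≤ A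
      0≤A = proj₁ (between 0<C ∞↦)
      0≤C-A : 0ℤ ≤ C - A
      0≤C-A = ℤ.i≤j⇒0≤j-i (proj₂ (between 0<C ∞↦))
      D-between : 0ℤ ≤ - D × - D ≤ C
      D-between = between 0<C (subst (_≤ 0ℤ) (e C D) ∞↤)
        where
        e : ∀ C D → D * (D + C) ≡ (- D) * (- D - C)
        e = solve-∀
      0≤-D : 0ℤ ≤ - D
      0≤-D = proj₁ D-between
      D≤0 : D ≤ 0ℤ
      D≤0 = subst (_≤ 0ℤ) (ℤ.neg-involutive D) (neg≤0 0≤-D)
      0≤C+D : 0ℤ ≤ C + D
      0≤C+D = subst (0ℤ ≤_) (cong (_+_ C) (ℤ.neg-involutive D)) (ℤ.i≤j⇒0≤j-i (proj₂ D-between))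
      B≤0 : B ≤ 0ℤ
      B≤0 with ≤-split B (B - D) 0↦
      ... | inj₁ (_ , B-D≤0) = ℤ.≤-trans (ℤ.i-j≤0⇒i≤j B-D≤0) D≤0
      ... | inj₂ (B≤0 , _) = B≤0
      A+B≤C+D : A + B ≤ C + D
      A+B≤C+D with ≤-split (A + B) (A + B - (C + D)) 1↦
      ... | inj₁ (_ , le) = ℤ.i-j≤0⇒i≤j le
      ... | inj₂ (A+B≤0 , _) = ℤ.≤-trans A+B≤0 0≤C+D
      0≤σ : 0ℤ ≤ C + D - (A + B)
      0≤σ = ℤ.i≤j⇒0≤j-i A+B≤C+D

    -- By the determinant, tr² - 4 = (A - D)² + 4BC. Here BC ≤ 0, and A - D is at most 2C in
    -- absolute value since A and -D lie in [0, C].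
    trace-≤ : (A * D - B * C ≡ 1ℤ) → (A + D) * (A + D) - + 4 ≤ + 4 * (C * C)
    trace-≤ det = ≤-by (+ 4 * ((- B) * C) + ((C - A) + (C + D)) * ((C + A) + (C - D)))
      (0≤+ (0≤* {+ 4} (+≤+ z≤n) (0≤* (0≤neg B≤0) 0≤C)) (0≤* (0≤+ 0≤C-A 0≤C+D) (0≤+ (0≤+ 0≤C 0≤A) (0≤+ 0≤C 0≤-D))))
      (trans (cong (λ r → (A + D) * (A + D) - + 4 * r + (+ 4 * ((- B) * C) + ((C - A) + (C + D)) * ((C + A) + (C - D)))) (sym det))
        (e A B C D))
      where
      0≤C = ℤ.<⇒≤ 0<C
      e : ∀ A B C D → (A + D) * (A + D) - + 4 * (A * D - B * C) + (+ 4 * ((- B) * C) + ((C - A) + (C + D)) * ((C + A) + (C - D))) ≡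
        + 4 * (C * C)
      e = solve-∀

    form-≥ : ∀ {x z} → 0ℤ < x → 0ℤ < x - z → C ≤ form A B C D x z
    form-≥ {x} {z} 0<x 0<x-z with ℤ.≤-total 0ℤ z
    -- In the variables y = x - z and z the form has the coefficients C, 2C + D - A and C + D - A -
    -- B, none of them negative, and y² ≥ 1.
    ... | inj₁ 0≤z = ≤-by (C * (y * y - 1ℤ) + ((C - A) + (C + D)) * (y * z) + (C + D - (A + B)) * (z * z))
        (0≤+ (0≤+ (0≤* (ℤ.<⇒≤ 0<C) (1≤square 0<x-z)) (0≤* (0≤+ 0≤C-A 0≤C+D) (0≤* (ℤ.<⇒≤ 0<x-z) 0≤z))) (0≤* 0≤σ (0≤* 0≤z 0≤z)))
        (e A B C D x z)
      where
      y = x - z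
      e : ∀ A B C D x z → C + (C * ((x - z) * (x - z) - 1ℤ) + ((C - A) + (C + D)) * ((x - z) * z) + (C + D - (A + B)) * (z * z)) ≡
        x * (C * x + D * z) - z * (A * x + B * z)
      e = solve-∀
    -- In the variables x and -z the coefficients C, A - D and -B are nonnegative, and x² ≥ 1.
    ... | inj₂ z≤0 = ≤-by (C * (x * x - 1ℤ) + (A + - D) * (x * (- z)) + (- B) * ((- z) * (- z)))
        (0≤+ (0≤+ (0≤* (ℤ.<⇒≤ 0<C) (1≤square 0<x)) (0≤* (0≤+ 0≤A 0≤-D) (0≤* (ℤ.<⇒≤ 0<x) 0≤-z))) (0≤* (0≤neg B≤0) (0≤* 0≤-z 0≤-z)))
        (e A B C D x z)
      where
      0≤-z = 0≤neg z≤0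
      e : ∀ A B C D x z → C + (C * (x * x - 1ℤ) + (A + - D) * (x * (- z)) + (- B) * ((- z) * (- z))) ≡
        x * (C * x + D * z) - z * (A * x + B * z)
      e = solve-∀

    trace-bound-pos : A * D - B * C ≡ 1ℤ → ∀ {x z} → 0ℤ < x * (x - z) →
      (A + D) * (A + D) - + 4 ≤ + 4 * (form A B C D x z * form A B C D x z)
    trace-bound-pos det {x} {z} 0<s = ℤ.≤-trans (trace-≤ det) (≤-by (+ 4 * ((F - C) * (F + C)))
        (0≤* {+ 4} (+≤+ z≤n) (0≤* 0≤F-C (subst (0ℤ ≤_) (e F C) (0≤+ 0≤F-C (0≤+ (ℤ.<⇒≤ 0<C) (ℤ.<⇒≤ 0<C))))))
        (e′ F C))
      where
      F = form A B C D x z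
      e : ∀ F C → F - C + (C + C) ≡ F + C
      e = solve-∀
      e′ : ∀ F C → + 4 * (C * C) + + 4 * ((F - C) * (F + C)) ≡ + 4 * (F * F)
      e′ = solve-∀
      C≤F : C ≤ F
      C≤F with <-split (- x) (x - z) (subst (_< 0ℤ) (ℤ.neg-distribˡ-* x (x - z)) (ℤ.neg-mono-< 0<s))
      ... | inj₂ (-x<0 , 0<x-z) = form-≥ (subst (0ℤ <_) (ℤ.neg-involutive x) (ℤ.neg-mono-< -x<0)) 0<x-z
      ... | inj₁ (0<-x , x-z<0) = subst (C ≤_) (e″ A B C D x z)
          (form-≥ { - x} { - z} 0<-x (subst (0ℤ <_) (e‴ x z) (ℤ.neg-mono-< x-z<0)))
        where
        e″ : ∀ A B C D x z → (- x) * (C * (- x) + D * (- z)) - (- z) * (A * (- x) + B * (- z)) ≡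
          x * (C * x + D * z) - z * (A * x + B * z)
        e″ = solve-∀
        e‴ : ∀ x z → - (x - z) ≡ - x - - z
        e‴ = solve-∀
      0≤F-C : 0ℤ ≤ F - C
      0≤F-C = ℤ.i≤j⇒0≤j-i C≤F

trace-bound : ∀ A B C D → A * (A - C) ≤ 0ℤ → D * (D + C) ≤ 0ℤ → B * (B - D) ≤ 0ℤ →
  (A + B) * (A + B - (C + D)) ≤ 0ℤ → A * D - B * C ≡ 1ℤ → ∀ x z → 0ℤ < x * (x - z) →
  (A + D) * (A + D) - + 4 ≤ + 4 * (form A B C D x z * form A B C D x z)
trace-bound A B C D p q r s det x z t with ℤ.<-cmp C 0ℤ
... | tri> _ _ 0<C = trace-bound-pos {A} {B} {C} {D} p q r s 0<C det {x} {z} t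
-- If C = 0, then ∞ is fixed and cannot go to [0, 1]: the first hypothesis becomes A² ≤ 0, so the
-- determinant would vanish.
... | tri≈ _ refl _ = contradiction (trans (sym det) (trans (cong (λ A → A * D - B * 0ℤ) A≡0) (e B D))) λ ()
  where
  e : ∀ B D → 0ℤ * D - B * 0ℤ ≡ 0ℤ
  e = solve-∀
  e′ : ∀ A → A * (A - 0ℤ) ≡ A * A
  e′ = solve-∀
  zero-square : ∀ A → A * A ≤ 0ℤ → A ≡ 0ℤ
  zero-square (+ zero) _ = refl
  zero-square (+ suc _) (+≤+ ())
  zero-square -[1+ _ ] (+≤+ ())
  A≡0 : A ≡ 0ℤ
  A≡0 = zero-square A (subst (_≤ 0ℤ) (e′ A) p)
-- The matrix -M acts in the same way and has positive lower left entry.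
... | tri< C<0 _ _ = subst₂ _≤_ (e₁ A D) (e₂ A B C D x z) (trace-bound-pos { - A} { - B} { - C} { - D}
    (subst (_≤ 0ℤ) (e₃ A C) p) (subst (_≤ 0ℤ) (e₄ C D) q) (subst (_≤ 0ℤ) (e₃ B D) r) (subst (_≤ 0ℤ) (e₅ A B C D) s)
    (ℤ.neg-mono-< C<0) (trans (e₆ A B C D) det) {x} {z} t)
  where
  e₁ : ∀ A D → (- A + - D) * (- A + - D) - + 4 ≡ (A + D) * (A + D) - + 4
  e₁ = solve-∀
  e₂ : ∀ A B C D x z →
    + 4 * ((x * ((- C) * x + (- D) * z) - z * ((- A) * x + (- B) * z)) * (x * ((- C) * x + (- D) * z) - z * ((- A) * x + (- B) * z))) ≡
    + 4 * ((x * (C * x + D * z) - z * (A * x + B * z)) * (x * (C * x + D * z) - z * (A * x + B * z)))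
  e₂ = solve-∀
  e₃ : ∀ A C → A * (A - C) ≡ (- A) * (- A - - C)
  e₃ = solve-∀
  e₄ : ∀ C D → D * (D + C) ≡ (- D) * (- D + - C)
  e₄ = solve-∀
  e₅ : ∀ A B C D → (A + B) * (A + B - (C + D)) ≡ (- A + - B) * (- A + - B - (- C + - D))
  e₅ = solve-∀
  e₆ : ∀ A B C D → (- A) * (- D) - (- B) * (- C) ≡ A * D - B * C
  e₆ = solve-∀

-- Conjugation and the trace bound for the group

formOf : SL₂ℤ → ℤ → ℤ → ℤ
formOf M x z = x * act₂ M x z - z * act₁ M x z

tr : SL₂ℤ → ℤ
tr M = m₁₁ M + m₂₂ M

conj : SL₂ℤ → SL₂ℤ → SL₂ℤ
conj h M = (h ·ₘ M) ·ₘ (h ⁻¹ₘ)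

tr-conj : ∀ h M → tr (conj h M) ≡ tr M
tr-conj (mat α β γ δ det) (mat a b c d _) = trans (e α β γ δ a b c d) (trans (cong (_* (a + d)) det) (ℤ.*-identityˡ (a + d)))
  where
  e : ∀ α β γ δ a b c d →
    ((α * a + β * c) * δ + (α * b + β * d) * (- γ)) + ((γ * a + δ * c) * (- β) + (γ * b + δ * d) * α) ≡
    (α * δ - β * γ) * (a + d)
  e = solve-∀

-- `formOf M` at v is the determinant of v and Mv. Conjugation replaces these vectors by hv and hMv,
-- and h preserves determinants.
formOf-conj : ∀ h M x z → formOf (conj h M) (act₁ h x z) (act₂ h x z) ≡ formOf M x z
formOf-conj h@(mat α β γ δ det) M x z = begin
  formOf (conj h M) X Z
    ≡⟨ cong₂ (λ u v → X * u - Z * v) (push act₂ act₂-·) (push act₁ act₁-·) ⟩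
  X * act₂ h x′ z′ - Z * act₁ h x′ z′
    ≡⟨ e₃ α β γ δ x z x′ z′ ⟩
  (α * δ - β * γ) * (x * z′ - z * x′)
    ≡⟨ trans (cong (_* (x * z′ - z * x′)) det) (ℤ.*-identityˡ (x * z′ - z * x′)) ⟩
  formOf M x z ∎
  where
  open ≡-Reasoning
  X Z x′ z′ : ℤ
  X = act₁ h x z
  Z = act₂ h x z
  x′ = act₁ M x z
  z′ = act₂ M x z
  e₁ : ∀ α β γ δ x z → δ * (α * x + β * z) + (- β) * (γ * x + δ * z) ≡ (α * δ - β * γ) * x
  e₁ = solve-∀
  e₂ : ∀ α β γ δ x z → (- γ) * (α * x + β * z) + α * (γ * x + δ * z) ≡ (α * δ - β * γ) * z
  e₂ = solve-∀
  e₃ : ∀ α β γ δ x z x′ z′ → (α * x + β * z) * (γ * x′ + δ * z′) - (γ * x + δ * z) * (α * x′ + β * z′) ≡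
    (α * δ - β * γ) * (x * z′ - z * x′)
  e₃ = solve-∀
  back₁ : act₁ (h ⁻¹ₘ) X Z ≡ x
  back₁ = trans (e₁ α β γ δ x z) (trans (cong (_* x) det) (ℤ.*-identityˡ x))
  back₂ : act₂ (h ⁻¹ₘ) X Z ≡ z
  back₂ = trans (e₂ α β γ δ x z) (trans (cong (_* z) det) (ℤ.*-identityˡ z))
  push : (act : SL₂ℤ → ℤ → ℤ → ℤ) →
    (∀ M N x z → act (M ·ₘ N) x z ≡ act M (act₁ N x z) (act₂ N x z)) →
    act (conj h M) X Z ≡ act h x′ z′
  push act act-· = trans (act-· (h ·ₘ M) (h ⁻¹ₘ) X Z)
    (trans (cong₂ (act (h ·ₘ M)) back₁ back₂) (act-· h M x z))

formOf-≈±1 : ∀ {M} → M ≈± 1ₘ → ∀ x z → formOf M x z ≡ 0ℤ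
formOf-≈±1 (plus (entries refl refl refl refl)) x z = e x z
  where
  e : ∀ x z → x * (0ℤ * x + 1ℤ * z) - z * (1ℤ * x + 0ℤ * z) ≡ 0ℤ
  e = solve-∀
formOf-≈±1 (minus (entries refl refl refl refl)) x z = e x z
  where
  e : ∀ x z → x * ((- 0ℤ) * x + (- 1ℤ) * z) - z * ((- 1ℤ) * x + (- 0ℤ) * z) ≡ 0ℤ
  e = solve-∀

formOf-⁻¹ : ∀ M x z → formOf (M ⁻¹ₘ) x z ≡ - formOf M x z
formOf-⁻¹ (mat a b c d _) x z = e a b c d x z
  where
  e : ∀ a b c d x z → x * ((- c) * x + a * z) - z * (d * x + (- b) * z) ≡ - (x * (c * x + d * z) - z * (a * x + b * z))
  e = solve-∀

Contracting : SL₂ℤ → Set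
Contracting M = ∀ x z → 0ℤ ≤ side x z → side (act₁ M x z) (act₂ M x z) ≤ 0ℤ

-- Four images suffice: those of ∞, 0 and 1 under M, and that of ∞ under the inverse.
contracting-bound : ∀ M → Contracting M → Contracting (M ⁻¹ₘ) → ∀ {x z} → 0ℤ < side x z →
  tr M * tr M - + 4 ≤ + 4 * (formOf M x z * formOf M x z)
contracting-bound (mat A B C D det) con con⁻¹ {x} {z} = trace-bound A B C D
  (subst (_≤ 0ℤ) (e₁ A B C D) (con 1ℤ 0ℤ (+≤+ z≤n)))
  (subst (_≤ 0ℤ) (e₂ A B C D) (con⁻¹ 1ℤ 0ℤ (+≤+ z≤n)))
  (subst (_≤ 0ℤ) (e₃ A B C D) (con 0ℤ 1ℤ (+≤+ z≤n)))
  (subst (_≤ 0ℤ) (e₄ A B C D) (con 1ℤ 1ℤ (+≤+ z≤n)))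
  det x z
  where
  e₁ : ∀ A B C D → (A * 1ℤ + B * 0ℤ) * (A * 1ℤ + B * 0ℤ - (C * 1ℤ + D * 0ℤ)) ≡ A * (A - C)
  e₁ = solve-∀
  e₂ : ∀ A B C D → (D * 1ℤ + (- B) * 0ℤ) * (D * 1ℤ + (- B) * 0ℤ - ((- C) * 1ℤ + A * 0ℤ)) ≡ D * (D + C)
  e₂ = solve-∀
  e₃ : ∀ A B C D → (A * 0ℤ + B * 1ℤ) * (A * 0ℤ + B * 1ℤ - (C * 0ℤ + D * 1ℤ)) ≡ B * (B - D)
  e₃ = solve-∀
  e₄ : ∀ A B C D → (A * 1ℤ + B * 1ℤ) * (A * 1ℤ + B * 1ℤ - (C * 1ℤ + D * 1ℤ)) ≡ (A + B) * (A + B - (C + D))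
  e₄ = solve-∀

generated-conj : ∀ {S : Pred SL₂ℤ 0ℓ} {h M} → h ∈ Generated PSL₂ℤ S → M ∈ Generated PSL₂ℤ S → conj h M ∈ Generated PSL₂ℤ S
generated-conj {h = h} {M} h∈ M∈ = gen-∙ {x = h ·ₘ M} {h ⁻¹ₘ} (gen-∙ {x = h} {M} h∈ M∈) (gen-⁻¹ {x = h} h∈)

module _ {p : ℕ} (pp : Prime p) (12∣p+1 : 12 ℕ.∣ p ℕ.+ 1) (F : FareySymbol p) where
  open Pairing pp 12∣p+1 F using (H; ping-pong; move-outside)

  -- Trace and form value do not change when M is conjugated and the cusp moves along. A nonzero
  -- form value rules out the trivial case of `ping-pong`.
  H-trace-bound : ∀ {M} → M ∈ H → ∀ {x z} → + p ∣ˢ z → ¬ + p ∣ˢ x → formOf M x z ≢ 0ℤ →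
    tr M * tr M - + 4 ≤ + 4 * (formOf M x z * formOf M x z)
  H-trace-bound {M} M∈H {x} {z} p∣z p∤x F≢0 =
    let (h , h∈H , out) = move-outside p∣z p∤x in bound h h∈H out
    where
    bound : ∀ h → h ∈ H → 0ℤ < side (act₁ h x z) (act₂ h x z) →
      tr M * tr M - + 4 ≤ + 4 * (formOf M x z * formOf M x z)
    bound h h∈H out = subst₂ (λ t f → t * t - + 4 ≤ + 4 * (f * f)) (tr-conj h M) (formOf-conj h M x z)
        (by-cases (ping-pong N∈H) (ping-pong (gen-⁻¹ {x = N} N∈H)))
      where
      N = conj h M
      X Z : ℤ
      X = act₁ h x z
      Z = act₂ h x z
      N∈H : N ∈ H
      N∈H = generated-conj h∈H M∈H
      FN≢0 : formOf N X Z ≢ 0ℤ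
      FN≢0 eq = F≢0 (trans (sym (formOf-conj h M x z)) eq)
      by-cases : N ≈± 1ₘ ⊎ Contracting N → (N ⁻¹ₘ) ≈± 1ₘ ⊎ Contracting (N ⁻¹ₘ) →
        tr N * tr N - + 4 ≤ + 4 * (formOf N X Z * formOf N X Z)
      by-cases (inj₁ N≈1) _ = contradiction (formOf-≈±1 N≈1 X Z) FN≢0
      by-cases (inj₂ _) (inj₁ N≈1) = contradiction (ℤ.neg-injective (trans (sym (formOf-⁻¹ N X Z)) (formOf-≈±1 N≈1 X Z))) FN≢0
      by-cases (inj₂ con) (inj₂ con⁻¹) = contracting-bound N con con⁻¹ {X} {Z} out

-- Real quadratic fields of class number one

ℚ-ring : AlmostCommutativeRing 0ℓ 0ℓ
ℚ-ring = fromCommutativeRing ℚ.+-*-commutativeRing is0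
  where
  is0 : ∀ x → Maybe (0ℚ ≡ x)
  is0 x with 0ℚ ℚ.≟ x
  ... | yes p = just p
  ... | no _ = nothing

toℚᵘ-ι : ∀ m → toℚᵘ (ι m) ℚᵘ.≃ mkℚᵘ m 0
toℚᵘ-ι m = ℚ.toℚᵘ-fromℚᵘ (mkℚᵘ m 0)

ι-+ : ∀ m n → ι (m + n) ≡ ι m ℚ.+ ι n
ι-+ m n = ℚ.toℚᵘ-injective (begin
  toℚᵘ (ι (m + n))               ≈⟨ toℚᵘ-ι (m + n) ⟩
  mkℚᵘ (m + n) 0                 ≈⟨ *≡* (e m n) ⟩
  mkℚᵘ m 0 ℚᵘ.+ mkℚᵘ n 0         ≈⟨ ℚᵘ.+-cong (toℚᵘ-ι m) (toℚᵘ-ι n) ⟨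
  toℚᵘ (ι m) ℚᵘ.+ toℚᵘ (ι n)     ≈⟨ ℚ.toℚᵘ-homo-+ (ι m) (ι n) ⟨
  toℚᵘ (ι m ℚ.+ ι n)             ∎)
  where
  open ℚᵘ.≃-Reasoning
  e : ∀ m n → (m + n) * 1ℤ ≡ (m * 1ℤ + n * 1ℤ) * 1ℤ
  e = solve-∀

ι-* : ∀ m n → ι (m * n) ≡ ι m ℚ.* ι n
ι-* m n = ℚ.toℚᵘ-injective (begin
  toℚᵘ (ι (m * n))               ≈⟨ toℚᵘ-ι (m * n) ⟩
  mkℚᵘ (m * n) 0                 ≈⟨ *≡* refl ⟩
  mkℚᵘ m 0 ℚᵘ.* mkℚᵘ n 0         ≈⟨ ℚᵘ.*-cong (toℚᵘ-ι m) (toℚᵘ-ι n) ⟨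
  toℚᵘ (ι m) ℚᵘ.* toℚᵘ (ι n)     ≈⟨ ℚ.toℚᵘ-homo-* (ι m) (ι n) ⟨
  toℚᵘ (ι m ℚ.* ι n)             ∎)
  where
  open ℚᵘ.≃-Reasoning

ι-injective : ∀ {m n} → ι m ≡ ι n → m ≡ n
ι-injective {m} {n} eq = ℤ.*-cancelʳ-≡ m n 1ℤ (ℚᵘ.drop-*≡* (ℚᵘ.≃-trans (ℚᵘ.≃-sym (toℚᵘ-ι m))
  (ℚᵘ.≃-trans (ℚᵘ.≃-reflexive (cong toℚᵘ eq)) (toℚᵘ-ι n))))

ι-neg : ∀ m → ι (- m) ≡ ℚ.- ι m
ι-neg m = e (ι m) (ι (- m)) (trans (sym (ι-+ m (- m))) (cong ι (ℤ.+-inverseʳ m)))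
  where
  e′ : ∀ x y → y ≡ (x ℚ.+ y) ℚ.- x
  e′ = RingSolver.solve-∀ ℚ-ring
  e″ : ∀ x → 0ℚ ℚ.- x ≡ ℚ.- x
  e″ = RingSolver.solve-∀ ℚ-ring
  e : ∀ x y → x ℚ.+ y ≡ 0ℚ → y ≡ ℚ.- x
  e x y eq = trans (e′ x y) (trans (cong (ℚ._- x) eq) (e″ x))

ι-sub : ∀ m n → ι (m - n) ≡ ι m ℚ.- ι n
ι-sub m n = trans (ι-+ m (- n)) (cong (ι m ℚ.+_) (ι-neg n))

/2≡*½ : ∀ m → m ℚ./ 2 ≡ ι m ℚ.* ½
/2≡*½ m = ℚ.toℚᵘ-injective (begin
  toℚᵘ (m ℚ./ 2)                 ≈⟨ ℚ.toℚᵘ-fromℚᵘ (mkℚᵘ m 1) ⟩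
  mkℚᵘ m 1                       ≈⟨ *≡* (e m) ⟩
  mkℚᵘ m 0 ℚᵘ.* toℚᵘ ½           ≈⟨ ℚᵘ.*-cong (toℚᵘ-ι m) ℚᵘ.≃-refl ⟨
  toℚᵘ (ι m) ℚᵘ.* toℚᵘ ½         ≈⟨ ℚ.toℚᵘ-homo-* (ι m) ½ ⟨
  toℚᵘ (ι m ℚ.* ½)               ∎)
  where
  open ℚᵘ.≃-Reasoning
  e : ∀ m → m * + 2 ≡ m * 1ℤ * + 2
  e = solve-∀

ℚ-cancelˡ : ∀ {x y z} → x ≢ 0ℚ → x ℚ.* y ≡ x ℚ.* z → y ≡ z
ℚ-cancelˡ {x} {y} {z} x≢0 eq = trans (sym (undo y)) (trans (cong (x⁻¹ ℚ.*_) eq) (undo z))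
  where
  instance
    x-nonZero = ℚ.≢-nonZero x≢0
  x⁻¹ = ℚ.1/ x
  undo : ∀ w → x⁻¹ ℚ.* (x ℚ.* w) ≡ w
  undo w = trans (sym (ℚ.*-assoc x⁻¹ x w)) (trans (cong (ℚ._* w) (ℚ.*-inverseˡ x)) (ℚ.*-identityˡ w))

-- Norms and lattices in the quadratic field

module Squarefree (K : RealQuadraticField) where
  open RealQuadraticField K

  non-square : ∀ q → q ℚ.* q ≢ ι (+ D)
  non-square q@(mkℚ n d-1 cop) eq = ℕ.<-irrefl (sym D≡1) 1<D
    where
    m d : ℕ
    m = ∣ n ∣
    d = suc d-1
    n² : n * n ≡ + D * (+ d * + d)
    n² = trans (sym (ℤ.*-identityʳ (n * n))) (ℚᵘ.drop-*≡* (ℚᵘ.≃-trans (ℚᵘ.≃-sym (ℚ.toℚᵘ-homo-* q q))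
      (ℚᵘ.≃-trans (ℚᵘ.≃-reflexive (cong toℚᵘ eq)) (toℚᵘ-ι (+ D)))))
    m² : m ℕ.* m ≡ D ℕ.* (d ℕ.* d)
    m² = trans (sym (ℤ.abs-* n n)) (trans (cong ∣_∣ n²) (ℤ.abs-* (+ D) (+ d * + d)))
    coprime : Coprime m d
    coprime = recompute cop
    d∣m : d ℕ.∣ m
    d∣m = coprime-divisor (λ (i∣d , i∣m) → coprime (i∣m , i∣d))
      (ℕ.divides (D ℕ.* d) (trans m² (sym (ℕ.*-assoc D d d))))
    d≡1 : d ≡ 1
    d≡1 = coprime (d∣m , ℕ.∣-refl)
    m²≡D : m ℕ.* m ≡ D
    m²≡D = trans m² (trans (cong (λ d → D ℕ.* (d ℕ.* d)) d≡1) (ℕ.*-identityʳ D))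
    m≡1 : m ≡ 1
    m≡1 = squarefree m (ℕ.divides 1 (trans (sym m²≡D) (sym (ℕ.*-identityˡ (m ℕ.* m)))))
    D≡1 : D ≡ 1
    D≡1 = trans (sym m²≡D) (cong (λ m → m ℕ.* m) m≡1)

  x²≡Dy²⇒y≡0 : ∀ {x y} → x ℚ.* x ≡ ι (+ D) ℚ.* (y ℚ.* y) → y ≡ 0ℚ
  x²≡Dy²⇒y≡0 {x} {y} eq with y ℚ.≟ 0ℚ
  ... | yes y≡0 = y≡0
  ... | no y≢0 = contradiction (trans (e x y⁻¹) (trans (cong (ℚ._* (y⁻¹ ℚ.* y⁻¹)) eq) (trans (e′ (ι (+ D)) y y⁻¹)
        (trans (cong (λ u → ι (+ D) ℚ.* (u ℚ.* u)) (ℚ.*-inverseʳ y)) (ℚ.*-identityʳ (ι (+ D)))))))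
      (non-square (x ℚ.* y⁻¹))
    where
    instance
      y-nonZero = ℚ.≢-nonZero y≢0
    y⁻¹ = ℚ.1/ y
    e : ∀ x z → (x ℚ.* z) ℚ.* (x ℚ.* z) ≡ (x ℚ.* x) ℚ.* (z ℚ.* z)
    e = RingSolver.solve-∀ ℚ-ring
    e′ : ∀ D y z → (D ℚ.* (y ℚ.* y)) ℚ.* (z ℚ.* z) ≡ D ℚ.* ((y ℚ.* z) ℚ.* (y ℚ.* z))
    e′ = RingSolver.solve-∀ ℚ-ring

module Arithmetic (K : RealQuadraticField) where
  open RealQuadraticField K
  open Squarefree K
  open Element

  𝔻 : ℚ
  𝔻 = ι (+ D)

  infixl 7 _⊗_
  _⊗_ : Element K → Element K → Element K
  _⊗_ = _*ᴷ_ K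

  det : Element K → Element K → ℚ
  det α β = re α ℚ.* im β ℚ.- im α ℚ.* re β

  element-≡ : ∀ {x y x′ y′} → x ≡ x′ → y ≡ y′ → _≡_ {A = Element K} (x ∔ y √D) (x′ ∔ y′ √D)
  element-≡ refl refl = refl

  norm-* : ∀ α β → norm K (α ⊗ β) ≡ norm K α ℚ.* norm K β
  norm-* (x ∔ y √D) (x′ ∔ y′ √D) = e 𝔻 x y x′ y′
    where
    e : ∀ D x y x′ y′ →
      (x ℚ.* x′ ℚ.+ D ℚ.* (y ℚ.* y′)) ℚ.* (x ℚ.* x′ ℚ.+ D ℚ.* (y ℚ.* y′)) ℚ.-
        D ℚ.* ((x ℚ.* y′ ℚ.+ y ℚ.* x′) ℚ.* (x ℚ.* y′ ℚ.+ y ℚ.* x′)) ≡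
      (x ℚ.* x ℚ.- D ℚ.* (y ℚ.* y)) ℚ.* (x′ ℚ.* x′ ℚ.- D ℚ.* (y′ ℚ.* y′))
    e = RingSolver.solve-∀ ℚ-ring

  -- Multiplication by α is a linear map with determinant N(α).
  det-* : ∀ α β γ → det (α ⊗ β) (α ⊗ γ) ≡ norm K α ℚ.* det β γ
  det-* (x ∔ y √D) (x′ ∔ y′ √D) (x″ ∔ y″ √D) = e 𝔻 x y x′ y′ x″ y″
    where
    e : ∀ D x y x′ y′ x″ y″ →
      (x ℚ.* x′ ℚ.+ D ℚ.* (y ℚ.* y′)) ℚ.* (x ℚ.* y″ ℚ.+ y ℚ.* x″) ℚ.-
        (x ℚ.* y′ ℚ.+ y ℚ.* x′) ℚ.* (x ℚ.* x″ ℚ.+ D ℚ.* (y ℚ.* y″)) ≡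
      (x ℚ.* x ℚ.- D ℚ.* (y ℚ.* y)) ℚ.* (x′ ℚ.* y″ ℚ.- y′ ℚ.* x″)
    e = RingSolver.solve-∀ ℚ-ring

  norm≢0 : ∀ {α} → α ≢ 0ᴷ K → norm K α ≢ 0ℚ
  norm≢0 {x ∔ y √D} α≢0 N≡0 = α≢0 (element-≡ x≡0 y≡0)
    where
    x²≡Dy² : x ℚ.* x ≡ 𝔻 ℚ.* (y ℚ.* y)
    x²≡Dy² = trans (e (x ℚ.* x) (𝔻 ℚ.* (y ℚ.* y))) (trans (cong (ℚ._+ 𝔻 ℚ.* (y ℚ.* y)) N≡0) (ℚ.+-identityˡ _))
      where
      e : ∀ u v → u ≡ (u ℚ.- v) ℚ.+ v
      e = RingSolver.solve-∀ ℚ-ring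
    y≡0 = x²≡Dy²⇒y≡0 {x} {y} x²≡Dy²
    x≡0 : x ≡ 0ℚ
    x≡0 with x ℚ.≟ 0ℚ
    ... | yes x≡0 = x≡0
    ... | no x≢0 = ℚ-cancelˡ x≢0 (trans x²≡Dy² (trans (cong (λ y → 𝔻 ℚ.* (y ℚ.* y)) y≡0) (e 𝔻 x)))
      where
      e : ∀ D x → D ℚ.* (0ℚ ℚ.* 0ℚ) ≡ x ℚ.* 0ℚ
      e = RingSolver.solve-∀ ℚ-ring

  -- θ = (b + √d)/2, written β + h√D, is a root of X² − bX + P, and 𝓞 = ℤ + ℤθ.
  module Order {d : ℕ} (disc : IsDiscriminant K d) (d≢0 : d ≢ 0)
    (b P : ℤ) (b²-4P≡d : b * b - + 4 * P ≡ + d) where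

    private
      ω₁ ω₂ : Element K
      ω₁ = proj₁ disc
      ω₂ = proj₁ (proj₂ disc)
      basis : IsIntegralBasis K ω₁ ω₂
      basis = proj₁ (proj₂ (proj₂ disc))

    -- The discriminant of the basis equals 4D det(ω₁, ω₂)², so `h` √D is half a square root of d.
    -- Only h² matters, so either sign will do.
    h β : ℚ
    h = det ω₁ ω₂
    β = ι b ℚ.* ½

    private
      4Dh²≡d : ι (+ d) ≡ (1ℚ ℚ.+ 1ℚ) ℚ.* (1ℚ ℚ.+ 1ℚ) ℚ.* (𝔻 ℚ.* (h ℚ.* h))
      4Dh²≡d = trans (proj₂ (proj₂ (proj₂ disc))) (e 𝔻 (re ω₁) (im ω₁) (re ω₂) (im ω₂))
        where
        e : ∀ D x y x′ y′ →
          (x ℚ.* x ℚ.+ D ℚ.* (y ℚ.* y) ℚ.+ (x ℚ.* x ℚ.+ D ℚ.* (y ℚ.* y))) ℚ.*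
          (x′ ℚ.* x′ ℚ.+ D ℚ.* (y′ ℚ.* y′) ℚ.+ (x′ ℚ.* x′ ℚ.+ D ℚ.* (y′ ℚ.* y′))) ℚ.-
          (x ℚ.* x′ ℚ.+ D ℚ.* (y ℚ.* y′) ℚ.+ (x ℚ.* x′ ℚ.+ D ℚ.* (y ℚ.* y′))) ℚ.*
          (x′ ℚ.* x ℚ.+ D ℚ.* (y′ ℚ.* y) ℚ.+ (x′ ℚ.* x ℚ.+ D ℚ.* (y′ ℚ.* y))) ≡
          (1ℚ ℚ.+ 1ℚ) ℚ.* (1ℚ ℚ.+ 1ℚ) ℚ.* (D ℚ.* ((x ℚ.* y′ ℚ.- y ℚ.* x′) ℚ.* (x ℚ.* y′ ℚ.- y ℚ.* x′)))
        e = RingSolver.solve-∀ ℚ-ring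

    Dh² : 𝔻 ℚ.* (h ℚ.* h) ≡ β ℚ.* β ℚ.- ι P
    Dh² = trans (e (𝔻 ℚ.* (h ℚ.* h))) (trans (cong (λ r → ½ ℚ.* ½ ℚ.* r)
        (trans (sym 4Dh²≡d) (trans (cong ι (sym b²-4P≡d))
          (trans (ι-sub (b * b) (+ 4 * P)) (cong₂ ℚ._-_ (ι-* b b) (ι-* (+ 4) P))))))
        (e′ (ι b) (ι P)))
      where
      e : ∀ r → r ≡ ½ ℚ.* ½ ℚ.* ((1ℚ ℚ.+ 1ℚ) ℚ.* (1ℚ ℚ.+ 1ℚ) ℚ.* r)
      e = RingSolver.solve-∀ ℚ-ring
      e′ : ∀ b P → ½ ℚ.* ½ ℚ.* (b ℚ.* b ℚ.- ι (+ 4) ℚ.* P) ≡ b ℚ.* ½ ℚ.* (b ℚ.* ½) ℚ.- P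
      e′ = RingSolver.solve-∀ ℚ-ring

    h≢0 : h ≢ 0ℚ
    h≢0 h≡0 = d≢0 (ℤ.+-injective (ι-injective (trans 4Dh²≡d
      (trans (cong (λ h → (1ℚ ℚ.+ 1ℚ) ℚ.* (1ℚ ℚ.+ 1ℚ) ℚ.* (𝔻 ℚ.* (h ℚ.* h))) h≡0) (e 𝔻)))))
      where
      e : ∀ D → (1ℚ ℚ.+ 1ℚ) ℚ.* (1ℚ ℚ.+ 1ℚ) ℚ.* (D ℚ.* (0ℚ ℚ.* 0ℚ)) ≡ 0ℚ
      e = RingSolver.solve-∀ ℚ-ring

    elt : ℤ → ℤ → Element K
    elt m n = (ι m ℚ.+ ι n ℚ.* β) ∔ (ι n ℚ.* h) √D

    ι-norm-form : ∀ m n →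
      ι (m * m + b * (m * n) + P * (n * n)) ≡ ι m ℚ.* ι m ℚ.+ ι b ℚ.* (ι m ℚ.* ι n) ℚ.+ ι P ℚ.* (ι n ℚ.* ι n)
    ι-norm-form m n = trans (ι-+ (m * m + b * (m * n)) (P * (n * n))) (cong₂ ℚ._+_
      (trans (ι-+ (m * m) (b * (m * n))) (cong₂ ℚ._+_ (ι-* m m) (trans (ι-* b (m * n)) (cong (ι b ℚ.*_) (ι-* m n)))))
      (trans (ι-* P (n * n)) (cong (ι P ℚ.*_) (ι-* n n))))

    -- The witness is the characteristic polynomial: the list holds the norm and minus the trace of
    -- m + nθ.
    elt∈𝓞 : ∀ m n → elt m n ∈ 𝓞 K
    elt∈𝓞 m n = (m * m + b * (m * n) + P * (n * n)) ∷ - (m + m + b * n) ∷ [] , element-≡ re≡0 im≡0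
      where
      M N x y : ℚ
      M = ι m
      N = ι n
      x = M ℚ.+ N ℚ.* β
      y = N ℚ.* h
      s≡ : ι (- (m + m + b * n)) ≡ ℚ.- (x ℚ.+ x)
      s≡ = trans (ι-neg (m + m + b * n)) (cong ℚ.-_ (trans (ι-+ (m + m) (b * n))
        (trans (cong₂ ℚ._+_ (ι-+ m m) (ι-* b n)) (e (ι b) M N))))
        where
        e : ∀ b M N → M ℚ.+ M ℚ.+ b ℚ.* N ≡ M ℚ.+ N ℚ.* (b ℚ.* ½) ℚ.+ (M ℚ.+ N ℚ.* (b ℚ.* ½))
        e = RingSolver.solve-∀ ℚ-ring
      t≡ = ι-norm-form m n
      re≡0 : ι (m * m + b * (m * n) + P * (n * n)) ℚ.+
        (x ℚ.* (ι (- (m + m + b * n)) ℚ.+ (x ℚ.* 1ℚ ℚ.+ 𝔻 ℚ.* (y ℚ.* 0ℚ))) ℚ.+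
          𝔻 ℚ.* (y ℚ.* (0ℚ ℚ.+ (x ℚ.* 0ℚ ℚ.+ y ℚ.* 1ℚ)))) ≡ 0ℚ
      re≡0 = trans (cong₂ (λ t s → t ℚ.+ (x ℚ.* (s ℚ.+ (x ℚ.* 1ℚ ℚ.+ 𝔻 ℚ.* (y ℚ.* 0ℚ))) ℚ.+
          𝔻 ℚ.* (y ℚ.* (0ℚ ℚ.+ (x ℚ.* 0ℚ ℚ.+ y ℚ.* 1ℚ))))) t≡ s≡)
        (trans (e 𝔻 M N (ι b) h (ι P)) (trans (cong (λ r → N ℚ.* N ℚ.* (r ℚ.- (β ℚ.* β ℚ.- ι P))) Dh²) (e′ N (β ℚ.* β ℚ.- ι P))))
        where
        e : ∀ D M N b h P →
          M ℚ.* M ℚ.+ b ℚ.* (M ℚ.* N) ℚ.+ P ℚ.* (N ℚ.* N) ℚ.+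
          ((M ℚ.+ N ℚ.* (b ℚ.* ½)) ℚ.* (ℚ.- (M ℚ.+ N ℚ.* (b ℚ.* ½) ℚ.+ (M ℚ.+ N ℚ.* (b ℚ.* ½))) ℚ.+
             ((M ℚ.+ N ℚ.* (b ℚ.* ½)) ℚ.* 1ℚ ℚ.+ D ℚ.* (N ℚ.* h ℚ.* 0ℚ))) ℚ.+
           D ℚ.* (N ℚ.* h ℚ.* (0ℚ ℚ.+ ((M ℚ.+ N ℚ.* (b ℚ.* ½)) ℚ.* 0ℚ ℚ.+ N ℚ.* h ℚ.* 1ℚ)))) ≡
          N ℚ.* N ℚ.* (D ℚ.* (h ℚ.* h) ℚ.- (b ℚ.* ½ ℚ.* (b ℚ.* ½) ℚ.- P))
        e = RingSolver.solve-∀ ℚ-ring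
        e′ : ∀ N r → N ℚ.* N ℚ.* (r ℚ.- r) ≡ 0ℚ
        e′ = RingSolver.solve-∀ ℚ-ring
      im≡0 : 0ℚ ℚ.+ (x ℚ.* (0ℚ ℚ.+ (x ℚ.* 0ℚ ℚ.+ y ℚ.* 1ℚ)) ℚ.+
        y ℚ.* (ι (- (m + m + b * n)) ℚ.+ (x ℚ.* 1ℚ ℚ.+ 𝔻 ℚ.* (y ℚ.* 0ℚ)))) ≡ 0ℚ
      im≡0 = trans (cong (λ s → 0ℚ ℚ.+ (x ℚ.* (0ℚ ℚ.+ (x ℚ.* 0ℚ ℚ.+ y ℚ.* 1ℚ)) ℚ.+
          y ℚ.* (s ℚ.+ (x ℚ.* 1ℚ ℚ.+ 𝔻 ℚ.* (y ℚ.* 0ℚ))))) s≡) (e 𝔻 x y)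
        where
        e : ∀ D x y → 0ℚ ℚ.+ (x ℚ.* (0ℚ ℚ.+ (x ℚ.* 0ℚ ℚ.+ y ℚ.* 1ℚ)) ℚ.+
          y ℚ.* (ℚ.- (x ℚ.+ x) ℚ.+ (x ℚ.* 1ℚ ℚ.+ D ℚ.* (y ℚ.* 0ℚ)))) ≡ 0ℚ
        e = RingSolver.solve-∀ ℚ-ring

    det-elt : ∀ m n m′ n′ → det (elt m n) (elt m′ n′) ≡ ι (m * n′ - n * m′) ℚ.* h
    det-elt m n m′ n′ = trans (e (ι m) (ι n) (ι m′) (ι n′) β h) (cong (ℚ._* h)
      (sym (trans (ι-sub (m * n′) (n * m′)) (cong₂ ℚ._-_ (ι-* m n′) (ι-* n m′)))))
      where
      e : ∀ m n m′ n′ β h →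
        (m ℚ.+ n ℚ.* β) ℚ.* (n′ ℚ.* h) ℚ.- n ℚ.* h ℚ.* (m′ ℚ.+ n′ ℚ.* β) ≡ (m ℚ.* n′ ℚ.- n ℚ.* m′) ℚ.* h
      e = RingSolver.solve-∀ ℚ-ring

    norm-elt : ∀ m n → norm K (elt m n) ≡ ι (m * m + b * (m * n) + P * (n * n))
    norm-elt m n = trans (e 𝔻 (ι m) (ι n) (ι b) h) (trans
      (cong (λ r → (ι m ℚ.+ ι n ℚ.* β) ℚ.* (ι m ℚ.+ ι n ℚ.* β) ℚ.- ι n ℚ.* ι n ℚ.* r) Dh²)
      (trans (e′ (ι m) (ι n) (ι b) (ι P)) (sym (ι-norm-form m n))))
      where
      e : ∀ D M N b h →
        (M ℚ.+ N ℚ.* (b ℚ.* ½)) ℚ.* (M ℚ.+ N ℚ.* (b ℚ.* ½)) ℚ.- D ℚ.* (N ℚ.* h ℚ.* (N ℚ.* h)) ≡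
        (M ℚ.+ N ℚ.* (b ℚ.* ½)) ℚ.* (M ℚ.+ N ℚ.* (b ℚ.* ½)) ℚ.- N ℚ.* N ℚ.* (D ℚ.* (h ℚ.* h))
      e = RingSolver.solve-∀ ℚ-ring
      e′ : ∀ M N b P →
        (M ℚ.+ N ℚ.* (b ℚ.* ½)) ℚ.* (M ℚ.+ N ℚ.* (b ℚ.* ½)) ℚ.- N ℚ.* N ℚ.* (b ℚ.* ½ ℚ.* (b ℚ.* ½) ℚ.- P) ≡
        M ℚ.* M ℚ.+ b ℚ.* (M ℚ.* N) ℚ.+ P ℚ.* (N ℚ.* N)
      e′ = RingSolver.solve-∀ ℚ-ring

    elt-+ : ∀ m n m′ n′ → _+ᴷ_ K (elt m n) (elt m′ n′) ≡ elt (m + m′) (n + n′)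
    elt-+ m n m′ n′ = element-≡
      (trans (e (ι m) (ι n) (ι m′) (ι n′) β) (sym (cong₂ (λ u v → u ℚ.+ v ℚ.* β) (ι-+ m m′) (ι-+ n n′))))
      (trans (sym (ℚ.*-distribʳ-+ h (ι n) (ι n′))) (cong (ℚ._* h) (sym (ι-+ n n′))))
      where
      e : ∀ m n m′ n′ β → m ℚ.+ n ℚ.* β ℚ.+ (m′ ℚ.+ n′ ℚ.* β) ≡ m ℚ.+ m′ ℚ.+ (n ℚ.+ n′) ℚ.* β
      e = RingSolver.solve-∀ ℚ-ring

    elt-* : ∀ r s m n → elt r s ⊗ elt m n ≡ elt (r * m - P * (s * n)) (r * n + s * m + b * (s * n))
    elt-* r s m n = element-≡
      (trans (e 𝔻 (ι r) (ι s) (ι m) (ι n) (ι b) h) (trans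
        (cong (λ u → (ι r ℚ.+ ι s ℚ.* β) ℚ.* (ι m ℚ.+ ι n ℚ.* β) ℚ.+ ι s ℚ.* ι n ℚ.* u) Dh²)
        (trans (e′ (ι r) (ι s) (ι m) (ι n) (ι b) (ι P)) (sym (cong₂ (λ u v → u ℚ.+ v ℚ.* β) re≡ im≡)))))
      (trans (e″ (ι r) (ι s) (ι m) (ι n) (ι b) h) (cong (ℚ._* h) (sym im≡)))
      where
      re≡ : ι (r * m - P * (s * n)) ≡ ι r ℚ.* ι m ℚ.- ι P ℚ.* (ι s ℚ.* ι n)
      re≡ = trans (ι-sub (r * m) (P * (s * n))) (cong₂ ℚ._-_ (ι-* r m) (trans (ι-* P (s * n)) (cong (ι P ℚ.*_) (ι-* s n))))
      im≡ : ι (r * n + s * m + b * (s * n)) ≡ ι r ℚ.* ι n ℚ.+ ι s ℚ.* ι m ℚ.+ ι b ℚ.* (ι s ℚ.* ι n)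
      im≡ = trans (ι-+ (r * n + s * m) (b * (s * n))) (cong₂ ℚ._+_
        (trans (ι-+ (r * n) (s * m)) (cong₂ ℚ._+_ (ι-* r n) (ι-* s m)))
        (trans (ι-* b (s * n)) (cong (ι b ℚ.*_) (ι-* s n))))
      e : ∀ D r s m n b h →
        (r ℚ.+ s ℚ.* (b ℚ.* ½)) ℚ.* (m ℚ.+ n ℚ.* (b ℚ.* ½)) ℚ.+ D ℚ.* (s ℚ.* h ℚ.* (n ℚ.* h)) ≡
        (r ℚ.+ s ℚ.* (b ℚ.* ½)) ℚ.* (m ℚ.+ n ℚ.* (b ℚ.* ½)) ℚ.+ s ℚ.* n ℚ.* (D ℚ.* (h ℚ.* h))
      e = RingSolver.solve-∀ ℚ-ring
      e′ : ∀ r s m n b P →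
        (r ℚ.+ s ℚ.* (b ℚ.* ½)) ℚ.* (m ℚ.+ n ℚ.* (b ℚ.* ½)) ℚ.+ s ℚ.* n ℚ.* (b ℚ.* ½ ℚ.* (b ℚ.* ½) ℚ.- P) ≡
        r ℚ.* m ℚ.- P ℚ.* (s ℚ.* n) ℚ.+ (r ℚ.* n ℚ.+ s ℚ.* m ℚ.+ b ℚ.* (s ℚ.* n)) ℚ.* (b ℚ.* ½)
      e′ = RingSolver.solve-∀ ℚ-ring
      e″ : ∀ r s m n b h →
        (r ℚ.+ s ℚ.* (b ℚ.* ½)) ℚ.* (n ℚ.* h) ℚ.+ s ℚ.* h ℚ.* (m ℚ.+ n ℚ.* (b ℚ.* ½)) ≡
        (r ℚ.* n ℚ.+ s ℚ.* m ℚ.+ b ℚ.* (s ℚ.* n)) ℚ.* h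
      e″ = RingSolver.solve-∀ ℚ-ring

    elt-0 : elt 0ℤ 0ℤ ≡ 0ᴷ K
    elt-0 = element-≡ (e β) (e′ h)
      where
      e : ∀ β → 0ℚ ℚ.+ 0ℚ ℚ.* β ≡ 0ℚ
      e = RingSolver.solve-∀ ℚ-ring
      e′ : ∀ h → 0ℚ ℚ.* h ≡ 0ℚ
      e′ = RingSolver.solve-∀ ℚ-ring

    embed-elt : ∀ m → embed K (ι m) ≡ elt m 0ℤ
    embed-elt m = element-≡ (e (ι m) β) (e′ h)
      where
      e : ∀ m β → m ≡ m ℚ.+ 0ℚ ℚ.* β
      e = RingSolver.solve-∀ ℚ-ring
      e′ : ∀ h → 0ℚ ≡ 0ℚ ℚ.* h
      e′ = RingSolver.solve-∀ ℚ-ring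

    private
      coordinates : ∀ α → α ∈ 𝓞 K → ∃₂ λ m n → α ≡ _+ᴷ_ K (embed K (ι m) ⊗ ω₁) (embed K (ι n) ⊗ ω₂)
      coordinates = proj₁ (proj₂ (proj₂ basis))

    -- (1, θ) and (ω₁, ω₂) have the same determinant, so the former is also a basis of 𝓞.
    𝓞⊆elt : ∀ {α} → α ∈ 𝓞 K → ∃₂ λ m n → α ≡ elt m n
    𝓞⊆elt {α} α∈ = expand (coordinates (elt 1ℤ 0ℤ) (elt∈𝓞 1ℤ 0ℤ)) (coordinates (elt 0ℤ 1ℤ) (elt∈𝓞 0ℤ 1ℤ)) (coordinates α α∈)
      where
      Coords : Element K → Set
      Coords α = ∃₂ λ m n → α ≡ _+ᴷ_ K (embed K (ι m) ⊗ ω₁) (embed K (ι n) ⊗ ω₂)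
      x₁ = re ω₁
      y₁ = im ω₁
      x₂ = re ω₂
      y₂ = im ω₂
      expand : Coords (elt 1ℤ 0ℤ) → Coords (elt 0ℤ 1ℤ) → Coords α → ∃₂ λ m n → α ≡ elt m n
      expand (p , q , one) (r , s , theta) (m , n , α≡) = m * s - n * r , n * p - m * q ,
        trans α≡ (element-≡ re≡ im≡)
        where
        re-coord : ∀ m n → ι m ℚ.* x₁ ℚ.+ 𝔻 ℚ.* (0ℚ ℚ.* y₁) ℚ.+ (ι n ℚ.* x₂ ℚ.+ 𝔻 ℚ.* (0ℚ ℚ.* y₂)) ≡ ι m ℚ.* x₁ ℚ.+ ι n ℚ.* x₂
        re-coord m n = e 𝔻 (ι m) (ι n) x₁ y₁ x₂ y₂
          where
          e : ∀ D m n x₁ y₁ x₂ y₂ → m ℚ.* x₁ ℚ.+ D ℚ.* (0ℚ ℚ.* y₁) ℚ.+ (n ℚ.* x₂ ℚ.+ D ℚ.* (0ℚ ℚ.* y₂)) ≡ m ℚ.* x₁ ℚ.+ n ℚ.* x₂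
          e = RingSolver.solve-∀ ℚ-ring
        im-coord : ∀ m n → ι m ℚ.* y₁ ℚ.+ 0ℚ ℚ.* x₁ ℚ.+ (ι n ℚ.* y₂ ℚ.+ 0ℚ ℚ.* x₂) ≡ ι m ℚ.* y₁ ℚ.+ ι n ℚ.* y₂
        im-coord m n = e (ι m) (ι n) x₁ y₁ x₂ y₂
          where
          e : ∀ m n x₁ y₁ x₂ y₂ → m ℚ.* y₁ ℚ.+ 0ℚ ℚ.* x₁ ℚ.+ (n ℚ.* y₂ ℚ.+ 0ℚ ℚ.* x₂) ≡ m ℚ.* y₁ ℚ.+ n ℚ.* y₂
          e = RingSolver.solve-∀ ℚ-ring
        one-re : re (elt 1ℤ 0ℤ) ≡ ι p ℚ.* x₁ ℚ.+ ι q ℚ.* x₂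
        one-re = trans (cong re one) (re-coord p q)
        one-im : im (elt 1ℤ 0ℤ) ≡ ι p ℚ.* y₁ ℚ.+ ι q ℚ.* y₂
        one-im = trans (cong im one) (im-coord p q)
        theta-re : re (elt 0ℤ 1ℤ) ≡ ι r ℚ.* x₁ ℚ.+ ι s ℚ.* x₂
        theta-re = trans (cong re theta) (re-coord r s)
        theta-im : im (elt 0ℤ 1ℤ) ≡ ι r ℚ.* y₁ ℚ.+ ι s ℚ.* y₂
        theta-im = trans (cong im theta) (im-coord r s)

        index≡1 : ι (p * s - q * r) ≡ 1ℚ
        index≡1 = ℚ-cancelˡ h≢0 (trans (cong (h ℚ.*_) (trans (ι-sub (p * s) (q * r)) (cong₂ ℚ._-_ (ι-* p s) (ι-* q r))))
          (trans (e (ι p) (ι q) (ι r) (ι s) x₁ y₁ x₂ y₂)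
            (trans (sym (cong₂ ℚ._-_ (cong₂ ℚ._*_ one-re theta-im) (cong₂ ℚ._*_ one-im theta-re))) (e′ β h))))
          where
          e : ∀ p q r s x₁ y₁ x₂ y₂ →
            (x₁ ℚ.* y₂ ℚ.- y₁ ℚ.* x₂) ℚ.* (p ℚ.* s ℚ.- q ℚ.* r) ≡
            (p ℚ.* x₁ ℚ.+ q ℚ.* x₂) ℚ.* (r ℚ.* y₁ ℚ.+ s ℚ.* y₂) ℚ.- (p ℚ.* y₁ ℚ.+ q ℚ.* y₂) ℚ.* (r ℚ.* x₁ ℚ.+ s ℚ.* x₂)
          e = RingSolver.solve-∀ ℚ-ring
          e′ : ∀ β h → (1ℚ ℚ.+ 0ℚ ℚ.* β) ℚ.* (1ℚ ℚ.* h) ℚ.- 0ℚ ℚ.* h ℚ.* (0ℚ ℚ.+ 1ℚ ℚ.* β) ≡ h ℚ.* 1ℚ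
          e′ = RingSolver.solve-∀ ℚ-ring

        k : ℚ
        k = ι p ℚ.* ι s ℚ.- ι q ℚ.* ι r
        k≡1 : k ≡ 1ℚ
        k≡1 = trans (sym (trans (ι-sub (p * s) (q * r)) (cong₂ ℚ._-_ (ι-* p s) (ι-* q r)))) index≡1
        U V : ℚ
        U = ι (m * s - n * r)
        V = ι (n * p - m * q)
        U≡ : U ≡ ι m ℚ.* ι s ℚ.- ι n ℚ.* ι r
        U≡ = trans (ι-sub (m * s) (n * r)) (cong₂ ℚ._-_ (ι-* m s) (ι-* n r))
        V≡ : V ≡ ι n ℚ.* ι p ℚ.- ι m ℚ.* ι q
        V≡ = trans (ι-sub (n * p) (m * q)) (cong₂ ℚ._-_ (ι-* n p) (ι-* m q))

        combine : ∀ z₁ z₂ o t → o ≡ ι p ℚ.* z₁ ℚ.+ ι q ℚ.* z₂ → t ≡ ι r ℚ.* z₁ ℚ.+ ι s ℚ.* z₂ →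
          ι m ℚ.* z₁ ℚ.+ ι n ℚ.* z₂ ≡ U ℚ.* o ℚ.+ V ℚ.* t
        combine z₁ z₂ o t o≡ t≡ = trans (sym (trans (cong (ℚ._* (ι m ℚ.* z₁ ℚ.+ ι n ℚ.* z₂)) k≡1) (ℚ.*-identityˡ _)))
          (trans (e (ι p) (ι q) (ι r) (ι s) (ι m) (ι n) z₁ z₂) (sym (cong₂ ℚ._+_ (cong₂ ℚ._*_ U≡ o≡) (cong₂ ℚ._*_ V≡ t≡))))
          where
          e : ∀ p q r s m n z₁ z₂ → (p ℚ.* s ℚ.- q ℚ.* r) ℚ.* (m ℚ.* z₁ ℚ.+ n ℚ.* z₂) ≡
            (m ℚ.* s ℚ.- n ℚ.* r) ℚ.* (p ℚ.* z₁ ℚ.+ q ℚ.* z₂) ℚ.+ (n ℚ.* p ℚ.- m ℚ.* q) ℚ.* (r ℚ.* z₁ ℚ.+ s ℚ.* z₂)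
          e = RingSolver.solve-∀ ℚ-ring

        re≡ : ι m ℚ.* x₁ ℚ.+ 𝔻 ℚ.* (0ℚ ℚ.* y₁) ℚ.+ (ι n ℚ.* x₂ ℚ.+ 𝔻 ℚ.* (0ℚ ℚ.* y₂)) ≡ U ℚ.+ V ℚ.* β
        re≡ = trans (re-coord m n) (trans (combine x₁ x₂ _ _ one-re theta-re) (e U V β))
          where
          e : ∀ U V β → U ℚ.* (1ℚ ℚ.+ 0ℚ ℚ.* β) ℚ.+ V ℚ.* (0ℚ ℚ.+ 1ℚ ℚ.* β) ≡ U ℚ.+ V ℚ.* β
          e = RingSolver.solve-∀ ℚ-ring
        im≡ : ι m ℚ.* y₁ ℚ.+ 0ℚ ℚ.* x₁ ℚ.+ (ι n ℚ.* y₂ ℚ.+ 0ℚ ℚ.* x₂) ≡ V ℚ.* h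
        im≡ = trans (im-coord m n) (trans (combine y₁ y₂ _ _ one-im theta-im) (e U V h))
          where
          e : ∀ U V h → U ℚ.* (0ℚ ℚ.* h) ℚ.+ V ℚ.* (1ℚ ℚ.* h) ≡ V ℚ.* h
          e = RingSolver.solve-∀ ℚ-ring

    -- The lattice ℤA + ℤθ is closed under multiplication by θ because A divides P: the constant
    -- part of θ(Am + nθ) is -ACn.
    ideal : ∀ A C → A * C ≡ P → Ideal K
    ideal A C AC≡P = record
      { carrier = λ α → ∃₂ λ m n → α ≡ elt (A * m) n
      ; integral = λ { (m , n , refl) → elt∈𝓞 (A * m) n }
      ; 0∈ = 0ℤ , 0ℤ , trans (sym elt-0) (cong (λ r → elt r 0ℤ) (sym (ℤ.*-zeroʳ A)))
      ; +-closed = λ { (m , n , refl) (m′ , n′ , refl) → m + m′ , n + n′ ,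
          trans (elt-+ (A * m) n (A * m′) n′) (cong (λ r → elt r (n + n′)) (sym (ℤ.*-distribˡ-+ A m m′))) }
      ; *-closed = λ { ρ∈ (m , n , refl) → multiple (𝓞⊆elt ρ∈) m n }
      ; generators = elt (A * 1ℤ) 0ℤ ∷ elt (A * 0ℤ) 1ℤ ∷ []
      ; generators⊆ = (1ℤ , 0ℤ , refl) All.∷ (0ℤ , 1ℤ , refl) All.∷ All.[]
      ; spanned = λ { (m , n , refl) → subst (Span K _) (combination m n) (embed∈𝓞 m ∷ embed∈𝓞 n ∷ []) }
      }
      where
      embed∈𝓞 : ∀ m → embed K (ι m) ∈ 𝓞 K
      embed∈𝓞 m = subst (𝓞 K) (sym (embed-elt m)) (elt∈𝓞 m 0ℤ)

      multiple : ∀ {ρ} → (∃₂ λ r s → ρ ≡ elt r s) → ∀ m n → ∃₂ λ m′ n′ → ρ ⊗ elt (A * m) n ≡ elt (A * m′) n′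
      multiple (r , s , refl) m n = r * m - C * (s * n) , r * n + s * (A * m) + b * (s * n) ,
        trans (elt-* r s (A * m) n) (cong (λ u → elt u (r * n + s * (A * m) + b * (s * n)))
          (trans (cong (λ P → r * (A * m) - P * (s * n)) (sym AC≡P)) (e A C r s m n)))
        where
        e : ∀ A C r s m n → r * (A * m) - A * C * (s * n) ≡ A * (r * m - C * (s * n))
        e = solve-∀

      combination : ∀ m n → _+ᴷ_ K (embed K (ι m) ⊗ elt (A * 1ℤ) 0ℤ)
          (_+ᴷ_ K (embed K (ι n) ⊗ elt (A * 0ℤ) 1ℤ) (0ᴷ K)) ≡ elt (A * m) n
      combination m n = trans (cong₂ (_+ᴷ_ K)
          (trans (cong (_⊗ elt (A * 1ℤ) 0ℤ) (embed-elt m)) (elt-* m 0ℤ (A * 1ℤ) 0ℤ))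
          (trans (cong₂ (_+ᴷ_ K) (trans (cong (_⊗ elt (A * 0ℤ) 1ℤ) (embed-elt n)) (elt-* n 0ℤ (A * 0ℤ) 1ℤ)) (sym elt-0))
            (elt-+ (n * (A * 0ℤ) - P * (0ℤ * 1ℤ)) (n * 1ℤ + 0ℤ * (A * 0ℤ) + b * (0ℤ * 1ℤ)) 0ℤ 0ℤ)))
        (trans (elt-+ (m * (A * 1ℤ) - P * (0ℤ * 0ℤ)) (m * 0ℤ + 0ℤ * (A * 1ℤ) + b * (0ℤ * 0ℤ))
            (n * (A * 0ℤ) - P * (0ℤ * 1ℤ) + 0ℤ) (n * 1ℤ + 0ℤ * (A * 0ℤ) + b * (0ℤ * 1ℤ) + 0ℤ))
          (cong₂ elt (e₁ A P m n) (e₂ A b m n)))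
        where
        e₁ : ∀ A P m n → m * (A * 1ℤ) - P * (0ℤ * 0ℤ) + (n * (A * 0ℤ) - P * (0ℤ * 1ℤ) + 0ℤ) ≡ A * m
        e₁ = solve-∀
        e₂ : ∀ A b m n → m * 0ℤ + 0ℤ * (A * 1ℤ) + b * (0ℤ * 0ℤ) + (n * 1ℤ + 0ℤ * (A * 0ℤ) + b * (0ℤ * 1ℤ) + 0ℤ) ≡ n
        e₂ = solve-∀

    -- Otherwise D h² would be the square β², although √D is irrational and h ≠ 0.
    P≢0 : P ≢ 0ℤ
    P≢0 P≡0 = h≢0 (x²≡Dy²⇒y≡0 {β} {h} (sym (trans Dh² (trans (cong (λ P → β ℚ.* β ℚ.- ι P) P≡0) (ℚ.+-identityʳ (β ℚ.* β))))))

    ideal-nonzero : ∀ A C AC≡P → Nonzero K (ideal A C AC≡P)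
    ideal-nonzero A C AC≡P = elt (A * 0ℤ) 1ℤ , (0ℤ , 1ℤ , refl) ,
      λ eq → h≢0 (trans (sym (ℚ.*-identityˡ h)) (cong im eq))

    private
      unit : ∀ g k → g * k ≡ 1ℤ → g ≡ 1ℤ ⊎ g ≡ - 1ℤ
      unit g k gk≡1 = sign g (ℕ.m*n≡1⇒m≡1 ∣ g ∣ ∣ k ∣ (trans (sym (ℤ.abs-* g k)) (cong ∣_∣ gk≡1)))
        where
        sign : ∀ g → ∣ g ∣ ≡ 1 → g ≡ 1ℤ ⊎ g ≡ - 1ℤ
        sign (+ _) refl = inj₁ refl
        sign -[1+ 0 ] refl = inj₂ refl

    -- If α I = β 𝓞 for the ideal I = ℤA + ℤθ then β = αγ, where γ = Am + nθ generates I.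
    -- Comparing determinants of ℤ-bases, N(γ) = A(Am² + bmn + Cn²) divides A.
    class-number-one⇒unit-value : ClassNumberOne K → ∀ A C → A * C ≡ P → A ≢ 0ℤ →
      ∃₂ λ m n → let g = A * (m * m) + b * (m * n) + C * (n * n) in g ≡ 1ℤ ⊎ g ≡ - 1ℤ
    class-number-one⇒unit-value one A C AC≡P A≢0 =
      -- The ideal with A = 1 is ℤ + ℤθ, the whole of 𝓞.
      conclude (one (ideal A C AC≡P) (ideal 1ℤ P (ℤ.*-identityˡ P)) (ideal-nonzero A C AC≡P) (ideal-nonzero 1ℤ P (ℤ.*-identityˡ P)))
      where
      conclude : SameClass K (ideal A C AC≡P) (ideal 1ℤ P (ℤ.*-identityˡ P)) →
        ∃₂ λ m n → let g = A * (m * m) + b * (m * n) + C * (n * n) in g ≡ 1ℤ ⊎ g ≡ - 1ℤ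
      conclude (α , β , (_ , α≢0) , _ , α⊆β , β⊆α) = compare α β α≢0
        (β⊆α (elt (1ℤ * 1ℤ) 0ℤ , (1ℤ , 0ℤ , refl) , refl))
        (α⊆β (elt (A * 1ℤ) 0ℤ , (1ℤ , 0ℤ , refl) , refl))
        (α⊆β (elt (A * 0ℤ) 1ℤ , (0ℤ , 1ℤ , refl) , refl))
        where
        compare : ∀ α β → α ≢ 0ᴷ K →
          (∃ λ σ → (∃₂ λ m n → σ ≡ elt (A * m) n) × β ⊗ elt (1ℤ * 1ℤ) 0ℤ ≡ α ⊗ σ) →
          (∃ λ σ → (∃₂ λ x y → σ ≡ elt (1ℤ * x) y) × α ⊗ elt (A * 1ℤ) 0ℤ ≡ β ⊗ σ) →
          (∃ λ σ → (∃₂ λ x y → σ ≡ elt (1ℤ * x) y) × α ⊗ elt (A * 0ℤ) 1ℤ ≡ β ⊗ σ) →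
          ∃₂ λ m n → let g = A * (m * m) + b * (m * n) + C * (n * n) in g ≡ 1ℤ ⊎ g ≡ - 1ℤ
        compare α β α≢0 (_ , (m , n , refl) , β≡) (_ , (x , y , refl) , αA≡) (_ , (x′ , y′ , refl) , αθ≡) =
          m , n , unit g k gk≡1
          where
          g k : ℤ
          g = A * (m * m) + b * (m * n) + C * (n * n)
          k = 1ℤ * x * y′ - y * (1ℤ * x′)

          norm-β : norm K β ≡ norm K α ℚ.* ι (A * g)
          norm-β = trans (sym (ℚ.*-identityʳ (norm K β)))
            (trans (cong (norm K β ℚ.*_) (trans (cong ι (sym (e₁ b P))) (sym (norm-elt (1ℤ * 1ℤ) 0ℤ))))
            (trans (sym (norm-* β (elt (1ℤ * 1ℤ) 0ℤ))) (trans (cong (norm K) β≡)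
            (trans (norm-* α (elt (A * m) n)) (cong (norm K α ℚ.*_) (trans (norm-elt (A * m) n) (cong ι
              (trans (cong (λ P → A * m * (A * m) + b * (A * m * n) + P * (n * n)) (sym AC≡P)) (e₂ A C b m n)))))))))
            where
            e₁ : ∀ b P → 1ℤ * 1ℤ * (1ℤ * 1ℤ) + b * (1ℤ * 1ℤ * 0ℤ) + P * (0ℤ * 0ℤ) ≡ 1ℤ
            e₁ = solve-∀
            e₂ : ∀ A C b m n → A * m * (A * m) + b * (A * m * n) + A * C * (n * n) ≡
              A * (A * (m * m) + b * (m * n) + C * (n * n))
            e₂ = solve-∀

          dets : norm K α ℚ.* (ι A ℚ.* h) ≡ norm K β ℚ.* (ι k ℚ.* h)
          dets = trans (cong (λ r → norm K α ℚ.* (ι r ℚ.* h)) (sym (e A)))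
            (trans (cong (norm K α ℚ.*_) (sym (det-elt (A * 1ℤ) 0ℤ (A * 0ℤ) 1ℤ)))
            (trans (sym (det-* α (elt (A * 1ℤ) 0ℤ) (elt (A * 0ℤ) 1ℤ))) (trans (cong₂ det αA≡ αθ≡)
            (trans (det-* β (elt (1ℤ * x) y) (elt (1ℤ * x′) y′)) (cong (norm K β ℚ.*_) (det-elt (1ℤ * x) y (1ℤ * x′) y′))))))
            where
            e : ∀ A → A * 1ℤ * 1ℤ - 0ℤ * (A * 0ℤ) ≡ A
            e = solve-∀

          A≡Agk : A * (g * k) ≡ A * 1ℤ
          A≡Agk = ι-injective (sym (ℚ-cancelˡ h≢0 (ℚ-cancelˡ (norm≢0 α≢0)
            (trans (trans (cong (norm K α ℚ.*_) (trans (ℚ.*-comm h (ι (A * 1ℤ))) (cong (λ r → ι r ℚ.* h) (ℤ.*-identityʳ A))))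
              (trans dets (cong (ℚ._* (ι k ℚ.* h)) norm-β)))
              (trans (e (norm K α) (ι (A * g)) (ι k) h) (cong (λ r → norm K α ℚ.* (h ℚ.* r))
                (trans (sym (ι-* (A * g) k)) (cong ι (ℤ.*-assoc A g k)))))))))
            where
            e : ∀ N g k h → N ℚ.* g ℚ.* (k ℚ.* h) ≡ N ℚ.* (h ℚ.* (g ℚ.* k))
            e = RingSolver.solve-∀ ℚ-ring

          gk≡1 : g * k ≡ 1ℤ
          gk≡1 = ℤ.*-cancelˡ-≡ A (g * k) 1ℤ {{ℤ.≢-nonZero A≢0}} A≡Agk

-- The automorph of a quadratic form

rational : ℚ → ℝ
rational c = record
  { L = ℚ._< c
  ; U = c ℚ.<_
  ; L-inhabited = c ℚ.- 1ℚ , subst (c ℚ.- 1ℚ ℚ.<_) (ℚ.+-identityʳ c) (ℚ.+-monoʳ-< c (ℚ.*<* -<+))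
  ; U-inhabited = c ℚ.+ 1ℚ , subst (ℚ._< c ℚ.+ 1ℚ) (ℚ.+-identityʳ c) (ℚ.+-monoʳ-< c (ℚ.*<* (+<+ (s≤s z≤n))))
  ; L-lower = ℚ.<-trans
  ; U-upper = λ q<r c<q → ℚ.<-trans c<q q<r
  ; L-open = λ q<c → let (r , q<r , r<c) = ℚ.<-dense q<c in r , q<r , r<c
  ; U-open = λ c<r → let (q , c<q , q<r) = ℚ.<-dense c<r in q , q<r , c<q
  ; disjoint = ℚ.<-asym
  ; located = located
  }
  where
  located : ∀ {q r} → q ℚ.< r → q ℚ.< c ⊎ c ℚ.< r
  located {q} q<r with q ℚ.<? c
  ... | yes q<c = inj₁ q<c
  ... | no q≮c = inj₂ (ℚ.≤-<-trans (ℚ.≮⇒≥ q≮c) q<r)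

-- Bounding d below by the single term (s/t) p^(m/k) = 8 p²⁴ is enough.
large⇒4p²<d : ∀ {p d} .{{_ : ℕ.NonZero p}} ε → Positive ε → d ≥ rational (ι (+ 9)) · p ^ (ι (+ 24) ⊕ ε) → 4 ℕ.* (p ℕ.* p) ℕ.< d
large⇒4p²<d {p} {d} ε 0<ε d≥ = begin-strict
  4 ℕ.* (p ℕ.* p)      <⟨ ℕ.*-monoˡ-< (p ℕ.* p) {{ℕ.m*n≢0 p p}} {4} {8} (s≤s (s≤s (s≤s (s≤s (s≤s z≤n))))) ⟩
  8 ℕ.* (p ℕ.* p)      ≡⟨ cong (λ q → 8 ℕ.* (p ℕ.* q)) (ℕ.*-identityʳ p) ⟨
  8 ℕ.* p ℕ.^ 2        ≤⟨ ℕ.*-monoʳ-≤ 8 (ℕ.^-monoʳ-≤ p (s≤s (s≤s (z≤n {22})))) ⟩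
  8 ℕ.* p ℕ.^ 24       ≤⟨ d≥ 8 1 24 1 (ℚ.*<* (+<+ (ℕ.n<1+n 8))) 0<ε ⟩
  (d ℕ.* 1) ℕ.^ 1      ≡⟨ trans (ℕ.*-identityʳ (d ℕ.* 1)) (ℕ.*-identityʳ d) ⟩
  d                    ∎
  where open ℕ.≤-Reasoning

p∤±1 : ∀ {p} → Prime p → ∀ {g} → g ≡ 1ℤ ⊎ g ≡ - 1ℤ → ¬ + p ∣ˢ g
p∤±1 pp (inj₁ refl) = p∤1 pp
p∤±1 pp (inj₂ refl) p∣ = p∤1 pp (∣.∣m⇒∣-m {m = - 1ℤ} p∣)

square-unit : ∀ {g} → g ≡ 1ℤ ⊎ g ≡ - 1ℤ → g * g ≡ 1ℤ
square-unit (inj₁ refl) = refl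
square-unit (inj₂ refl) = refl

module Automorph (a b c d U V : ℤ) (disc : b * b - + 4 * a * c ≡ d) (pell : U * U - d * (V * V) ≡ + 4) where

  -- The product (U - bV)(U + bV) = 4 - 4acV² is even, so one factor is even; the factors differ by
  -- 2bV, so both are.
  half : ∃ λ k → U + b * V ≡ + 2 * k
  half = choose (euclid prime[2] {U - b * V} {U + b * V} (divides (+ 2 - + 2 * (a * c * (V * V)))
      (trans (e a b c U V) (trans (cong (λ r → r - + 4 * (a * c * (V * V))) (trans (cong (λ d → U * U - d * (V * V)) disc) pell)) (e′ (a * c * (V * V)))))))
    where
    e : ∀ a b c U V → (U - b * V) * (U + b * V) ≡ U * U - (b * b - + 4 * a * c) * (V * V) - + 4 * (a * c * (V * V))
    e = solve-∀
    e′ : ∀ r → + 4 - + 4 * r ≡ (+ 2 - + 2 * r) * + 2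
    e′ = solve-∀
    choose : + 2 ∣ˢ U - b * V ⊎ + 2 ∣ˢ U + b * V → ∃ λ k → U + b * V ≡ + 2 * k
    choose (inj₁ (divides q eq)) = q + b * V , trans (e″ U (b * V)) (trans (cong (_+ + 2 * (b * V)) eq) (e‴ q (b * V)))
      where
      e″ : ∀ U r → U + r ≡ U - r + + 2 * r
      e″ = solve-∀
      e‴ : ∀ q r → q * + 2 + + 2 * r ≡ + 2 * (q + r)
      e‴ = solve-∀
    choose (inj₂ (divides q eq)) = q , trans eq (ℤ.*-comm q (+ 2))

  k : ℤ
  k = proj₁ half

  U≡ : U ≡ k + (k - b * V)
  U≡ = trans (e U (b * V)) (trans (cong (_- b * V) (proj₂ half)) (e′ k (b * V)))
    where
    e : ∀ U r → U ≡ U + r - r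
    e = solve-∀
    e′ : ∀ k r → + 2 * k - r ≡ k + (k - r)
    e′ = solve-∀

  automorph-det : k * (k - b * V) - c * V * (- (a * V)) ≡ 1ℤ
  automorph-det = ℤ.*-cancelˡ-≡ (+ 4) _ 1ℤ (trans (e a b c k V) (trans
      (cong₂ (λ u d → u * u - d * (V * V)) (sym U≡) disc) pell))
    where
    e : ∀ a b c k V → + 4 * (k * (k - b * V) - c * V * (- (a * V))) ≡
      (k + (k - b * V)) * (k + (k - b * V)) - (b * b - + 4 * a * c) * (V * V)
    e = solve-∀

  automorph : SL₂ℤ
  automorph = mat k (c * V) (- (a * V)) (k - b * V) automorph-det

  tr-automorph : tr automorph ≡ U
  tr-automorph = sym U≡

  tr²-4 : tr automorph * tr automorph - + 4 ≡ d * (V * V)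
  tr²-4 = trans (cong₂ (λ t r → t * t - r) tr-automorph (sym pell)) (e U (d * (V * V)))
    where
    e : ∀ U r → U * U - (U * U - r) ≡ r
    e = solve-∀

  formOf-automorph : ∀ x z → formOf automorph x z ≡ - (V * (a * (x * x) + b * (x * z) + c * (z * z)))
  formOf-automorph = e a b c k V
    where
    e : ∀ a b c k V x z → x * (- (a * V) * x + (k - b * V) * z) - z * (k * x + c * V * z) ≡
      - (V * (a * (x * x) + b * (x * z) + c * (z * z)))
    e = solve-∀

  has-entries : ∀ {u v} → u ≡ ι U ℚ.* ½ → v ≡ ι V ℚ.* ½ →
    HasEntries automorph (u ℚ.+ ι b ℚ.* v) (ι (+ 2) ℚ.* ι c ℚ.* v) (ℚ.- (ι (+ 2) ℚ.* ι a ℚ.* v)) (u ℚ.- ι b ℚ.* v)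
  has-entries refl refl = record
    { eq₁₁ = trans (e₁ (ι k) (ι b) (ι V)) (cong (λ u → u ℚ.* ½ ℚ.+ ι b ℚ.* (ι V ℚ.* ½)) (sym ιU))
    ; eq₁₂ = trans (ι-* c V) (e₂ (ι c) (ι V))
    ; eq₂₁ = trans (ι-neg (a * V)) (cong ℚ.-_ (trans (ι-* a V) (e₂ (ι a) (ι V))))
    ; eq₂₂ = trans (trans (ι-sub k (b * V)) (cong (λ r → ι k ℚ.- r) (ι-* b V))) (trans (e₃ (ι k) (ι b) (ι V))
        (cong (λ u → u ℚ.* ½ ℚ.- ι b ℚ.* (ι V ℚ.* ½)) (sym ιU)))
    }
    where
    ιU : ι U ≡ ι k ℚ.+ (ι k ℚ.- ι b ℚ.* ι V)
    ιU = trans (cong ι U≡) (trans (ι-+ k (k - b * V)) (cong (ι k ℚ.+_) (trans (ι-sub k (b * V)) (cong (λ r → ι k ℚ.- r) (ι-* b V)))))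
    e₁ : ∀ k b V → k ≡ (k ℚ.+ (k ℚ.- b ℚ.* V)) ℚ.* ½ ℚ.+ b ℚ.* (V ℚ.* ½)
    e₁ = RingSolver.solve-∀ ℚ-ring
    e₂ : ∀ c V → c ℚ.* V ≡ ι (+ 2) ℚ.* c ℚ.* (V ℚ.* ½)
    e₂ = RingSolver.solve-∀ ℚ-ring
    e₃ : ∀ k b V → k ℚ.- b ℚ.* V ≡ (k ℚ.+ (k ℚ.- b ℚ.* V)) ℚ.* ½ ℚ.- b ℚ.* (V ℚ.* ½)
    e₃ = RingSolver.solve-∀ ℚ-ring

-- With U = 2u and V = 2v the equation has integer unknowns and right side 4.
record IntegralPell (d : ℕ) (u v : ℚ) : Set where
  constructor integral-pell
  field
    U V : ℤ
    u≡ : u ≡ ι U ℚ.* ½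
    v≡ : v ≡ ι V ℚ.* ½
    V≢0 : V ≢ 0ℤ
    pell : U * U - + d * (V * V) ≡ + 4

integralPell : ∀ {d u v} → PellSolution d u v → IntegralPell d u v
integralPell {d} record { u-half = U , refl ; v-half = V , refl ; 0<v = 0<v ; equation = equation } =
  integral-pell U V (/2≡*½ U) (/2≡*½ V) (λ V≡0 → ℚ.<-irrefl (sym (cong (ℚ._/ 2) V≡0)) 0<v)
    (ι-injective (trans (trans (ι-sub (U * U) (+ d * (V * V))) (cong₂ ℚ._-_ (ι-* U U) (trans (ι-* (+ d) (V * V)) (cong (ι (+ d) ℚ.*_) (ι-* V V)))))
      (trans (e (ι U) (ι (+ d)) (ι V)) (cong (ι (+ 4) ℚ.*_)
        (trans (cong₂ (λ u v → u ℚ.* u ℚ.- ι (+ d) ℚ.* (v ℚ.* v)) (sym (/2≡*½ U)) (sym (/2≡*½ V))) equation)))))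
  where
  e : ∀ U d V → U ℚ.* U ℚ.- d ℚ.* (V ℚ.* V) ≡ ι (+ 4) ℚ.* (U ℚ.* ½ ℚ.* (U ℚ.* ½) ℚ.- d ℚ.* (V ℚ.* ½ ℚ.* (V ℚ.* ½)))
  e = RingSolver.solve-∀ ℚ-ring

-- The automorph lies outside the group

module Main (p : ℕ) (pp : Prime p) (12∣p+1 : 12 ℕD.∣ p ℕ.+ 1) (F : FareySymbol p)
  (K : RealQuadraticField) (d : ℕ) (isDisc : IsDiscriminant K d) (one : ClassNumberOne K)
  (a b c : ℤ) (disc : b * b - + 4 * a * c ≡ + d) (p∣a : + p ∣ˢ a) (4p²<d : 4 ℕ.* (p ℕ.* p) ℕ.< d)
  (U V : ℤ) (V≢0 : V ≢ 0ℤ) (pell : U * U - + d * (V * V) ≡ + 4) where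

  open Automorph a b c (+ d) U V disc pell public

  automorph∈Γ₀ : automorph ∈ Γ₀ p
  automorph∈Γ₀ = ∣.∣⇒∣ᵤ {+ p} { - (a * V)} (∣.∣m⇒∣-m {m = a * V} (∣.∣m⇒∣m*n {m = a} V p∣a))

  private
    A : ℤ
    A = _∣ˢ_.quotient p∣a
    a≡ : a ≡ A * + p
    a≡ = _∣ˢ_.equality p∣a

    d≢0 : d ≢ 0
    d≢0 = ℕ.m<n⇒n≢0 4p²<d

    e₀ : ∀ A b c p → b * b - + 4 * (A * (c * p)) ≡ b * b - + 4 * (A * p) * c
    e₀ = solve-∀

    open Arithmetic.Order K isDisc d≢0 b (A * (c * + p))
      (trans (e₀ A b c (+ p)) (trans (cong (λ a → b * b - + 4 * a * c) (sym a≡)) disc))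
      using (P≢0; class-number-one⇒unit-value)

    A≢0 : A ≢ 0ℤ
    A≢0 A≡0 = P≢0 (cong (_* (c * + p)) A≡0)

    unit-value = class-number-one⇒unit-value one A (c * + p) refl A≢0

    x y z g : ℤ
    x = proj₁ unit-value
    y = proj₁ (proj₂ unit-value)
    z = + p * y
    g = A * (x * x) + b * (x * y) + c * + p * (y * y)

    g-unit : g ≡ 1ℤ ⊎ g ≡ - 1ℤ
    g-unit = proj₂ (proj₂ unit-value)

    -- The last term of `g` carries the factor p, so p ∣ x would make p divide ±1.
    p∤x : ¬ + p ∣ˢ x
    p∤x p∣x = p∤±1 pp g-unit (∣.∣m∣n⇒∣m+n (∣.∣m∣n⇒∣m+n
      (∣.∣n⇒∣m*n A {x * x} (∣.∣m⇒∣m*n {m = x} x p∣x)) (∣.∣n⇒∣m*n b {x * y} (∣.∣m⇒∣m*n {m = x} y p∣x)))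
      (∣.∣m⇒∣m*n {m = c * + p} (y * y) (∣.∣n⇒∣m*n c {+ p} ∣.∣-refl)))

    p∣z : + p ∣ˢ z
    p∣z = ∣.∣m⇒∣m*n {m = + p} y ∣.∣-refl

    -- With a = Ap and z = py every term of the form gains a factor p, so the value is -V p g with g
    -- = ±1.
    form² : formOf automorph x z * formOf automorph x z ≡ V * V * (+ p * + p)
    form² = trans (cong (λ f → f * f) (trans (formOf-automorph x z)
        (cong (λ a → - (V * (a * (x * x) + b * (x * z) + c * (z * z)))) a≡)))
      (trans (e A b c (+ p) V x y) (trans (cong (V * V * (+ p * + p) *_) (square-unit g-unit)) (ℤ.*-identityʳ _)))
      where
      e : ∀ A b c p V x y →
        (- (V * (A * p * (x * x) + b * (x * (p * y)) + c * (p * y * (p * y))))) *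
        (- (V * (A * p * (x * x) + b * (x * (p * y)) + c * (p * y * (p * y))))) ≡
        V * V * (p * p) * ((A * (x * x) + b * (x * y) + c * p * (y * y)) * (A * (x * x) + b * (x * y) + c * p * (y * y)))
      e = solve-∀

    0<V² : 0ℤ < V * V
    0<V² = 0<square V≢0

    form≢0 : formOf automorph x z ≢ 0ℤ
    form≢0 eq = ℤ.<-irrefl (sym (trans (sym form²) (cong (λ f → f * f) eq)))
      (0<* 0<V² (0<square {+ p} λ p≡0 → ℕ.≢-nonZero⁻¹ p {{prime⇒nonZero pp}} (ℤ.+-injective p≡0)))

    TraceBound : Set
    TraceBound = tr automorph * tr automorph - + 4 ≤ + 4 * (formOf automorph x z * formOf automorph x z)

    no-trace-bound : ¬ TraceBound
    no-trace-bound le = ℕ.<⇒≱ 4p²<d (ℤ.drop‿+≤+ (ℤ.*-cancelʳ-≤-pos (+ d) (+ (4 ℕ.* (p ℕ.* p))) (V * V) {{ℤ.positive 0<V²}}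
      (subst₂ _≤_ tr²-4 (trans (cong (+ 4 *_) form²) (trans (e (V * V) (+ p * + p)) (cong (_* (V * V)) 4p²))) le)))
      where
      e : ∀ u v → + 4 * (u * v) ≡ + 4 * v * u
      e = solve-∀
      4p² : + 4 * (+ p * + p) ≡ + (4 ℕ.* (p ℕ.* p))
      4p² = trans (cong (+ 4 *_) (sym (ℤ.pos-* p p))) (sym (ℤ.pos-* 4 (p ℕ.* p)))

  automorph∉H : ¬ automorph ∈ Generated PSL₂ℤ (FareySymbol.pairingMatrices F)
  automorph∉H M∈H = no-trace-bound (H-trace-bound pp 12∣p+1 F {automorph} M∈H {x} {z} p∣z p∤x form≢0)

corollary1p7 : (ε : ℝ) → Positive ε →
    ∃ λ (C : ℝ) → Positive C ×
    ((p : ℕ) → Prime p → 12 ℕD.∣ p ℕ.+ 1 →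
    (F : FareySymbol p) →
    (K : RealQuadraticField) (d : ℕ) → IsDiscriminant K d →
    ClassNumberOne K →
    (𝔭₁ 𝔭₂ : Ideal K) → SplitsAs K p 𝔭₁ 𝔭₂ →
    ¬ HasGeneratorOfPositiveNorm K 𝔭₁ →
    (u v : ℚ) → MinimalPellSolution d u v →
    (a b c : ℤ) → b ℤ.* b ℤ.- + 4 ℤ.* a ℤ.* c ≡ + d → + p ℤD.∣ a →
    d ≥ C · p ^ (ι (+ 24) ⊕ ε) →
    ∃ λ (M : SL₂ℤ) →
    HasEntries M (u ℚ.+ ι b ℚ.* v)           (ι (+ 2) ℚ.* ι c ℚ.* v)
    (ℚ.- (ι (+ 2) ℚ.* ι a ℚ.* v)) (u ℚ.- ι b ℚ.* v) ×
    M ∈ Γ₀ p ×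
    ¬ M ∈ Generated PSL₂ℤ (FareySymbol.pairingMatrices F))
-- One constant serves every ε. It is 9 because the cut for C p^(24 + ε) admits only coefficients
-- strictly below C, and 8 is the one evaluated.
corollary1p7 ε 0<ε = rational (ι (+ 9)) , ℚ.*<* (+<+ (s≤s z≤n)) ,
  λ p pp 12∣p+1 F K d isDisc one _ _ _ _ u v (solution , _) a b c disc p∣a d≥ →
    let open IntegralPell (integralPell solution)
        open Main p pp 12∣p+1 F K d isDisc one a b c disc (∣.∣ᵤ⇒∣ p∣a) (large⇒4p²<d {{prime⇒nonZero pp}} ε 0<ε d≥) U V V≢0 pell
    in automorph , has-entries u≡ v≡ , automorph∈Γ₀ , automorph∉H
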